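{- Let $d$ be a prime, let $m\geq 2$ and $n\geq 1$ be integers, and let $c_0$ be a root of $G_{d,m,n}(c)$. Set $K=\mathbb{Q}(c_0)$ with ring of integers $\mathcal{O}_K$. Then $d$ does not divide the index $[\mathcal{O}_K:\mathbb{Z}[c_0]]$.
   Context: For an integer $d\geq 2$ let $f_{c,d}(x)=x^d+c$, and write $f_{c,d}^k$ for the $k$-th iterate ($f_{c,d}^0(x)=x$); $f_{c,d}^k(0)\in\mathbb{Z}[c]$. Let $\mu$ be the Möbius function. For $m\geq 1$ set $$F_{d,m,n}(c)=\prod_{k\mid n}\left(\frac{f_{c,d}^{m+k}(0)-f_{c,d}^m(0)}{f_{c,d}^{m-1+k}(0)-f_{c,d}^{m-1}(0)}\right)^{\mu(n/k)},$$ and for $m\geq 2$ define $G_{d,m,n}(c)=F_{d,m,n}(c)$ if $n\nmid m-1$, and $G_{d,m,n}(c)=F_{d,m,n}(c)/F_{d,1,n}(c)$ if $n\mid m-1$. These are monic polynomials in $\mathbb{Z}[c]$, so $c_0$ is an algebraic integer. -}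

module Defs where

open import Level using (0ℓ)
open import Algebra.Bundles using (RawRing)
open import Data.Nat as ℕ using (ℕ; zero; suc; _≤?_; _<_)
open import Data.Nat.Divisibility using (_∣?_)
open import Data.Nat.DivMod using (_/_)
open import Data.Integer as ℤ using (ℤ; +_; -[1+_])
import Data.Rational as ℚ
open ℚ using (ℚ)
open import Data.Fin using (Fin)
open import Data.List using (List; []; _∷_; map; foldr; filter; upTo)
open import Data.Product using (Σ; _×_; _,_; proj₁; proj₂)
open import Data.Sum using (_⊎_)
open import Data.Bool using (if_then_else_)
open import Relation.Nullary using (¬_; does)
open import Relation.Binary.PropositionalEquality using (_≡_)

-- Univariate polynomials over a raw ring, as coefficient lists
-- (lowest degree first).  Equality is coefficientwise, with missing
-- coefficients read as 0, so trailing zeros are irrelevant.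

module Poly (R : RawRing 0ℓ 0ℓ) where
  open RawRing R renaming (Carrier to A)

  P : Set
  P = List A

  coeff : P → ℕ → A
  coeff []      _       = 0#
  coeff (a ∷ p) zero    = a
  coeff (a ∷ p) (suc i) = coeff p i

  infix 4 _≈ₚ_ _∣ₚ_
  infixl 6 _+ₚ_ _-ₚ_
  infixl 7 _*ₚ_

  _≈ₚ_ : P → P → Set
  p ≈ₚ q = ∀ i → coeff p i ≡ coeff q i

  _+ₚ_ : P → P → P
  []      +ₚ q       = q
  (a ∷ p) +ₚ []      = a ∷ p
  (a ∷ p) +ₚ (b ∷ q) = (a + b) ∷ (p +ₚ q)

  -ₚ_ : P → P
  -ₚ p = map (-_) p

  _-ₚ_ : P → P → P
  p -ₚ q = p +ₚ (-ₚ q)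

  _*ₚ_ : P → P → P
  []      *ₚ q = []
  (a ∷ p) *ₚ q = map (a *_) q +ₚ (0# ∷ (p *ₚ q))

  constP : A → P
  constP a = a ∷ []

  oneP : P
  oneP = constP 1#

  X : P
  X = 0# ∷ 1# ∷ []

  _^ₚ_ : P → ℕ → P
  p ^ₚ zero  = oneP
  p ^ₚ suc k = p *ₚ (p ^ₚ k)

  _∣ₚ_ : P → P → Set
  p ∣ₚ q = Σ P λ r → p *ₚ r ≈ₚ q

  Monic : P → Set
  Monic p = Σ ℕ λ k → (coeff p k ≡ 1#) × (∀ j → k < j → coeff p j ≡ 0#)

  IsConstant : P → Set
  IsConstant p = ∀ i → 0 < i → coeff p i ≡ 0#

  -- irreducible (A a field): nonconstant, and every factorisation has a
  -- constant (necessarily unit) factor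
  Irreducible : P → Set
  Irreducible p = ¬ IsConstant p × (∀ a b → a *ₚ b ≈ₚ p → IsConstant a ⊎ IsConstant b)

  compose : P → P → P
  compose h α = foldr (λ a acc → constP a +ₚ α *ₚ acc) [] h

module ℤ[x] = Poly ℤ.+-*-rawRing
module ℚ[x] = Poly ℚ.+-*-rawRing

ZPoly : Set
ZPoly = ℤ[x].P

QPoly : Set
QPoly = ℚ[x].P

toQ : ZPoly → QPoly
toQ = map (λ z → z ℚ./ 1)

-- Möbius function (by trial division; μ 0 is irrelevant)

-- mob fuel n q : Möbius value of n, assuming n has no prime factor < 2+q
mob : ℕ → ℕ → ℕ → ℤ
mob zero    n q = + 1
mob (suc f) n q =
  if does (n ≤? 1) then + 1
  else if does ((2 ℕ.+ q) ∣? n)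
       then (if does ((2 ℕ.+ q) ℕ.* (2 ℕ.+ q) ∣? n) then + 0
             else ℤ.- mob f (n / (2 ℕ.+ q)) (suc q))
       else mob f n (suc q)

μ : ℕ → ℤ
μ n = mob n n 0

-- The critical orbit f_{c,d}^k(0) ∈ ℤ[c], f_{c,d}(x) = x^d + c

open ℤ[x] using (_+ₚ_; _-ₚ_; _*ₚ_; _^ₚ_; oneP; X; _≈ₚ_)

orbit : ℕ → ℕ → ZPoly
orbit d zero    = []
orbit d (suc k) = (orbit d k ^ₚ d) +ₚ X

A : ℕ → ℕ → ℕ → ZPoly
A d j k = orbit d (j ℕ.+ k) -ₚ orbit d j

divisors : ℕ → List ℕ
divisors n = filter (λ k → k ∣? n) (upTo (suc n))

safeDiv : ℕ → ℕ → ℕ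
safeDiv n zero    = 0
safeDiv n (suc k) = n / suc k

contrib : ℤ → ZPoly → ZPoly → ZPoly × ZPoly
contrib (+ 1)      a b = a , b
contrib -[1+ 0 ]   a b = b , a
contrib _          a b = oneP , oneP

-- numerator and denominator of F_{d,m,n} as a product of polynomials:
-- F_{d,m,n} = ∏_{k ∣ n} (A d m k / A d (m-1) k)^{μ(n/k)} = Fnum / Fden
FnumDen : ℕ → ℕ → ℕ → ZPoly × ZPoly
FnumDen d m n =
  foldr (λ k acc → let c = contrib (μ (safeDiv n k)) (A d m k) (A d (m ℕ.∸ 1) k)
                   in (proj₁ c *ₚ proj₁ acc) , (proj₂ c *ₚ proj₂ acc))
        (oneP , oneP) (divisors n)

Fnum Fden : ℕ → ℕ → ℕ → ZPoly
Fnum d m n = proj₁ (FnumDen d m n)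
Fden d m n = proj₂ (FnumDen d m n)

-- g is (the polynomial) G_{d,m,n}:
--   n ∤ m-1 :  g = F_{d,m,n}               i.e.  g · Fden_m = Fnum_m
--   n ∣ m-1 :  g = F_{d,m,n} / F_{d,1,n}   i.e.  g · Fden_m · Fnum_1 = Fnum_m · Fden_1
IsG : ℕ → ℕ → ℕ → ZPoly → Set
IsG d m n g =
  if does (n ∣? (m ℕ.∸ 1))
  then g *ₚ Fden d m n *ₚ Fnum d 1 n ≈ₚ Fnum d m n *ₚ Fden d 1 n
  else g *ₚ Fden d m n ≈ₚ Fnum d m n

-- The number field K = ℚ[x]/(p) for p ∈ ℚ[x] monic irreducible
-- (p = minimal polynomial of c₀, and c₀ = class of x).

module NumberField (p : QPoly) where
  open ℚ[x] using (_∣ₚ_) renaming (_-ₚ_ to _-q_; compose to composeQ)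

  _≈K_ : QPoly → QPoly → Set
  α ≈K β = p ∣ₚ (α -q β)

  IsAlgInt : QPoly → Set
  IsAlgInt α = Σ ZPoly λ h → ℤ[x].Monic h × (composeQ (toQ h) α ≈K [])

  OK : Set
  OK = Σ QPoly IsAlgInt

  -- congruence modulo ℤ[c₀] = image of ℤ[x]
  _∼_ : OK → OK → Set
  a ∼ b = Σ ZPoly λ z → (proj₁ a -q proj₁ b) ≈K toQ z

  -- [𝒪_K : ℤ[c₀]] = N : the quotient 𝒪_K/ℤ[c₀] is in bijection with Fin N
  IndexIs : ℕ → Set
  IndexIs N =
    Σ (OK → Fin N) λ f → Σ (Fin N → OK) λ g →
      (∀ a b → a ∼ b → f a ≡ f b) × (∀ i → f (g i) ≡ i) × (∀ a → g (f a) ∼ a)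

{-# OPTIONS --safe #-}

-- Write a k for the critical orbit f^k(0) and Δ j k = a (j + k) − a j.  Then Δ (j + 1) k = Δ j k · B j k
-- with B j k = Δ^(d−1) + d (Δ y + (a j)^(d−1)) for Δ = Δ j k, which is a multiple of a k and is
-- congruent to (a k)^(d^j) modulo d.  Let π = a n and R = ℤ[c₀].
-- (1) Modulo d, g is coprime to a j unless n ∣ j.  Otherwise some proper ideal contains g and a j, and
--     may be assumed to contain each a k or be comaximal to it (enlarge it, under a double negation).
--     Let n₀ be the least index with a n₀ in it.  As a (q n₀) = a n₀ (1 + a n₀ r), the factor a n₀
--     occurs in g to a power that is a multiple of Σ μ(n/k) over n₀ ∣ k ∣ n; this sum is 0 since n₀ ≠ n.
-- (2) By (1) the factors k ≠ n of G are units modulo d at c₀, so the factor k = n gives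
--     d (1 + d y) ∈ π R, and π^E ∈ d R for some E.
-- (3) In F_d[x]/(π) the Frobenius is surjective, because π = (a (n − 1))^d + x.  So this finite-dimensional
--     algebra is reduced, and even b ∈ (b^k) for all b and k.
-- (4) If α is integral and b = π^(j+1) α ∈ R, then b^k ∈ π R for some k, so b ∈ (π, d) by (3), hence
--     π^j α ∈ R by (2).  Thus d α ∈ R implies α ∈ R: the finite group 𝒪_K / R has no d-torsion, so
--     its order is prime to d.

module Submission where

open import Defs
open import Level using (0ℓ)
open import Algebra.Bundles using (RawRing; CommutativeRing; AbelianGroup)
open import Algebra.Structures using (IsCommutativeRing; IsAbelianGroup)
open import Algebra.Solver.Ring.AlmostCommutativeRing using (fromCommutativeRing; _-Raw-AlmostCommutative⟶_)
import Algebra.Properties.CommutativeMonoid.Sum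
import Algebra.Properties.CommutativeSemiring.Binomial
import Algebra.Properties.CommutativeSemiring.Exp
import Algebra.Properties.Group
import Algebra.Properties.Monoid.Mult
import Algebra.Properties.Monoid.Sum
import Algebra.Properties.Ring
import Algebra.Solver.Ring
import Algebra.Solver.Ring.NaturalCoefficients.Default
open import Data.Bool using (Bool; true; false; if_then_else_; _∧_; T)
open import Data.Empty using (⊥; ⊥-elim)
open import Data.Fin as Fin using (Fin)
import Data.Fin.Properties as Fin
open import Data.Fin.Permutation using (Permutation; permutation)
open import Data.Integer as ℤ using (ℤ)
import Data.Integer.Properties as ℤ
import Data.Integer.Divisibility.Signed as ℤ∣
import Data.Integer.Solver as ℤSolver
open import Data.List using (List; []; _∷_; _++_; map; foldr; length; replicate; take; filter; filterᵇ; upTo; allFin; cartesianProductWith)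
import Data.List.Properties as List
open import Data.List.Membership.Propositional using (_∈_)
open import Data.List.Membership.Propositional.Properties using (∈-++⁻; ∈-++⁺ˡ; ∈-++⁺ʳ; ∈-∃++; ∈-filter⁻; ∈-filter⁺; ∈-upTo⁻; ∈-upTo⁺; ∈-allFin; ∈-cartesianProductWith⁺; ∈-cartesianProductWith⁻)
open import Data.List.Relation.Unary.All as All using (All; []; _∷_)
open import Data.List.Relation.Unary.Any using (here; there)
open import Data.List.Relation.Unary.Unique.Propositional using (Unique; []; _∷_)
import Data.List.Relation.Unary.Unique.Propositional.Properties as Unique
open import Data.Maybe as Maybe using (Maybe)
open import Data.Nat as ℕ using (ℕ; zero; suc; z≤n; s≤s; _≤_)
import Data.Nat.Properties as ℕ
open import Data.Nat.Combinatorics using (_C_; nCn≡1; nC1≡n; k![n∸k]!∣n!)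
open import Data.Nat.Combinatorics.Specification using (nCk≡n!/k![n-k]!)
open import Data.Nat.Coprimality using (Coprime; coprime-Bézout)
open import Data.Nat.Divisibility as ℕ∣ using (_∣_; _∣?_; divides)
open import Data.Nat.DivMod as DivMod using (_/_; _%_; m≡m%n+[m/n]*n; m%n<n)
open import Data.Nat.GCD using (module Bézout)
open import Data.Nat.Primality using (Prime; euclidsLemma; prime⇒irreducible; prime⇒nonTrivial; _Rough_; 2-rough; rough⇒≤; ∤⇒rough-suc; rough∧∣⇒rough; rough∧∣⇒prime)
open import Data.Product using (Σ; _×_; _,_; proj₁; proj₂)
import Data.Rational as ℚ
import Data.Rational.Properties as ℚ
open import Data.Rational.Unnormalised as ℚᵘ using (mkℚᵘ; *≡*)
import Data.Rational.Unnormalised.Properties as ℚᵘ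
open import Data.Sum using (_⊎_; inj₁; inj₂)
open import Relation.Nullary using (¬_; contradiction; does; yes; no)
open import Relation.Nullary.Decidable using (dec⇒maybe; dec-true; dec-false; T?)
import Relation.Binary.PropositionalEquality as ≡
open ≡ using (_≡_; _≢_)
import Relation.Binary.Reasoning.Setoid

-- Polynomial rings

-- In geometric terms R is regular above d. Since π^E ∈ d R, every prime over d contains π; since d
-- (1 + d y) ∈ π R, the ideal (π, d) is locally generated by π; and R/(π, d) is a quotient of
-- F_d[x]/(π), hence a product of fields. So π generates each prime over d locally. Step (4) carries
-- this out with the denominator 1 + d y written explicitly, without localising or factoring π
-- modulo d. The obstacle is constructive: there is no maximal ideal to choose and no decision
-- whether a k is a unit modulo an ideal. The goal d ∤ N is a negation, so double negations can be
-- carried to the very end. In step (2), d has to survive with a unit beside it. With l = m - 1,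
-- modulo a n the factor B l n is d (a l)^(d-1), which suffices if a l is a unit modulo (d, g), so
-- if n does not divide l. If n ∣ l, then a l = a n w₀ vanishes modulo a n; dividing by F_{d,1,n}
-- removes the power (a n)^(d-1), and what remains is d w₀^(d-1) modulo a n with w₀ = 1 modulo a n.

module PolyRing (R : RawRing 0ℓ 0ℓ)
  (isCR : IsCommutativeRing _≡_ (RawRing._+_ R) (RawRing._*_ R) (RawRing.-_ R) (RawRing.0# R) (RawRing.1# R)) where

  open RawRing R
  open Poly R public
  private
    module R where
      commutativeRing : CommutativeRing 0ℓ 0ℓ
      commutativeRing = record { isCommutativeRing = isCR }
      open CommutativeRing commutativeRing public
    open Algebra.Solver.Ring.NaturalCoefficients.Default R.commutativeSemiring
    open Algebra.Properties.Ring R.ring using (-0#≈0#)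
    open ≡.≡-Reasoning

  coeff-+ : ∀ p q i → coeff (p +ₚ q) i ≡ coeff p i + coeff q i
  coeff-+ []      q       i       = ≡.sym (R.+-identityˡ _)
  coeff-+ (a ∷ p) []      i       = ≡.sym (R.+-identityʳ _)
  coeff-+ (a ∷ p) (b ∷ q) zero    = ≡.refl
  coeff-+ (a ∷ p) (b ∷ q) (suc i) = coeff-+ p q i

  coeff-neg : ∀ p i → coeff (-ₚ p) i ≡ - coeff p i
  coeff-neg []      i       = ≡.sym -0#≈0#
  coeff-neg (a ∷ p) zero    = ≡.refl
  coeff-neg (a ∷ p) (suc i) = coeff-neg p i

  coeff-scale : ∀ a p i → coeff (map (a *_) p) i ≡ a * coeff p i
  coeff-scale a []      i       = ≡.sym (R.zeroʳ a)
  coeff-scale a (b ∷ p) zero    = ≡.refl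
  coeff-scale a (b ∷ p) (suc i) = coeff-scale a p i

  coeff-*-zero : ∀ a p q → coeff ((a ∷ p) *ₚ q) 0 ≡ a * coeff q 0
  coeff-*-zero a p q = ≡.trans (coeff-+ (map (a *_) q) _ 0)
    (≡.trans (R.+-identityʳ _) (coeff-scale a q 0))

  coeff-*-suc : ∀ a p q i → coeff ((a ∷ p) *ₚ q) (suc i) ≡ a * coeff q (suc i) + coeff (p *ₚ q) i
  coeff-*-suc a p q i = ≡.trans (coeff-+ (map (a *_) q) _ (suc i))
    (≡.cong (_+ _) (coeff-scale a q (suc i)))

  +ₚ-cong : ∀ {p p′ q q′} → p ≈ₚ p′ → q ≈ₚ q′ → p +ₚ q ≈ₚ p′ +ₚ q′
  +ₚ-cong {p} {p′} {q} {q′} e f i = ≡.trans (coeff-+ p q i)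
    (≡.trans (≡.cong₂ _+_ (e i) (f i)) (≡.sym (coeff-+ p′ q′ i)))

  -ₚ-cong : ∀ {p q} → p ≈ₚ q → -ₚ p ≈ₚ -ₚ q
  -ₚ-cong {p} {q} e i = ≡.trans (coeff-neg p i)
    (≡.trans (≡.cong -_ (e i)) (≡.sym (coeff-neg q i)))

  *ₚ-congˡ : ∀ p {q q′} → q ≈ₚ q′ → p *ₚ q ≈ₚ p *ₚ q′
  *ₚ-congˡ []      e i = ≡.refl
  *ₚ-congˡ (a ∷ p) {q} {q′} e zero = ≡.trans (coeff-*-zero a p q)
    (≡.trans (≡.cong (a *_) (e 0)) (≡.sym (coeff-*-zero a p q′)))
  *ₚ-congˡ (a ∷ p) {q} {q′} e (suc i) = ≡.trans (coeff-*-suc a p q i)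
    (≡.trans (≡.cong₂ _+_ (≡.cong (a *_) (e (suc i))) (*ₚ-congˡ p e i)) (≡.sym (coeff-*-suc a p q′ i)))

  *ₚ-zeroʳ : ∀ p → p *ₚ [] ≈ₚ []
  *ₚ-zeroʳ []      i       = ≡.refl
  *ₚ-zeroʳ (a ∷ p) zero    = ≡.refl
  *ₚ-zeroʳ (a ∷ p) (suc i) = *ₚ-zeroʳ p i

  -- Multiplication recurses on its left factor; commutativity needs this matching recursion on the
  -- right one.
  *ₚ-∷ʳ-suc : ∀ p b q i → coeff (p *ₚ (b ∷ q)) (suc i) ≡ b * coeff p (suc i) + coeff (p *ₚ q) i
  *ₚ-∷ʳ-suc [] b q i = ≡.sym (≡.trans (R.+-identityʳ _) (R.zeroʳ b))
  *ₚ-∷ʳ-suc (a ∷ p) b q zero = begin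
    coeff ((a ∷ p) *ₚ (b ∷ q)) 1              ≡⟨ coeff-*-suc a p (b ∷ q) 0 ⟩
    a * coeff q 0 + coeff (p *ₚ (b ∷ q)) 0    ≡⟨ ≡.cong (a * coeff q 0 +_) (*ₚ-∷ʳ-zero p) ⟩
    a * coeff q 0 + b * coeff p 0             ≡⟨ R.+-comm _ _ ⟩
    b * coeff p 0 + a * coeff q 0             ≡⟨ ≡.cong (b * coeff p 0 +_) (≡.sym (coeff-*-zero a p q)) ⟩
    b * coeff p 0 + coeff ((a ∷ p) *ₚ q) 0    ∎
    where
    *ₚ-∷ʳ-zero : ∀ p → coeff (p *ₚ (b ∷ q)) 0 ≡ b * coeff p 0
    *ₚ-∷ʳ-zero []      = ≡.sym (R.zeroʳ b)
    *ₚ-∷ʳ-zero (c ∷ p) = ≡.trans (coeff-*-zero c p (b ∷ q)) (R.*-comm c b)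
  *ₚ-∷ʳ-suc (a ∷ p) b q (suc i) = begin
    coeff ((a ∷ p) *ₚ (b ∷ q)) (suc (suc i))                         ≡⟨ coeff-*-suc a p (b ∷ q) (suc i) ⟩
    a * coeff q (suc i) + coeff (p *ₚ (b ∷ q)) (suc i)               ≡⟨ ≡.cong (a * coeff q (suc i) +_) (*ₚ-∷ʳ-suc p b q i) ⟩
    a * coeff q (suc i) + (b * coeff p (suc i) + coeff (p *ₚ q) i)
      ≡⟨ solve 3 (λ x y z → x :+ (y :+ z) := y :+ (x :+ z)) ≡.refl (a * coeff q (suc i)) (b * coeff p (suc i)) _ ⟩
    b * coeff p (suc i) + (a * coeff q (suc i) + coeff (p *ₚ q) i)   ≡⟨ ≡.cong (b * coeff p (suc i) +_) (≡.sym (coeff-*-suc a p q i)) ⟩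
    b * coeff p (suc i) + coeff ((a ∷ p) *ₚ q) (suc i)               ∎

  *ₚ-comm : ∀ p q → p *ₚ q ≈ₚ q *ₚ p
  *ₚ-comm []      q       i       = ≡.sym (*ₚ-zeroʳ q i)
  *ₚ-comm (a ∷ p) []      i       = *ₚ-zeroʳ (a ∷ p) i
  *ₚ-comm (a ∷ p) (b ∷ q) zero    = ≡.trans (coeff-*-zero a p (b ∷ q))
    (≡.trans (R.*-comm a b) (≡.sym (coeff-*-zero b q (a ∷ p))))
  *ₚ-comm (a ∷ p) (b ∷ q) (suc i) = ≡.trans (coeff-*-suc a p (b ∷ q) i)
    (≡.trans (≡.cong (a * coeff q i +_) (*ₚ-comm p (b ∷ q) i)) (≡.sym (*ₚ-∷ʳ-suc (b ∷ q) a p i)))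

  *ₚ-cong : ∀ {p p′ q q′} → p ≈ₚ p′ → q ≈ₚ q′ → p *ₚ q ≈ₚ p′ *ₚ q′
  *ₚ-cong {p} {p′} {q} {q′} e f i = ≡.trans (*ₚ-congˡ p f i)
    (≡.trans (*ₚ-comm p q′ i) (≡.trans (*ₚ-congˡ q′ e i) (*ₚ-comm q′ p′ i)))

  *ₚ-distribʳ : ∀ r p q → (p +ₚ q) *ₚ r ≈ₚ p *ₚ r +ₚ q *ₚ r
  *ₚ-distribʳ r []      q       i = ≡.refl
  *ₚ-distribʳ r (a ∷ p) []      i = ≡.sym (≡.trans (coeff-+ ((a ∷ p) *ₚ r) [] i) (R.+-identityʳ _))
  *ₚ-distribʳ r (a ∷ p) (b ∷ q) zero = begin
    coeff ((a + b ∷ p +ₚ q) *ₚ r) 0                       ≡⟨ coeff-*-zero (a + b) (p +ₚ q) r ⟩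
    (a + b) * coeff r 0                                   ≡⟨ R.distribʳ _ a b ⟩
    a * coeff r 0 + b * coeff r 0                         ≡⟨ ≡.sym (≡.cong₂ _+_ (coeff-*-zero a p r) (coeff-*-zero b q r)) ⟩
    coeff ((a ∷ p) *ₚ r) 0 + coeff ((b ∷ q) *ₚ r) 0       ≡⟨ ≡.sym (coeff-+ ((a ∷ p) *ₚ r) _ 0) ⟩
    coeff ((a ∷ p) *ₚ r +ₚ (b ∷ q) *ₚ r) 0                ∎
  *ₚ-distribʳ r (a ∷ p) (b ∷ q) (suc i) = begin
    coeff ((a + b ∷ p +ₚ q) *ₚ r) (suc i)
      ≡⟨ coeff-*-suc (a + b) (p +ₚ q) r i ⟩
    (a + b) * coeff r (suc i) + coeff ((p +ₚ q) *ₚ r) i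
      ≡⟨ ≡.cong ((a + b) * coeff r (suc i) +_) (≡.trans (*ₚ-distribʳ r p q i) (coeff-+ (p *ₚ r) _ i)) ⟩
    (a + b) * coeff r (suc i) + (coeff (p *ₚ r) i + coeff (q *ₚ r) i)
      ≡⟨ solve 5 (λ a b c x y → (a :+ b) :* c :+ (x :+ y) := (a :* c :+ x) :+ (b :* c :+ y)) ≡.refl a b _ _ _ ⟩
    (a * coeff r (suc i) + coeff (p *ₚ r) i) + (b * coeff r (suc i) + coeff (q *ₚ r) i)
      ≡⟨ ≡.sym (≡.cong₂ _+_ (coeff-*-suc a p r i) (coeff-*-suc b q r i)) ⟩
    coeff ((a ∷ p) *ₚ r) (suc i) + coeff ((b ∷ q) *ₚ r) (suc i)
      ≡⟨ ≡.sym (coeff-+ ((a ∷ p) *ₚ r) _ (suc i)) ⟩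
    coeff ((a ∷ p) *ₚ r +ₚ (b ∷ q) *ₚ r) (suc i)          ∎

  scale-*ₚ : ∀ a p q → map (a *_) p *ₚ q ≈ₚ map (a *_) (p *ₚ q)
  scale-*ₚ a []      q i       = ≡.refl
  scale-*ₚ a (b ∷ p) q zero    = begin
    coeff ((a * b ∷ map (a *_) p) *ₚ q) 0  ≡⟨ coeff-*-zero (a * b) (map (a *_) p) q ⟩
    a * b * coeff q 0                      ≡⟨ R.*-assoc a b _ ⟩
    a * (b * coeff q 0)                    ≡⟨ ≡.cong (a *_) (≡.sym (coeff-*-zero b p q)) ⟩
    a * coeff ((b ∷ p) *ₚ q) 0             ≡⟨ ≡.sym (coeff-scale a ((b ∷ p) *ₚ q) 0) ⟩
    coeff (map (a *_) ((b ∷ p) *ₚ q)) 0    ∎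
  scale-*ₚ a (b ∷ p) q (suc i) = begin
    coeff ((a * b ∷ map (a *_) p) *ₚ q) (suc i)                ≡⟨ coeff-*-suc (a * b) (map (a *_) p) q i ⟩
    a * b * coeff q (suc i) + coeff (map (a *_) p *ₚ q) i
      ≡⟨ ≡.cong (a * b * coeff q (suc i) +_) (≡.trans (scale-*ₚ a p q i) (coeff-scale a (p *ₚ q) i)) ⟩
    a * b * coeff q (suc i) + a * coeff (p *ₚ q) i
      ≡⟨ solve 4 (λ a b c x → a :* b :* c :+ a :* x := a :* (b :* c :+ x)) ≡.refl a b _ _ ⟩
    a * (b * coeff q (suc i) + coeff (p *ₚ q) i)               ≡⟨ ≡.cong (a *_) (≡.sym (coeff-*-suc b p q i)) ⟩
    a * coeff ((b ∷ p) *ₚ q) (suc i)                           ≡⟨ ≡.sym (coeff-scale a ((b ∷ p) *ₚ q) (suc i)) ⟩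
    coeff (map (a *_) ((b ∷ p) *ₚ q)) (suc i)                  ∎

  shift-*ₚ : ∀ p q → (0# ∷ p) *ₚ q ≈ₚ 0# ∷ p *ₚ q
  shift-*ₚ p q zero    = ≡.trans (coeff-*-zero 0# p q) (R.zeroˡ _)
  shift-*ₚ p q (suc i) = ≡.trans (coeff-*-suc 0# p q i)
    (≡.trans (≡.cong (_+ coeff (p *ₚ q) i) (R.zeroˡ _)) (R.+-identityˡ _))

  *ₚ-assoc : ∀ p q r → (p *ₚ q) *ₚ r ≈ₚ p *ₚ (q *ₚ r)
  *ₚ-assoc []      q r i = ≡.refl
  *ₚ-assoc (a ∷ p) q r i = begin
    coeff ((map (a *_) q +ₚ (0# ∷ p *ₚ q)) *ₚ r) i            ≡⟨ *ₚ-distribʳ r (map (a *_) q) (0# ∷ p *ₚ q) i ⟩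
    coeff (map (a *_) q *ₚ r +ₚ (0# ∷ p *ₚ q) *ₚ r) i
      ≡⟨ +ₚ-cong {map (a *_) q *ₚ r} {map (a *_) (q *ₚ r)} {(0# ∷ p *ₚ q) *ₚ r} {0# ∷ p *ₚ (q *ₚ r)} (scale-*ₚ a q r) (λ j → ≡.trans (shift-*ₚ (p *ₚ q) r j) (∷-cong j)) i ⟩
    coeff (map (a *_) (q *ₚ r) +ₚ (0# ∷ p *ₚ (q *ₚ r))) i     ∎
    where
    ∷-cong : 0# ∷ (p *ₚ q) *ₚ r ≈ₚ 0# ∷ p *ₚ (q *ₚ r)
    ∷-cong zero    = ≡.refl
    ∷-cong (suc j) = *ₚ-assoc p q r j

  *ₚ-identityˡ : ∀ p → oneP *ₚ p ≈ₚ p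
  *ₚ-identityˡ p i = ≡.trans (coeff-+ (map (1# *_) p) (0# ∷ []) i)
    (≡.trans (≡.cong₂ _+_ (≡.trans (coeff-scale 1# p i) (R.*-identityˡ _)) (zeros i)) (R.+-identityʳ _))
    where
    zeros : 0# ∷ [] ≈ₚ []
    zeros zero    = ≡.refl
    zeros (suc i) = ≡.refl

  -- _≈ₚ_ is a function type, from which p and q cannot be inferred.
  infix 4 _≋_
  record _≋_ (p q : P) : Set where
    constructor by-coeff
    field at : p ≈ₚ q
  open _≋_ public

  abstract
    polyRing-isCommutativeRing : IsCommutativeRing _≋_ _+ₚ_ _*ₚ_ -ₚ_ [] oneP
    polyRing-isCommutativeRing = record
      { isRing = record
        { +-isAbelianGroup = record
          { isGroup = record
            { isMonoid = record
              { isSemigroup = record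
                { isMagma = record
                  { isEquivalence = record
                    { refl = by-coeff λ i → ≡.refl
                    ; sym = λ e → by-coeff λ i → ≡.sym (at e i)
                    ; trans = λ e f → by-coeff λ i → ≡.trans (at e i) (at f i) }
                  ; ∙-cong = λ {p} {p′} {q} {q′} e f → by-coeff (+ₚ-cong {p} {p′} {q} {q′} (at e) (at f)) }
                ; assoc = λ p q r → by-coeff λ i → begin
                    coeff (p +ₚ q +ₚ r) i                   ≡⟨ coeff-+ (p +ₚ q) r i ⟩
                    coeff (p +ₚ q) i + coeff r i            ≡⟨ ≡.cong (_+ coeff r i) (coeff-+ p q i) ⟩
                    coeff p i + coeff q i + coeff r i       ≡⟨ R.+-assoc _ _ _ ⟩
                    coeff p i + (coeff q i + coeff r i)     ≡⟨ ≡.cong (coeff p i +_) (coeff-+ q r i) ⟨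
                    coeff p i + coeff (q +ₚ r) i            ≡⟨ coeff-+ p (q +ₚ r) i ⟨
                    coeff (p +ₚ (q +ₚ r)) i                 ∎ }
              ; identity = (λ p → by-coeff λ i → ≡.refl)
                         , (λ p → by-coeff λ i → ≡.trans (coeff-+ p [] i) (R.+-identityʳ _)) }
            ; inverse = (λ p → by-coeff λ i → ≡.trans (coeff-+ (-ₚ p) p i)
                          (≡.trans (≡.cong (_+ coeff p i) (coeff-neg p i)) (R.-‿inverseˡ _)))
                      , (λ p → by-coeff λ i → ≡.trans (coeff-+ p (-ₚ p) i)
                          (≡.trans (≡.cong (coeff p i +_) (coeff-neg p i)) (R.-‿inverseʳ _)))
            ; ⁻¹-cong = λ {p} {q} e → by-coeff (-ₚ-cong {p} {q} (at e)) }
          ; comm = λ p q → by-coeff λ i → ≡.trans (coeff-+ p q i) (≡.trans (R.+-comm _ _) (≡.sym (coeff-+ q p i))) }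
        ; *-cong = λ {p} {p′} {q} {q′} e f → by-coeff (*ₚ-cong {p} {p′} {q} {q′} (at e) (at f))
        ; *-assoc = λ p q r → by-coeff (*ₚ-assoc p q r)
        ; *-identity = (λ p → by-coeff (*ₚ-identityˡ p))
                     , (λ p → by-coeff λ i → ≡.trans (*ₚ-comm p oneP i) (*ₚ-identityˡ p i))
        ; distrib = (λ p q r → by-coeff λ i → ≡.trans (*ₚ-comm p (q +ₚ r) i) (≡.trans (*ₚ-distribʳ p q r i)
                      (+ₚ-cong {q *ₚ p} {p *ₚ q} {r *ₚ p} {p *ₚ r} (*ₚ-comm q p) (*ₚ-comm r p) i)))
                  , (λ p q r → by-coeff (*ₚ-distribʳ p q r)) }
      ; *-comm = λ p q → by-coeff (*ₚ-comm p q) }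

  polyRing : CommutativeRing 0ℓ 0ℓ
  polyRing = record
    { Carrier = P ; _≈_ = _≋_ ; _+_ = _+ₚ_ ; _*_ = _*ₚ_ ; -_ = -ₚ_ ; 0# = [] ; 1# = oneP
    ; isCommutativeRing = polyRing-isCommutativeRing }


module ℤX = PolyRing ℤ.+-*-rawRing ℤ.+-*-isCommutativeRing
module ℚX = PolyRing ℚ.+-*-rawRing ℚ.+-*-isCommutativeRing

-- Ideals and quotients

-- The ring map from ℤ, in the form that the ring solver takes. It is carried along as data, so that
-- `ι c` can be a constant polynomial, its class in a quotient, or a rational constant.
ℤ→ : CommutativeRing 0ℓ 0ℓ → Set
ℤ→ T = ℤ.+-*-rawRing -Raw-AlmostCommutative⟶ fromCommutativeRing T

module ℤ-Solver (T : CommutativeRing 0ℓ 0ℓ) (φ : ℤ→ T) where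
  open CommutativeRing T using (_≈_; reflexive)
  open _-Raw-AlmostCommutative⟶_ φ using (⟦_⟧)

  private
    ⟦⟧-equal? : (a b : ℤ) → Maybe (⟦ a ⟧ ≈ ⟦ b ⟧)
    ⟦⟧-equal? a b = Maybe.map (λ e → reflexive (≡.cong ⟦_⟧ e)) (dec⇒maybe (a ℤ.≟ b))

  open Algebra.Solver.Ring ℤ.+-*-rawRing (fromCommutativeRing T) φ ⟦⟧-equal? public
    using (Polynomial; solve; _:+_; _:*_; :-_; _:-_; _:=_; con)

module ℤ-Algebra (T : CommutativeRing 0ℓ 0ℓ) (φ : ℤ→ T) where
  open CommutativeRing T public
  open _-Raw-AlmostCommutative⟶_ φ public renaming (⟦_⟧ to ι)
  open Algebra.Properties.CommutativeSemiring.Exp commutativeSemiring public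
  open Algebra.Properties.Ring ring public using (-‿distribˡ-*; -0#≈0#)
  module ≈-Reasoning = Relation.Binary.Reasoning.Setoid setoid
  open ℤ-Solver T φ using (solve; _:+_; _:*_; :-_; _:-_; _:=_; con)

  1^ : ∀ k → 1# ^ k ≈ 1#
  1^ zero    = refl
  1^ (suc k) = trans (*-identityˡ _) (1^ k)

  x-0≈x : ∀ x → x - 0# ≈ x
  x-0≈x x = trans (+-congˡ -0#≈0#) (+-identityʳ x)

  record Ideal : Set₁ where
    field
      Mem  : Carrier → Set
      resp : ∀ {x y} → x ≈ y → Mem x → Mem y
      mem0 : Mem 0#
      mem+ : ∀ {x y} → Mem x → Mem y → Mem (x + y)
      mem* : ∀ r {x} → Mem x → Mem (r * x)

    mem- : ∀ {x} → Mem x → Mem (- x)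
    mem- {x} h = resp (solve 1 (λ x → (:- con (ℤ.+ 1)) :* x := :- x) refl x) (mem* (- ι (ℤ.+ 1)) h)

    mem*ʳ : ∀ r {x} → Mem x → Mem (x * r)
    mem*ʳ r {x} h = resp (*-comm r x) (mem* r h)
  open Ideal public

  zeroIdeal : Ideal
  zeroIdeal = record
    { Mem = _≈ 0# ; resp = λ e h → trans (sym e) h ; mem0 = refl
    ; mem+ = λ h k → trans (+-cong h k) (+-identityˡ 0#)
    ; mem* = λ r h → trans (*-congˡ h) (zeroʳ r) }

  infixl 5 _⊕_
  -- A membership is a witness: for `zeroIdeal ⊕ a ⊕ b` it lists the coefficient of b, then that of
  -- a, then the equation. Later proofs read off cofactors in this order.
  _⊕_ : Ideal → Carrier → Ideal
  I ⊕ a = record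
    { Mem = λ x → Σ Carrier λ u → Mem I (x - u * a)
    ; resp = λ e (u , h) → u , resp I (+-congʳ e) h
    ; mem0 = 0# , resp I (sym (trans (+-congˡ (trans (-‿cong (zeroˡ a)) -0#≈0#)) (+-identityʳ 0#))) (mem0 I)
    ; mem+ = λ {x} {y} (u , h) (v , k) → u + v , resp I
        (solve 5 (λ x y u v a → (x :- u :* a) :+ (y :- v :* a) := (x :+ y) :- (u :+ v) :* a) refl x y u v a) (mem+ I h k)
    ; mem* = λ r {x} (u , h) → r * u , resp I
        (solve 4 (λ r x u a → r :* (x :- u :* a) := r :* x :- (r :* u) :* a) refl r x u a) (mem* I r h) }

  ⊕-old : ∀ I a {x} → Mem I x → Mem (I ⊕ a) x
  ⊕-old I a {x} h = 0# , resp I (sym (trans (+-congˡ (trans (-‿cong (zeroˡ a)) -0#≈0#)) (+-identityʳ x))) h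

  ⊕-new : ∀ I a → Mem (I ⊕ a) a
  ⊕-new I a = 1# , resp I (sym (trans (+-congˡ (-‿cong (*-identityˡ a))) (-‿inverseʳ a))) (mem0 I)

  ⊕-mono : ∀ I J a → (∀ {x} → Mem I x → Mem J x) → ∀ {x} → Mem (I ⊕ a) x → Mem (J ⊕ a) x
  ⊕-mono I J a I⊆J (u , h) = u , I⊆J h

  module Quotient (I : Ideal) where
    infix 4 _≈/_
    record _≈/_ (x y : Carrier) : Set where
      constructor mod
      field diff : Mem I (x - y)
    open _≈/_ public

    incl : ∀ {x y} → x ≈ y → x ≈/ y
    incl {x} {y} e = mod (resp I (sym (trans (+-congʳ e) (-‿inverseʳ y))) (mem0 I))

    mem⇒≈0 : ∀ {x} → Mem I x → x ≈/ 0#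
    mem⇒≈0 {x} h = mod (resp I (sym (x-0≈x x)) h)

    ≈0⇒mem : ∀ {x} → x ≈/ 0# → Mem I x
    ≈0⇒mem {x} (mod h) = resp I (x-0≈x x) h

    abstract
      isCommutativeRing/ : IsCommutativeRing _≈/_ _+_ _*_ -_ 0# 1#
      isCommutativeRing/ = record
        { isRing = record
          { +-isAbelianGroup = record
            { isGroup = record
              { isMonoid = record
                { isSemigroup = record
                  { isMagma = record
                    { isEquivalence = record
                      { refl = incl refl
                      ; sym = λ {x} {y} (mod h) → mod (resp I
                          (solve 2 (λ x y → :- (x :- y) := y :- x) refl x y) (mem- I h))
                      ; trans = λ {x} {y} {z} (mod h) (mod k) → mod (resp I
                          (solve 3 (λ x y z → (x :- y) :+ (y :- z) := x :- z) refl x y z) (mem+ I h k)) }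
                    ; ∙-cong = λ {x} {x′} {y} {y′} (mod h) (mod k) → mod (resp I
                        (solve 4 (λ x x′ y y′ → (x :- x′) :+ (y :- y′) := (x :+ y) :- (x′ :+ y′)) refl x x′ y y′)
                        (mem+ I h k)) }
                  ; assoc = λ x y z → incl (+-assoc x y z) }
                ; identity = (λ x → incl (+-identityˡ x)) , (λ x → incl (+-identityʳ x)) }
              ; inverse = (λ x → incl (-‿inverseˡ x)) , (λ x → incl (-‿inverseʳ x))
              ; ⁻¹-cong = λ {x} {y} (mod h) → mod (resp I
                  (solve 2 (λ x y → :- (x :- y) := :- x :- :- y) refl x y) (mem- I h)) }
            ; comm = λ x y → incl (+-comm x y) }
          ; *-cong = λ {x} {x′} {y} {y′} (mod h) (mod k) → mod (resp I
              (solve 4 (λ x x′ y y′ → y :* (x :- x′) :+ x′ :* (y :- y′) := x :* y :- x′ :* y′) refl x x′ y y′)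
              (mem+ I (mem* I y h) (mem* I x′ k)))
          ; *-assoc = λ x y z → incl (*-assoc x y z)
          ; *-identity = (λ x → incl (*-identityˡ x)) , (λ x → incl (*-identityʳ x))
          ; distrib = (λ x y z → incl (distribˡ x y z)) , (λ x y z → incl (distribʳ x y z)) }
        ; *-comm = λ x y → incl (*-comm x y) }

    quotient : CommutativeRing 0ℓ 0ℓ
    quotient = record
      { Carrier = Carrier ; _≈_ = _≈/_ ; _+_ = _+_ ; _*_ = _*_ ; -_ = -_ ; 0# = 0# ; 1# = 1#
      ; isCommutativeRing = isCommutativeRing/ }

    φ/ : ℤ→ quotient
    φ/ = record
      { ⟦_⟧ = ι
      ; +-homo = λ a b → incl (+-homo a b)
      ; *-homo = λ a b → incl (*-homo a b)
      ; -‿homo = λ a → incl (-‿homo a)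
      ; 0-homo = incl 0-homo
      ; 1-homo = incl 1-homo }

    module Pow = Algebra.Properties.CommutativeSemiring.Exp (CommutativeRing.commutativeSemiring quotient)

    -- A quotient keeps the elements and operations and only coarsens equality, so powers agree as
    -- elements and not merely modulo I.
    ^/≡^ : ∀ x k → x Pow.^ k ≡ x ^ k
    ^/≡^ x zero    = ≡.refl
    ^/≡^ x (suc k) = ≡.cong (x *_) (^/≡^ x k)

-- Integral elements

module Integrality (T : CommutativeRing 0ℓ 0ℓ) (φ : ℤ→ T) where
  open ℤ-Algebra T φ
  open ℤ-Solver T φ using (solve; _:+_; _:*_; :-_; _:-_; _:=_)
  open ≈-Reasoning
  open ℤ[x] using (coeff)

  ev : ZPoly → Carrier → Carrier
  ev []      γ = 0#
  ev (c ∷ p) γ = ι c + γ * ev p γ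

  ev-+ : ∀ p q γ → ev (p ℤ[x].+ₚ q) γ ≈ ev p γ + ev q γ
  ev-+ []      q       γ = sym (+-identityˡ _)
  ev-+ (a ∷ p) []      γ = sym (+-identityʳ _)
  ev-+ (a ∷ p) (b ∷ q) γ = trans (+-cong (+-homo a b) (*-congˡ (ev-+ p q γ)))
    (solve 5 (λ a b g x y → (a :+ b) :+ g :* (x :+ y) := (a :+ g :* x) :+ (b :+ g :* y)) refl (ι a) (ι b) γ _ _)

  ev-neg : ∀ p γ → ev (ℤ[x].-ₚ p) γ ≈ - ev p γ
  ev-neg []      γ = sym -0#≈0#
  ev-neg (a ∷ p) γ = trans (+-cong (-‿homo a) (*-congˡ (ev-neg p γ)))
    (solve 3 (λ a g x → :- a :+ g :* :- x := :- (a :+ g :* x)) refl (ι a) γ _)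

  ev-scale : ∀ c p γ → ev (map (c ℤ.*_) p) γ ≈ ι c * ev p γ
  ev-scale c []      γ = sym (zeroʳ _)
  ev-scale c (a ∷ p) γ = trans (+-cong (*-homo c a) (*-congˡ (ev-scale c p γ)))
    (solve 4 (λ c a g x → c :* a :+ g :* (c :* x) := c :* (a :+ g :* x)) refl (ι c) (ι a) γ _)

  ev-* : ∀ p q γ → ev (p ℤ[x].*ₚ q) γ ≈ ev p γ * ev q γ
  ev-* []      q γ = sym (zeroˡ _)
  ev-* (a ∷ p) q γ = begin
    ev (map (a ℤ.*_) q ℤ[x].+ₚ (ℤ.+ 0 ∷ p ℤ[x].*ₚ q)) γ      ≈⟨ ev-+ (map (a ℤ.*_) q) _ γ ⟩
    ev (map (a ℤ.*_) q) γ + (ι (ℤ.+ 0) + γ * ev (p ℤ[x].*ₚ q) γ)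
      ≈⟨ +-cong (ev-scale a q γ) (trans (+-congʳ 0-homo) (trans (+-identityˡ _) (*-congˡ (ev-* p q γ)))) ⟩
    ι a * ev q γ + γ * (ev p γ * ev q γ)
      ≈⟨ solve 4 (λ a g x y → a :* y :+ g :* (x :* y) := (a :+ g :* x) :* y) refl (ι a) γ _ _ ⟩
    (ι a + γ * ev p γ) * ev q γ ∎

  ev-shift : ∀ k p γ → ev (replicate k (ℤ.+ 0) ++ p) γ ≈ γ ^ k * ev p γ
  ev-shift zero    p γ = sym (*-identityˡ _)
  ev-shift (suc k) p γ = trans (+-cong 0-homo (*-congˡ (ev-shift k p γ)))
    (trans (+-identityˡ _) (sym (*-assoc γ _ _)))

  length-+ₚ : ∀ p q {D} → length p ℕ.≤ D → length q ℕ.≤ D → length (p ℤ[x].+ₚ q) ℕ.≤ D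
  length-+ₚ []      q       h k = k
  length-+ₚ (a ∷ p) []      h k = h
  length-+ₚ (a ∷ p) (b ∷ q) (s≤s h) (s≤s k) = s≤s (length-+ₚ p q h k)

  length-*ₚ : ∀ p q → length (p ℤ[x].*ₚ q) ℕ.≤ length p ℕ.+ length q
  length-*ₚ []      q = z≤n
  length-*ₚ (a ∷ p) q = length-+ₚ (map (a ℤ.*_) q) _
    (ℕ.≤-trans (ℕ.≤-reflexive (List.length-map _ q)) (ℕ.m≤n+m _ (suc (length p)))) (s≤s (length-*ₚ p q))

  length-shift : ∀ k (p : ZPoly) → length (replicate k (ℤ.+ 0) ++ p) ≡ k ℕ.+ length p
  length-shift zero    p = ≡.refl
  length-shift (suc k) p = ≡.cong suc (length-shift k p)

  -- W γ D vs t : t is a combination of vs whose coefficients are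
  -- polynomials in γ of degree less than D.
  W : Carrier → ℕ → List Carrier → Carrier → Set
  W γ D []       t = t ≈ 0#
  W γ D (v ∷ vs) t = Σ ZPoly λ p → length p ℕ.≤ D × W γ D vs (t - ev p γ * v)

  module _ {γ : Carrier} where

    W-resp : ∀ {D} vs {s t} → s ≈ t → W γ D vs s → W γ D vs t
    W-resp []       e h           = trans (sym e) h
    W-resp (v ∷ vs) e (p , l , h) = p , l , W-resp vs (+-congʳ e) h

    W-0 : ∀ {D} vs → W γ D vs 0#
    W-0 []       = refl
    W-0 (v ∷ vs) = [] , z≤n , W-resp vs (sym (trans (+-congˡ (trans (-‿cong (zeroˡ v)) -0#≈0#)) (+-identityʳ 0#))) (W-0 vs)

    W-+ : ∀ {D} vs {s t} → W γ D vs s → W γ D vs t → W γ D vs (s + t)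
    W-+ []       h k = trans (+-cong h k) (+-identityˡ 0#)
    W-+ (v ∷ vs) {s} {t} (p , l , h) (q , m , k) = p ℤ[x].+ₚ q , length-+ₚ p q l m , W-resp vs
      (trans (solve 5 (λ s t p q v → (s :- p :* v) :+ (t :- q :* v) := s :+ t :- (p :+ q) :* v) refl s t _ _ v)
             (+-congˡ (-‿cong (*-congʳ (sym (ev-+ p q γ))))))
      (W-+ vs h k)

    W-ev : ∀ {D E} vs q → length q ℕ.≤ E → ∀ {t} → W γ D vs t → W γ (E ℕ.+ D) vs (ev q γ * t)
    W-ev []       q l h = trans (*-congˡ h) (zeroʳ _)
    W-ev (v ∷ vs) q l {t} (p , m , h) = q ℤ[x].*ₚ p , ℕ.≤-trans (length-*ₚ q p) (ℕ.+-mono-≤ l m) , W-resp vs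
      (trans (solve 4 (λ t p q v → q :* (t :- p :* v) := q :* t :- (q :* p) :* v) refl t _ _ v)
             (+-congˡ (-‿cong (*-congʳ (sym (ev-* q p γ))))))
      (W-ev vs q l h)

    -- `W-ev` would charge E + 1 here, the length of the polynomial γ^E. The exact bound matters:
    -- the relation left at the end must have degree below that of its leading power.
    W-shift : ∀ {D} E vs {t} → W γ D vs t → W γ (E ℕ.+ D) vs (γ ^ E * t)
    W-shift E []       h = trans (*-congˡ h) (zeroʳ _)
    W-shift {D} E (v ∷ vs) {t} (p , m , h) = replicate E (ℤ.+ 0) ++ p
      , ℕ.≤-trans (ℕ.≤-reflexive (length-shift E p)) (ℕ.+-monoʳ-≤ E m)
      , W-resp vs
      (trans (solve 4 (λ t p q v → q :* (t :- p :* v) := q :* t :- (q :* p) :* v) refl t _ _ v)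
             (+-congˡ (-‿cong (*-congʳ (sym (ev-shift E p γ))))))
      (W-shift E vs h)

    W-gen : ∀ {D} vs {v} → v ∈ vs → ∀ p → length p ℕ.≤ D → W γ D vs (ev p γ * v)
    W-gen (v ∷ vs) (here ≡.refl) p l = p , l , W-resp vs (sym (-‿inverseʳ _)) (W-0 vs)
    W-gen (v ∷ vs) (there h)     p l = [] , z≤n , W-resp vs
      (sym (trans (+-congˡ (trans (-‿cong (zeroˡ v)) -0#≈0#)) (+-identityʳ _))) (W-gen vs h p l)

    -- Multiplying γ^D v = q u + w′ by γ^D − p, where (γ^D − p) u = w, removes u.
    eliminate : ∀ D u vs → (∀ {v} → v ∈ u ∷ vs → W γ D (u ∷ vs) (γ ^ D * v)) →
      ∀ {v} → v ∈ vs → W γ (D ℕ.+ D) vs (γ ^ (D ℕ.+ D) * v)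
    eliminate D u vs rel {v} v∈ =
      let p , lp , w  = rel (here ≡.refl)
          q , lq , w′ = rel (there v∈)
          x = γ ^ D
      in W-resp vs
        (trans (solve 5 (λ x p q u v →
             x :* p :* v :+ (q :* (x :* u :- p :* u) :+ (x :* (x :* v :- q :* u) :+ :- p :* (x :* v :- q :* u))) := x :* x :* v)
             refl x (ev p γ) (ev q γ) u v)
           (*-congʳ (sym (^-homo-* γ D D))))
        (W-+ vs (W-resp vs (*-congʳ (ev-shift D p γ))
                  (W-gen vs v∈ (replicate D (ℤ.+ 0) ++ p)
                    (ℕ.≤-trans (ℕ.≤-reflexive (length-shift D p)) (ℕ.+-monoʳ-≤ D lp))))
          (W-+ vs (W-ev vs q lq w)
            (W-+ vs (W-shift D vs w′)
              (W-resp vs (*-congʳ (ev-neg p γ))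
                (W-ev vs (ℤ[x].-ₚ p) (ℕ.≤-trans (ℕ.≤-reflexive (List.length-map _ p)) lp) w′)))))

  Span : List Carrier → Carrier → Set
  Span []       t = t ≈ 0#
  Span (v ∷ vs) t = Σ ℤ λ c → Span vs (t - ι c * v)

  Span-resp : ∀ vs {s t} → s ≈ t → Span vs s → Span vs t
  Span-resp []       e h       = trans (sym e) h
  Span-resp (v ∷ vs) e (c , h) = c , Span-resp vs (+-congʳ e) h

  x-0v≈x : ∀ x v → x - ι (ℤ.+ 0) * v ≈ x
  x-0v≈x x v = trans (+-congˡ (trans (-‿cong (trans (*-congʳ 0-homo) (zeroˡ v))) -0#≈0#)) (+-identityʳ x)

  Span-0 : ∀ vs → Span vs 0#
  Span-0 []       = refl
  Span-0 (v ∷ vs) = ℤ.+ 0 , Span-resp vs (sym (x-0v≈x 0# v)) (Span-0 vs)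

  Span-+ : ∀ vs {s t} → Span vs s → Span vs t → Span vs (s + t)
  Span-+ []       h k = trans (+-cong h k) (+-identityˡ 0#)
  Span-+ (v ∷ vs) {s} {t} (p , h) (q , k) = p ℤ.+ q , Span-resp vs
    (trans (solve 5 (λ s t p q v → (s :- p :* v) :+ (t :- q :* v) := s :+ t :- (p :+ q) :* v) refl s t _ _ v)
           (+-congˡ (-‿cong (*-congʳ (sym (+-homo p q))))))
    (Span-+ vs h k)

  Span-scale : ∀ vs c {t} → Span vs t → Span vs (ι c * t)
  Span-scale []       c h = trans (*-congˡ h) (zeroʳ _)
  Span-scale (v ∷ vs) c {t} (p , h) = c ℤ.* p , Span-resp vs
    (trans (solve 4 (λ t p q v → q :* (t :- p :* v) := q :* t :- (q :* p) :* v) refl t _ _ v)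
           (+-congˡ (-‿cong (*-congʳ (sym (*-homo c p))))))
    (Span-scale vs c h)

  Span-gen : ∀ vs {v} → v ∈ vs → Span vs v
  Span-gen (v ∷ vs) (here ≡.refl) = ℤ.+ 1 , Span-resp vs
    (sym (trans (+-congˡ (-‿cong (trans (*-congʳ 1-homo) (*-identityˡ v)))) (-‿inverseʳ v))) (Span-0 vs)
  Span-gen (v ∷ vs) {w} (there h) = ℤ.+ 0 , Span-resp vs (sym (x-0v≈x w v)) (Span-gen vs h)

  Span-bind : ∀ vs us α → (∀ {v} → v ∈ vs → Span us (α * v)) → ∀ {t} → Span vs t → Span us (α * t)
  Span-bind []       us α f h = Span-resp us (sym (trans (*-congˡ h) (zeroʳ α))) (Span-0 us)
  Span-bind (v ∷ vs) us α f {t} (c , h) = Span-resp us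
    (solve 4 (λ a t c v → a :* (t :- c :* v) :+ c :* (a :* v) := a :* t) refl α t (ι c) v)
    (Span-+ us (Span-bind vs us α (λ v∈ → f (there v∈)) h) (Span-scale us c (f (here ≡.refl))))

  Span-weaken : ∀ vs us {t} → Span vs t → Span (vs ++ us) t
  Span-weaken []       us e       = Span-resp us (sym e) (Span-0 us)
  Span-weaken (v ∷ vs) us (c , h) = c , Span-weaken vs us h

  Span⇒W : ∀ {γ} vs {t} → Span vs t → W γ 1 vs t
  Span⇒W []       h = h
  Span⇒W (v ∷ vs) (c , h) = c ∷ [] , s≤s z≤n , W-resp vs
    (+-congˡ (-‿cong (*-congʳ (sym (trans (+-congˡ (zeroʳ _)) (+-identityʳ _)))))) (Span⇒W vs h)

  IntegralOf : ℕ → Carrier → Set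
  IntegralOf e α = Σ ZPoly λ p → length p ℕ.≤ e × α ^ e ≈ ev p α

  -- Removing a generator doubles the degree bound. The result depends on the generators alone and
  -- not on γ, which gives all elements of a finite algebra integral equations of one common degree.
  elimDegree : List Carrier → ℕ → ℕ
  elimDegree []       D = D
  elimDegree (v ∷ vs) D = elimDegree vs (D ℕ.+ D)

  eliminateAll : ∀ {γ} vs D → (∀ {v} → v ∈ vs ++ 1# ∷ [] → W γ D (vs ++ 1# ∷ []) (γ ^ D * v)) →
    IntegralOf (elimDegree vs D) γ
  eliminateAll {γ} []       D rel with rel (here ≡.refl)
  ... | p , l , h = p , l , (begin
    γ ^ D                             ≈⟨ *-identityʳ _ ⟨
    γ ^ D * 1#                        ≈⟨ solve 2 (λ x y → x := x :- y :+ y) refl (γ ^ D * 1#) (ev p γ * 1#) ⟩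
    γ ^ D * 1# - ev p γ * 1# + ev p γ * 1#   ≈⟨ +-cong h (*-identityʳ _) ⟩
    0# + ev p γ                       ≈⟨ +-identityˡ _ ⟩
    ev p γ                            ∎)
  eliminateAll {γ} (u ∷ vs) D rel = eliminateAll vs (D ℕ.+ D) (eliminate D u (vs ++ 1# ∷ []) rel)

  -- The determinant trick done by elimination: generators are removed until one is left, and its
  -- relation γ^D v = p(γ) v is a monic equation as soon as v = 1. For this reason 1 is appended as
  -- the last generator.
  finite⇒integral : ∀ {γ} vs → Span vs 1# → (∀ {v} → v ∈ vs → Span vs (γ * v)) → IntegralOf (elimDegree vs 1) γ
  finite⇒integral {γ} vs one mult = eliminateAll vs 1 λ {v} v∈ →
    Span⇒W (vs ++ 1# ∷ []) (Span-weaken vs (1# ∷ []) (Span-resp vs (*-congʳ (sym (*-identityʳ γ)))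
      (case (∈-++⁻ vs v∈))))
    where
    case : ∀ {v} → _ → Span vs (γ * v)
    case (inj₁ h)             = mult h
    case (inj₂ (here ≡.refl)) = Span-bind vs vs γ mult one

  powers : Carrier → ℕ → List Carrier
  powers α zero    = []
  powers α (suc e) = α ^ e ∷ powers α e

  ∈-powers : ∀ {α} e {k} → k ℕ.< e → α ^ k ∈ powers α e
  ∈-powers (suc e) {k} k<1+e with k ℕ.≟ e
  ... | yes ≡.refl = here ≡.refl
  ... | no k≢e     = there (∈-powers e (ℕ.≤∧≢⇒< (ℕ.≤-pred k<1+e) k≢e))

  ∈-powers⁻ : ∀ {α} e {v} → v ∈ powers α e → Σ ℕ λ k → k ℕ.< e × v ≡ α ^ k
  ∈-powers⁻ (suc e) (here eq) = e , ℕ.≤-refl , eq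
  ∈-powers⁻ (suc e) (there h) = let k , k<e , eq = ∈-powers⁻ e h in k , ℕ.m<n⇒m<1+n k<e , eq

  module _ {α : Carrier} {e : ℕ} (int : IntegralOf e α) where

    ev∈powers : ∀ p k → k ℕ.+ length p ℕ.≤ e → Span (powers α e) (α ^ k * ev p α)
    ev∈powers []      k l = Span-resp (powers α e) (sym (zeroʳ _)) (Span-0 (powers α e))
    ev∈powers (c ∷ p) k l = Span-resp (powers α e)
      (solve 4 (λ c x a r → c :* x :+ a :* x :* r := x :* (c :+ a :* r)) refl (ι c) (α ^ k) α (ev p α))
      (Span-+ (powers α e)
        (Span-scale (powers α e) c (Span-gen (powers α e) (∈-powers e (ℕ.≤-trans (s≤s (ℕ.m≤m+n k (length p))) l′))))
        (ev∈powers p (suc k) l′))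
      where l′ : suc (k ℕ.+ length p) ℕ.≤ e
            l′ = ≡.subst (ℕ._≤ e) (ℕ.+-suc k (length p)) l

    -- For k = e the monic equation rewrites the power. This includes e = 0, where the list is empty
    -- and the equation says 1 = 0.
    power∈powers : ∀ {k} → k ℕ.≤ e → Span (powers α e) (α ^ k)
    power∈powers {k} k≤e with k ℕ.≟ e
    ... | no k≢e = Span-gen (powers α e) (∈-powers e (ℕ.≤∧≢⇒< k≤e k≢e))
    ... | yes ≡.refl = let p , l , eq = int in
      Span-resp (powers α e) (trans (*-identityˡ _) (sym eq)) (ev∈powers p 0 l)

    powers-stable : ∀ {v} → v ∈ powers α e → Span (powers α e) (α * v)
    powers-stable v∈ with ∈-powers⁻ e v∈
    ... | k , k<e , ≡.refl = power∈powers k<e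

  Span-* : ∀ us vs {x y} → Span us x → Span vs y → Span (cartesianProductWith _*_ us vs) (x * y)
  Span-* us vs {x} {y} hx hy = Span-resp ws (*-comm y x) (Span-bind us ws y
    (λ {u} u∈ → Span-resp ws (*-comm u y) (Span-bind vs ws u
      (λ v∈ → Span-gen ws (∈-cartesianProductWith⁺ _*_ u∈ v∈)) hy)) hx)
    where ws = cartesianProductWith _*_ us vs

  +-integral : ∀ {α β e f} → IntegralOf e α → IntegralOf f β → Σ ℕ λ k → IntegralOf k (α + β)
  +-integral {α} {β} {e} {f} hα hβ = _ , finite⇒integral us
    (Span-resp us (*-identityˡ 1#) (Span-* (powers α e) (powers β f) (power∈powers hα z≤n) (power∈powers hβ z≤n)))
    stable
    where
    us : List Carrier
    us = cartesianProductWith _*_ (powers α e) (powers β f)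
    stable : ∀ {v} → v ∈ us → Span us ((α + β) * v)
    stable v∈ with ∈-cartesianProductWith⁻ _*_ (powers α e) (powers β f) v∈
    ... | a , b , a∈ , b∈ , ≡.refl = Span-resp us
      (solve 4 (λ x y a b → x :* a :* b :+ a :* (y :* b) := (x :+ y) :* (a :* b)) refl α β a b)
      (Span-+ us (Span-* (powers α e) (powers β f) (powers-stable hα a∈) (Span-gen (powers β f) b∈))
                 (Span-* (powers α e) (powers β f) (Span-gen (powers α e) a∈) (powers-stable hβ b∈)))

  neg-integral : ∀ {α e} → IntegralOf e α → Σ ℕ λ k → IntegralOf k (- α)
  neg-integral {α} {e} hα = _ , finite⇒integral (powers α e) (power∈powers hα z≤n)
    λ {v} v∈ → Span-resp (powers α e)
      (trans (*-congʳ (trans (-‿homo (ℤ.+ 1)) (-‿cong 1-homo)))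
        (trans (sym (-‿distribˡ-* 1# (α * v))) (trans (-‿cong (*-identityˡ _)) (-‿distribˡ-* α v))))
      (Span-scale (powers α e) (ℤ.- ℤ.+ 1) (powers-stable hα v∈))

  0-integral : IntegralOf 1 0#
  0-integral = [] , z≤n , zeroˡ _

  ev-zeros : ∀ p γ → (∀ j → coeff p j ≡ ℤ.+ 0) → ev p γ ≈ 0#
  ev-zeros []      γ z = refl
  ev-zeros (c ∷ p) γ z = trans (+-cong (trans (reflexive (≡.cong ι (z 0))) 0-homo)
    (trans (*-congˡ (ev-zeros p γ (λ j → z (suc j)))) (zeroʳ γ))) (+-identityˡ 0#)

  -- A coefficient list may end in zeros, so the leading term is split off at position k and not at
  -- the end of the list.
  ev-monic : ∀ h k γ → coeff h k ≡ ℤ.+ 1 → (∀ j → k ℕ.< j → coeff h j ≡ ℤ.+ 0) →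
    ev h γ ≈ ev (take k h) γ + γ ^ k
  ev-monic (c ∷ h) zero γ one zeros = begin
    ι c + γ * ev h γ ≈⟨ +-cong (trans (reflexive (≡.cong ι one)) 1-homo)
                          (trans (*-congˡ (ev-zeros h γ (λ j → zeros (suc j) (s≤s z≤n)))) (zeroʳ γ)) ⟩
    1# + 0#          ≈⟨ +-comm 1# 0# ⟩
    0# + 1#          ∎
  ev-monic (c ∷ h) (suc k) γ one zeros = trans
    (+-congˡ (*-congˡ (ev-monic h k γ one (λ j k<j → zeros (suc j) (s≤s k<j)))))
    (solve 4 (λ c g x y → c :+ g :* (x :+ y) := c :+ g :* x :+ g :* y) refl (ι c) γ _ _)

  monic⇒integral : ∀ h → ((k , _) : ℤ[x].Monic h) → ∀ {α} → ev h α ≈ 0# → IntegralOf k α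
  monic⇒integral h (k , one , zeros) {α} root = ℤ[x].-ₚ take k h
    , ℕ.≤-trans (ℕ.≤-reflexive (≡.trans (List.length-map _ (take k h)) (List.length-take k h))) (ℕ.m⊓n≤m k _)
    , (begin
      α ^ k                                      ≈⟨ solve 2 (λ x y → y := x :+ y :- x) refl (ev (take k h) α) (α ^ k) ⟩
      ev (take k h) α + α ^ k - ev (take k h) α  ≈⟨ +-congʳ (trans (sym (ev-monic h k α one zeros)) root) ⟩
      0# - ev (take k h) α                       ≈⟨ +-identityˡ _ ⟩
      - ev (take k h) α                          ≈⟨ ev-neg (take k h) α ⟨
      ev (ℤ[x].-ₚ take k h) α                    ∎)

  -- This is x^e - p, by recursion on e so that the leading 1 lands at position e. Coefficients of p
  -- from position e on are dropped, whence the length bound in `ev-monicDiff`.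
  monicDiff : ℕ → ZPoly → ZPoly
  monicDiff zero    p       = ℤ.+ 1 ∷ []
  monicDiff (suc e) []      = ℤ.+ 0 ∷ monicDiff e []
  monicDiff (suc e) (c ∷ p) = ℤ.- c ∷ monicDiff e p

  monicDiff-monic : ∀ e p → coeff (monicDiff e p) e ≡ ℤ.+ 1 × (∀ j → e ℕ.< j → coeff (monicDiff e p) j ≡ ℤ.+ 0)
  monicDiff-monic zero    p = ≡.refl , λ { (suc j) _ → ≡.refl }
  monicDiff-monic (suc e) []      = let o , z = monicDiff-monic e [] in o , λ { (suc j) (s≤s l) → z j l }
  monicDiff-monic (suc e) (c ∷ p) = let o , z = monicDiff-monic e p in o , λ { (suc j) (s≤s l) → z j l }

  ev-monicDiff : ∀ e p γ → length p ℕ.≤ e → ev (monicDiff e p) γ ≈ γ ^ e - ev p γ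
  ev-monicDiff zero    []      γ l = trans (+-cong 1-homo (trans (zeroʳ γ) (sym -0#≈0#))) refl
  ev-monicDiff (suc e) []      γ l = begin
    ι (ℤ.+ 0) + γ * ev (monicDiff e []) γ   ≈⟨ +-cong 0-homo (*-congˡ (ev-monicDiff e [] γ z≤n)) ⟩
    0# + γ * (γ ^ e - 0#)                   ≈⟨ trans (+-identityˡ _) (*-congˡ (x-0≈x _)) ⟩
    γ * γ ^ e                               ≈⟨ x-0≈x _ ⟨
    γ * γ ^ e - 0#                          ∎
  ev-monicDiff (suc e) (c ∷ p) γ (s≤s l) = trans (+-cong (-‿homo c) (*-congˡ (ev-monicDiff e p γ l)))
    (solve 4 (λ c g x y → :- c :+ g :* (x :- y) := g :* x :- (c :+ g :* y)) refl (ι c) γ _ _)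

  integral⇒monic : ∀ {e α} → IntegralOf e α → Σ ZPoly λ h → ℤ[x].Monic h × ev h α ≈ 0#
  integral⇒monic {e} {α} (p , l , eq) = monicDiff e p , (e , monicDiff-monic e p)
    , trans (ev-monicDiff e p α l) (trans (+-congʳ eq) (-‿inverseʳ _))

-- Binomial coefficients at a prime

prime∤! : ∀ {p} → Prime p → ∀ k → k ℕ.< p → ¬ (p ∣ k ℕ.!)
prime∤! {p} pp zero k<p p∣1 = contradiction (ℕ∣.∣1⇒≡1 p∣1) (ℕ.nonTrivial⇒≢1 {{prime⇒nonTrivial pp}})
prime∤! pp (suc k) k<p h with euclidsLemma (suc k) (k ℕ.!) pp h
... | inj₁ p∣k  = contradiction (ℕ∣.∣⇒≤ p∣k) (ℕ.<⇒≱ k<p)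
... | inj₂ p∣k! = prime∤! pp k (ℕ.<-trans (ℕ.n<1+n k) k<p) p∣k!

-- p divides p! = C(p, k) k! (p - k)! but neither of the two factorials.
prime∣C : ∀ {p} → Prime p → ∀ k → 0 ℕ.< k → k ℕ.< p → p ∣ p C k
prime∣C {suc p-1} pp k 0<k k<p with euclidsLemma (p C k) (k ℕ.! ℕ.* (p ℕ.∸ k) ℕ.!) pp p∣prod
  where
  p = suc p-1
  k≤p = ℕ.<⇒≤ k<p
  instance _ = k ℕ.!* (p ℕ.∸ k) !≢0
  p∣prod : p ∣ (p C k) ℕ.* (k ℕ.! ℕ.* (p ℕ.∸ k) ℕ.!)
  p∣prod = ≡.subst (p ∣_) (≡.sym (≡.trans (≡.cong (ℕ._* (k ℕ.! ℕ.* (p ℕ.∸ k) ℕ.!)) (nCk≡n!/k![n-k]! k≤p))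
    (DivMod.m/n*n≡m (k![n∸k]!∣n! k≤p)))) (ℕ∣.m∣m*n (p-1 ℕ.!))
... | inj₁ h = h
... | inj₂ h with euclidsLemma (k ℕ.!) _ pp h
...   | inj₁ h₁ = contradiction h₁ (prime∤! pp k k<p)
...   | inj₂ h₂ = contradiction h₂ (prime∤! pp _ (ℕ.∸-monoʳ-< {suc p-1} {k} {0} 0<k (ℕ.<⇒≤ k<p)))

-- The prime is written e + 2, so that d - 1 and d - 2 are the terms `suc e` and `e` and powers
-- unfold by computation.
module PrimeBinomial (T : CommutativeRing 0ℓ 0ℓ) (φ : ℤ→ T) (e : ℕ) (d-prime : Prime (suc (suc e))) where
  open ℤ-Algebra T φ
  open ℤ-Solver T φ using (solve; _:+_; _:*_; :-_; _:-_; _:=_; con)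
  open ≈-Reasoning
  open Algebra.Properties.Monoid.Sum +-monoid using (sum; sum-init-last)
  open Algebra.Properties.CommutativeSemiring.Binomial commutativeSemiring using (theorem; binomialTerm)
  open Algebra.Properties.Monoid.Mult +-monoid using (×-congˡ; ×-homo-1) renaming (_×_ to _·_)

  d : ℕ
  d = suc (suc e)

  δ : Carrier
  δ = ι (ℤ.+ d)

  ·≈ι : ∀ n x → n · x ≈ ι (ℤ.+ n) * x
  ·≈ι zero    x = sym (trans (*-congʳ 0-homo) (zeroˡ x))
  ·≈ι (suc n) x = begin
    x + n · x                        ≈⟨ +-cong (sym (*-identityˡ x)) (·≈ι n x) ⟩
    1# * x + ι (ℤ.+ n) * x           ≈⟨ distribʳ x 1# (ι (ℤ.+ n)) ⟨
    (1# + ι (ℤ.+ n)) * x             ≈⟨ *-congʳ (+-congʳ (sym 1-homo)) ⟩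
    (ι (ℤ.+ 1) + ι (ℤ.+ n)) * x      ≈⟨ *-congʳ (sym (+-homo (ℤ.+ 1) (ℤ.+ n))) ⟩
    ι (ℤ.+ suc n) * x                ∎

  sum-multiple : ∀ {n} c (f : Fin n → Carrier) → (∀ k → Σ Carrier λ y → f k ≈ c * y) →
    Σ Carrier λ y → sum f ≈ c * y
  sum-multiple {zero}  c f h = 0# , sym (zeroʳ c)
  sum-multiple {suc n} c f h =
    let y , ey = h Fin.zero
        z , ez = sum-multiple c (λ k → f (Fin.suc k)) (λ k → h (Fin.suc k))
    in y + z , trans (+-cong ey ez) (sym (distribˡ c y z))

  -- The index k + 2 with k < e runs through 2, ..., d - 1, where both t² and d split off.
  middle : ∀ v t (k : Fin e) →
    Σ Carrier λ y → binomialTerm t v d (Fin.suc (Fin.suc (Fin.inject₁ k))) ≈ (δ * (t * t)) * y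
  middle v t k with prime∣C d-prime (2 ℕ.+ Fin.toℕ (Fin.inject₁ k)) (s≤s z≤n)
    (s≤s (s≤s (≡.subst (ℕ._< e) (≡.sym (Fin.toℕ-inject₁ k)) (Fin.toℕ<n k))))
  ... | divides q eq = ι (ℤ.+ q) * (t ^ i * r) , (begin
    (d C suc (suc i)) · (t * (t * t ^ i) * r)      ≈⟨ ×-congˡ eq ⟩
    (q ℕ.* d) · (t * (t * t ^ i) * r)              ≈⟨ ·≈ι (q ℕ.* d) _ ⟩
    ι (ℤ.+ (q ℕ.* d)) * (t * (t * t ^ i) * r)
      ≈⟨ *-congʳ (trans (reflexive (≡.cong ι (ℤ.pos-* q d))) (*-homo (ℤ.+ q) (ℤ.+ d))) ⟩
    ι (ℤ.+ q) * δ * (t * (t * t ^ i) * r)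
      ≈⟨ solve 5 (λ q d t x r → q :* d :* (t :* (t :* x) :* r) := (d :* (t :* t)) :* (q :* (x :* r))) refl (ι (ℤ.+ q)) δ t (t ^ i) r ⟩
    (δ * (t * t)) * (ι (ℤ.+ q) * (t ^ i * r))      ∎)
    where i = Fin.toℕ (Fin.inject₁ k)
          r = v ^ (d ℕ.∸ (2 ℕ.+ i))

  abstract
    -- The shape serves two reductions of the cofactor of t: modulo d it is t^(d-1), and modulo t it
    -- is d v^(d-1), with d occurring exactly once.
    prime-binomial : ∀ v t → Σ Carrier λ y → (v + t) ^ d ≈ v ^ d + t * (t ^ suc e + δ * (t * y + v ^ suc e))
    prime-binomial v t = y , (begin
      (v + t) ^ d                                 ≈⟨ ^-congˡ d (+-comm v t) ⟩
      (t + v) ^ d                                 ≈⟨ theorem d t v ⟩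
      f Fin.zero + (f (Fin.suc Fin.zero) + sum g)
        ≈⟨ +-cong bottom (+-cong second (trans (sum-init-last g) (+-cong (proj₂ mid) top))) ⟩
      v ^ d + (δ * (t * 1# * v ^ suc e) + (δ * (t * t) * y + t * t ^ suc e))
        ≈⟨ +-congˡ (+-congʳ (*-congˡ (*-congʳ (*-identityʳ t)))) ⟩
      v ^ d + (δ * (t * v ^ suc e) + (δ * (t * t) * y + t * t ^ suc e))
        ≈⟨ solve 6 (λ vd δ t ve y te → vd :+ (δ :* (t :* ve) :+ (δ :* (t :* t) :* y :+ t :* te))
              := vd :+ t :* (te :+ δ :* (t :* y :+ ve))) refl (v ^ d) δ t (v ^ suc e) y (t ^ suc e) ⟩
      v ^ d + t * (t ^ suc e + δ * (t * y + v ^ suc e))  ∎)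
      where
      f : Fin (suc d) → Carrier
      f = binomialTerm t v d
      g : Fin (suc e) → Carrier
      g k = f (Fin.suc (Fin.suc k))
      mid : Σ Carrier λ y → sum (λ k → g (Fin.inject₁ k)) ≈ δ * (t * t) * y
      mid = sum-multiple (δ * (t * t)) (λ k → g (Fin.inject₁ k)) (middle v t)
      y : Carrier
      y = proj₁ mid
      bottom : f Fin.zero ≈ v ^ d
      bottom = trans (×-homo-1 (1# * v ^ d)) (*-identityˡ (v ^ d))
      second : f (Fin.suc Fin.zero) ≈ δ * (t * 1# * v ^ suc e)
      second = trans (×-congˡ {t * 1# * v ^ suc e} (nC1≡n d)) (·≈ι d (t * 1# * v ^ suc e))
      term : ℕ → Carrier
      term i = (d C suc (suc i)) · (t * (t * t ^ i) * v ^ (e ℕ.∸ i))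
      top : g (Fin.fromℕ e) ≈ t * t ^ suc e
      top = begin
        term (Fin.toℕ (Fin.fromℕ e))                ≈⟨ reflexive (≡.cong term (Fin.toℕ-fromℕ e)) ⟩
        (d C d) · (t * (t * t ^ e) * v ^ (e ℕ.∸ e)) ≈⟨ ×-congˡ (nCn≡1 d) ⟩
        1 · (t * (t * t ^ e) * v ^ (e ℕ.∸ e))       ≈⟨ ×-homo-1 _ ⟩
        t * (t * t ^ e) * v ^ (e ℕ.∸ e)             ≈⟨ *-congˡ (reflexive (≡.cong (v ^_) (ℕ.n∸n≡0 e))) ⟩
        t * (t * t ^ e) * 1#                        ≈⟨ *-identityʳ _ ⟩
        t * (t * t ^ e)                             ∎

  module CharP (δ≈0 : δ ≈ 0#) where

    frobenius-+ : ∀ v t → (v + t) ^ d ≈ v ^ d + t ^ d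
    frobenius-+ v t = let y , eq = prime-binomial v t in trans eq
      (+-congˡ (*-congˡ (trans (+-congˡ (trans (*-congʳ δ≈0) (zeroˡ _))) (+-identityʳ _))))

    frobenius-neg : ∀ v → (- v) ^ d ≈ - (v ^ d)
    frobenius-neg v = begin
      (- v) ^ d                        ≈⟨ solve 2 (λ x y → x := y :+ x :- y) refl _ (v ^ d) ⟩
      v ^ d + (- v) ^ d - v ^ d        ≈⟨ +-congʳ (trans (sym (frobenius-+ v (- v))) (trans (^-congˡ d (-‿inverseʳ v)) (zeroˡ _))) ⟩
      0# - v ^ d                       ≈⟨ +-identityˡ _ ⟩
      - (v ^ d)                        ∎

    fermat-ℕ : ∀ n → ι (ℤ.+ n) ^ d ≈ ι (ℤ.+ n)
    fermat-ℕ zero    = trans (*-congʳ 0-homo) (trans (zeroˡ _) (sym 0-homo))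
    fermat-ℕ (suc n) = begin
      ι (ℤ.+ suc n) ^ d                    ≈⟨ ^-congˡ d (+-homo (ℤ.+ 1) (ℤ.+ n)) ⟩
      (ι (ℤ.+ 1) + ι (ℤ.+ n)) ^ d          ≈⟨ frobenius-+ _ _ ⟩
      ι (ℤ.+ 1) ^ d + ι (ℤ.+ n) ^ d        ≈⟨ +-cong (trans (^-congˡ d 1-homo) (trans (1^ d) (sym 1-homo))) (fermat-ℕ n) ⟩
      ι (ℤ.+ 1) + ι (ℤ.+ n)                ≈⟨ +-homo (ℤ.+ 1) (ℤ.+ n) ⟨
      ι (ℤ.+ suc n)                        ∎

    fermat : ∀ c → ι c ^ d ≈ ι c
    fermat (ℤ.+ n)    = fermat-ℕ n
    fermat ℤ.-[1+ n ] = begin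
      ι ℤ.-[1+ n ] ^ d          ≈⟨ ^-congˡ d (-‿homo (ℤ.+ suc n)) ⟩
      (- ι (ℤ.+ suc n)) ^ d     ≈⟨ frobenius-neg _ ⟩
      - (ι (ℤ.+ suc n) ^ d)     ≈⟨ -‿cong (fermat-ℕ (suc n)) ⟩
      - ι (ℤ.+ suc n)           ≈⟨ -‿homo (ℤ.+ suc n) ⟨
      ι ℤ.-[1+ n ]              ∎

-- Monic polynomials and the critical orbit

constℤ : ℤ→ ℤX.polyRing
constℤ = record
  { ⟦_⟧ = ℤX.constP
  ; +-homo = λ a b → ℤX.by-coeff λ i → ≡.refl
  ; *-homo = λ a b → ℤX.by-coeff λ { zero → ≡.sym (ℤ.+-identityʳ (a ℤ.* b)) ; (suc i) → ≡.refl }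
  ; -‿homo = λ a → ℤX.by-coeff λ i → ≡.refl
  ; 0-homo = ℤX.by-coeff λ { zero → ≡.refl ; (suc i) → ≡.refl }
  ; 1-homo = ℤX.by-coeff λ i → ≡.refl }

module S = ℤ-Algebra ℤX.polyRing constℤ

open ℤX using (coeff; by-coeff; at)

∷≈ : ∀ c f → c ∷ f S.≈ S.ι c S.+ ℤX.X S.* f
∷≈ c f = by-coeff λ i → ≡.sym (≡.trans (ℤX.coeff-+ (c ∷ []) (ℤX.X ℤX.*ₚ f) i)
  (≡.trans (≡.cong (λ z → coeff (c ∷ []) i ℤ.+ z) (ℤX.shift-*ₚ ℤX.oneP f i)) (shifted i)))
  where
  shifted : ∀ i → coeff (c ∷ []) i ℤ.+ coeff (ℤ.+ 0 ∷ ℤX.oneP ℤX.*ₚ f) i ≡ coeff (c ∷ f) i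
  shifted zero    = ℤ.+-identityʳ c
  shifted (suc i) = ≡.trans (ℤ.+-identityˡ _) (ℤX.*ₚ-identityˡ f i)

⟨_⟩ : ℕ → S.Ideal
⟨ c ⟩ = S.zeroIdeal S.⊕ S.ι (ℤ.+ c)

∣⇒⟨⟩ : ∀ c f → (∀ i → ℤ.+ c ℤ∣.∣ coeff f i) → S.Mem ⟨ c ⟩ f
∣⇒⟨⟩ c f h = let u , e = quot f h in u , S.trans (S.+-congʳ e) (S.-‿inverseʳ (u S.* S.ι (ℤ.+ c)))
  where
  quot : ∀ f → (∀ i → ℤ.+ c ℤ∣.∣ coeff f i) → Σ ZPoly λ u → f S.≈ u S.* S.ι (ℤ.+ c)
  quot []      h = [] , S.refl
  quot (a ∷ f) h with h 0 | quot f (λ i → h (suc i))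
  ... | ℤ∣.divides q eq | u , e = q ∷ u , (begin
    a ∷ f                                  ≈⟨ ∷≈ a f ⟩
    ι a + X * f                            ≈⟨ +-cong (trans (reflexive (≡.cong ι eq)) (*-homo q (ℤ.+ c))) (*-congˡ {X} e) ⟩
    ι q * ι (ℤ.+ c) + X * (u * ι (ℤ.+ c))
      ≈⟨ solve 4 (λ q c x u → q :* c :+ x :* (u :* c) := (q :+ x :* u) :* c) refl (ι q) (ι (ℤ.+ c)) X u ⟩
    (ι q + X * u) * ι (ℤ.+ c)              ≈⟨ *-congʳ (sym (∷≈ q u)) ⟩
    (q ∷ u) * ι (ℤ.+ c)                    ∎)
    where open S
          open S.≈-Reasoning
          open ℤ-Solver ℤX.polyRing constℤ using (solve; _:+_; _:*_; _:=_)
          X = ℤX.X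

⟨⟩⇒∣ : ∀ c f → S.Mem ⟨ c ⟩ f → ∀ i → ℤ.+ c ℤ∣.∣ coeff f i
⟨⟩⇒∣ c f (u , e) i = ℤ∣.divides (coeff u i) (≡.trans (at f≈ i) (≡.trans (ℤX.*ₚ-comm u (ℤ.+ c ∷ []) i)
  (≡.trans (ℤX.coeff-+ (map (ℤ.+ c ℤ.*_) u) (ℤ.+ 0 ∷ []) i)
  (≡.trans (≡.cong₂ ℤ._+_ (ℤX.coeff-scale (ℤ.+ c) u i) (zeros i))
  (≡.trans (ℤ.+-identityʳ _) (ℤ.*-comm (ℤ.+ c) (coeff u i)))))))
  where
  zeros : ∀ i → coeff (ℤ.+ 0 ∷ []) i ≡ ℤ.+ 0
  zeros zero    = ≡.refl
  zeros (suc i) = ≡.refl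
  open ℤ-Solver ℤX.polyRing constℤ using (solve; _:+_; _:-_; _:=_)
  f≈ : f S.≈ u S.* S.ι (ℤ.+ c)
  f≈ = S.trans (solve 2 (λ f v → f := (f :- v) :+ v) S.refl f (u S.* S.ι (ℤ.+ c)))
    (S.trans (S.+-congʳ e) (S.+-identityˡ _))

-- The leading coefficient of a product, where the coefficients of q beyond l need only vanish
-- modulo c. The case c = 0 is the exact formula, c = d the one over F_d.
coeff-*-top : ∀ {c} f q k l → (∀ j → k ℕ.< j → coeff f j ≡ ℤ.+ 0) → (∀ j → l ℕ.< j → c ℤ∣.∣ coeff q j) →
  c ℤ∣.∣ coeff (f ℤX.*ₚ q) (k ℕ.+ l) ℤ.- coeff f k ℤ.* coeff q l
coeff-*-top {c} [] q k l hf hq = ≡.subst (c ℤ∣.∣_) (≡.sym (ℤ.+-inverseʳ (ℤ.+ 0))) (ℤ∣.divides (ℤ.+ 0) ≡.refl)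
coeff-*-top {c} (a ∷ f) q zero l hf hq = ℤ∣.divides (ℤ.+ 0) (≡.trans (≡.cong (ℤ._- a ℤ.* coeff q l) (low l)) (ℤ.+-inverseʳ (a ℤ.* coeff q l)))
  where
  low : ∀ l → coeff ((a ∷ f) ℤX.*ₚ q) l ≡ a ℤ.* coeff q l
  low zero    = ℤX.coeff-*-zero a f q
  low (suc l) = ≡.trans (ℤX.coeff-*-suc a f q l) (≡.trans (≡.cong (λ z → a ℤ.* coeff q (suc l) ℤ.+ z)
    (ℤX.*ₚ-cong {f} {[]} {q} {q} (λ j → hf (suc j) (s≤s z≤n)) (λ _ → ≡.refl) l)) (ℤ.+-identityʳ _))
coeff-*-top {c} (a ∷ f) q (suc k) l hf hq = ≡.subst (c ℤ∣.∣_)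
  (≡.sym (≡.trans (≡.cong (ℤ._- coeff f k ℤ.* coeff q l) (ℤX.coeff-*-suc a f q (k ℕ.+ l))) (ℤ.+-assoc (a ℤ.* coeff q (suc k ℕ.+ l)) _ _)))
  (ℤ∣.∣m∣n⇒∣m+n (ℤ∣.∣n⇒∣m*n a (hq (suc k ℕ.+ l) (s≤s (ℕ.m≤n+m l k))))
    (coeff-*-top f q k l (λ j k<j → hf (suc j) (s≤s k<j)) hq))

MonicOf : ℕ → ZPoly → Set
MonicOf k f = coeff f k ≡ ℤ.+ 1 × (∀ j → k ℕ.< j → coeff f j ≡ ℤ.+ 0)

coeff-beyond : ∀ (f : ZPoly) j → length f ℕ.≤ j → coeff f j ≡ ℤ.+ 0
coeff-beyond []      j       h       = ≡.refl
coeff-beyond (a ∷ f) (suc j) (s≤s h) = coeff-beyond f j h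

-- From the top down: once all coefficients of q above i are divisible by c, coefficient k + i of f
-- q is coefficient i of q modulo c. With c = 0 and c = d this makes monic polynomials
-- non-zero-divisors over ℤ and over ℤ/d.
monic-cancel : ∀ c {k f} q → MonicOf k f → S.Mem ⟨ c ⟩ (f S.* q) → S.Mem ⟨ c ⟩ q
monic-cancel c {k} {f} q (one , zeros) h = ∣⇒⟨⟩ c q (λ i → descend (length q) i (ℕ.m≤n+m _ i))
  where
  descend : ∀ n i → length q ℕ.≤ i ℕ.+ n → ℤ.+ c ℤ∣.∣ coeff q i
  descend zero    i l = ≡.subst (ℤ.+ c ℤ∣.∣_) (≡.sym (coeff-beyond q i (≡.subst (_ ℕ.≤_) (ℕ.+-identityʳ i) l)))
    (ℤ∣.divides (ℤ.+ 0) ≡.refl)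
  descend (suc n) i l = ≡.subst (ℤ.+ c ℤ∣.∣_) eq (ℤ∣.∣m∣n⇒∣m-n (⟨⟩⇒∣ c (f S.* q) h (k ℕ.+ i))
      (coeff-*-top f q k i zeros (λ j i<j → descend n j
        (ℕ.≤-trans l (ℕ.≤-trans (ℕ.≤-reflexive (ℕ.+-suc i n)) (ℕ.+-monoˡ-≤ n i<j))))))
    where
    eq : coeff (f S.* q) (k ℕ.+ i) ℤ.- (coeff (f S.* q) (k ℕ.+ i) ℤ.- coeff f k ℤ.* coeff q i) ≡ coeff q i
    eq = ≡.trans (cancel (coeff (f S.* q) (k ℕ.+ i)) _) (≡.trans (≡.cong (ℤ._* coeff q i) one) (ℤ.*-identityˡ _))
      where cancel : ∀ x y → x ℤ.- (x ℤ.- y) ≡ y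
            cancel = solve 2 (λ x y → x :- (x :- y) := y) ≡.refl
              where open ℤSolver.+-*-Solver

monic-1 : MonicOf 0 S.1#
monic-1 = ≡.refl , λ { (suc j) _ → ≡.refl }

monic-* : ∀ {k l f q} → MonicOf k f → MonicOf l q → MonicOf (k ℕ.+ l) (f S.* q)
monic-* {k} {l} {f} {q} (one , zeros) (one′ , zeros′)
  = ≡.trans (exact l ℕ.≤-refl) (≡.cong₂ ℤ._*_ one one′)
  , λ j k+l<j → let j′ = j ℕ.∸ k
                    j≡ : k ℕ.+ j′ ≡ j
                    j≡ = ℕ.m+[n∸m]≡n (ℕ.≤-trans (ℕ.m≤m+n k l) (ℕ.<⇒≤ k+l<j))
                    l<j′ = ℕ.+-cancelˡ-< k l j′ (≡.subst (k ℕ.+ l ℕ.<_) (≡.sym j≡) k+l<j)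
                in ≡.trans (≡.cong (coeff (f S.* q)) (≡.sym j≡)) (≡.trans (exact j′ (ℕ.<⇒≤ l<j′))
                     (≡.trans (≡.cong (coeff f k ℤ.*_) (zeros′ j′ l<j′)) (ℤ.*-zeroʳ (coeff f k))))
  where
  exact : ∀ i → l ℕ.≤ i → coeff (f S.* q) (k ℕ.+ i) ≡ coeff f k ℤ.* coeff q i
  exact i l≤i = ℤ.i-j≡0⇒i≡j _ _ (ℤ∣.0∣⇒≡0 (coeff-*-top {ℤ.+ 0} f q k i zeros
    (λ j i<j → ≡.subst (ℤ.+ 0 ℤ∣.∣_) (≡.sym (zeros′ j (ℕ.≤-<-trans l≤i i<j))) (ℤ∣.divides (ℤ.+ 0) ≡.refl))))

monic-^ₚ : ∀ {k f} → MonicOf k f → ∀ n → MonicOf (n ℕ.* k) (f ℤX.^ₚ n)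
monic-^ₚ h zero    = monic-1
monic-^ₚ {k} {f} h (suc n) = monic-* {k} {n ℕ.* k} {f} {f ℤX.^ₚ n} h (monic-^ₚ h n)

monic-+ : ∀ {k f q} → MonicOf k f → (∀ j → k ℕ.≤ j → coeff q j ≡ ℤ.+ 0) → MonicOf k (f S.+ q)
monic-+ {k} {f} {q} (one , zeros) low
  = ≡.trans (ℤX.coeff-+ f q k) (≡.cong₂ ℤ._+_ one (low k ℕ.≤-refl))
  , λ j k<j → ≡.trans (ℤX.coeff-+ f q j) (≡.cong₂ ℤ._+_ (zeros j k<j) (low j (ℕ.<⇒≤ k<j)))

module _ (e : ℕ) where
  private d = suc (suc e)

  -- The degree d^(k-1) of a k. The value 0 for the zero polynomial a 0 is a convention under which
  -- the degrees increase strictly from the start.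
  orbitDegree : ℕ → ℕ
  orbitDegree zero          = 0
  orbitDegree (suc zero)    = 1
  orbitDegree (suc (suc k)) = d ℕ.* orbitDegree (suc k)

  orbitDegree>0 : ∀ k → 0 ℕ.< orbitDegree (suc k)
  orbitDegree>0 zero    = s≤s z≤n
  orbitDegree>0 (suc k) = ℕ.≤-trans (orbitDegree>0 k) (ℕ.m≤m+n _ _)

  orbitDegree-suc : ∀ k → orbitDegree k ℕ.< orbitDegree (suc k)
  orbitDegree-suc zero    = s≤s z≤n
  orbitDegree-suc (suc k) = ℕ.m<m+n _ (ℕ.≤-trans (orbitDegree>0 k) (ℕ.m≤m+n _ _))

  orbitDegree-+ : ∀ j k → orbitDegree j ℕ.< orbitDegree (j ℕ.+ suc k)
  orbitDegree-+ j zero    = ≡.subst (λ i → orbitDegree j ℕ.< orbitDegree i) (≡.sym (ℕ.+-comm j 1)) (orbitDegree-suc j)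
  orbitDegree-+ j (suc k) = ℕ.<-trans (orbitDegree-+ j k)
    (≡.subst (λ i → orbitDegree (j ℕ.+ suc k) ℕ.< orbitDegree i) (≡.sym (ℕ.+-suc j (suc k))) (orbitDegree-suc (j ℕ.+ suc k)))

  orbit-monic : ∀ k → MonicOf (orbitDegree (suc k)) (orbit d (suc k))
  orbit-monic zero    = ≡.refl , λ { (suc (suc j)) _ → ≡.refl ; (suc zero) (s≤s ()) }
  orbit-monic (suc k) = monic-+ {d ℕ.* orbitDegree (suc k)} {orbit d (suc k) ℤX.^ₚ d} {ℤX.X} (monic-^ₚ {orbitDegree (suc k)} {orbit d (suc k)} (orbit-monic k) d)
    λ j deg≤j → X-top j (ℕ.≤-trans (ℕ.+-mono-≤ (orbitDegree>0 k) (ℕ.≤-trans (orbitDegree>0 k) (ℕ.m≤m+n _ (e ℕ.* orbitDegree (suc k))))) deg≤j)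
    where
    X-top : ∀ j → 2 ℕ.≤ j → coeff ℤX.X j ≡ ℤ.+ 0
    X-top (suc (suc j)) _ = ≡.refl
    X-top (suc zero) (s≤s ())

  A-monic : ∀ j k → MonicOf (orbitDegree (j ℕ.+ suc k)) (A d j (suc k))
  A-monic j k = monic-+ {orbitDegree (j ℕ.+ suc k)} {orbit d (j ℕ.+ suc k)} {S.- orbit d j} top
    λ i deg≤i → ≡.trans (ℤX.coeff-neg (orbit d j) i) (≡.cong ℤ.-_ (low j i (ℕ.<-≤-trans (orbitDegree-+ j k) deg≤i)))
    where
    top : MonicOf (orbitDegree (j ℕ.+ suc k)) (orbit d (j ℕ.+ suc k))
    top rewrite ℕ.+-suc j k = orbit-monic (j ℕ.+ k)
    low : ∀ j i → orbitDegree j ℕ.< i → coeff (orbit d j) i ≡ ℤ.+ 0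
    low zero    i h = ≡.refl
    low (suc j) i h = proj₂ (orbit-monic j) i h

-- The orbit modulo an ideal

countDivisible : (ℕ → Bool) → ℕ → List ℕ → ℕ
countDivisible σ n₀ ks = length (filterᵇ (λ k → σ k ∧ does (n₀ ∣? k)) ks)

module Products (T : CommutativeRing 0ℓ 0ℓ) (φ : ℤ→ T) where
  open ℤ-Algebra T φ
  open ℤ-Solver T φ using (solve; _:+_; _:*_; :-_; _:-_; _:=_; con)
  open ≈-Reasoning

  -- A product of powers f(k)^μ(n/k) is kept as two of these, one for each sign, because the ring
  -- has no division.
  ∏ : (ℕ → Bool) → (ℕ → Carrier) → List ℕ → Carrier
  ∏ σ f = foldr (λ k acc → (if σ k then f k else 1#) * acc) 1#

  ∏-cong : ∀ σ {f g} ks → All (λ k → f k ≈ g k) ks → ∏ σ f ks ≈ ∏ σ g ks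
  ∏-cong σ []       []       = refl
  ∏-cong σ (k ∷ ks) (h ∷ hs) with σ k
  ... | true  = *-cong h (∏-cong σ ks hs)
  ... | false = *-cong refl (∏-cong σ ks hs)

  Comax : Ideal → Carrier → Set
  Comax I w = Mem (I ⊕ w) 1#

  comax-1 : ∀ I → Comax I 1#
  comax-1 I = ⊕-new I 1#

  comax-* : ∀ I v w → Comax I v → Comax I w → Comax I (v * w)
  comax-* I v w (s , h) (t , k) = s * t , resp I
    (trans (solve 5 (λ o s v t w → (o :- t :* w) :+ (t :* w) :* (o :- s :* v)
               := o :+ t :* w :* (o :- con (ℤ.+ 1)) :- s :* t :* (v :* w)) refl 1# s v t w)
      (+-congʳ (trans (+-congˡ (trans (*-congˡ 1-ι1≈0) (zeroʳ _))) (+-identityʳ _))))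
    (mem+ I k (mem* I (t * w) h))
    where
    1-ι1≈0 : 1# - ι (ℤ.+ 1) ≈ 0#
    1-ι1≈0 = trans (+-congˡ (-‿cong 1-homo)) (-‿inverseʳ 1#)

  comax-^ : ∀ I v k → Comax I v → Comax I (v ^ k)
  comax-^ I v zero    h = comax-1 I
  comax-^ I v (suc k) h = comax-* I v (v ^ k) h (comax-^ I v k h)

  comax-shift : ∀ I {v w} → Mem I (w - v) → Comax I v → Comax I w
  comax-shift I {v} {w} m (u , h) = u , resp I
    (solve 4 (λ o u v w → (o :- u :* v) :+ (:- u) :* (w :- v) := o :- u :* w) refl 1# u v w)
    (mem+ I h (mem* I (- u) m))

  -- Each selected k divisible by n₀ contributes one h, and everything else is a unit modulo I. For
  -- h in a proper I this isolates the power of h that has to cancel.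
  ∏-factor : ∀ I n₀ h σ f ks →
    All (λ k → (n₀ ∣ k → Σ Carrier λ w → f k ≈ h * w × Comax I w) × (¬ (n₀ ∣ k) → Comax I (f k))) ks →
    Σ Carrier λ W → ∏ σ f ks ≈ h ^ countDivisible σ n₀ ks * W × Comax I W
  ∏-factor I n₀ h σ f []       []       = 1# , sym (*-identityˡ 1#) , comax-1 I
  ∏-factor I n₀ h σ f (k ∷ ks) ((p , q) ∷ hs) with σ k | n₀ ∣? k | ∏-factor I n₀ h σ f ks hs
  ... | false | _      | W , eq , cW = W , trans (*-identityˡ _) eq , cW
  ... | true  | yes n₀∣k | W , eq , cW = let w , ew , cw = p n₀∣k in w * W
    , trans (*-cong ew eq) (solve 4 (λ h w x y → (h :* w) :* (x :* y) := (h :* x) :* (w :* y)) refl h w _ W)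
    , comax-* I w W cw cW
  ... | true  | no  n₀∤k | W , eq , cW = f k * W
    , trans (*-congˡ eq) (solve 3 (λ f x y → f :* (x :* y) := x :* (f :* y)) refl (f k) _ W)
    , comax-* I (f k) W (q n₀∤k) cW

-- The critical orbit over a commutative ring

record IsOrbit (T : CommutativeRing 0ℓ 0ℓ) (φ : ℤ→ T) (d : ℕ)
  (a : ℕ → CommutativeRing.Carrier T) (x : CommutativeRing.Carrier T) : Set where
  open ℤ-Algebra T φ
  field
    a-zero : a 0 ≈ 0#
    a-suc  : ∀ k → a (suc k) ≈ a k ^ d + x

module OrbitAlgebra (T : CommutativeRing 0ℓ 0ℓ) (φ : ℤ→ T) (e : ℕ) (d-prime : Prime (suc (suc e)))
  (a : ℕ → CommutativeRing.Carrier T) (x : CommutativeRing.Carrier T) (isOrbit : IsOrbit T φ (suc (suc e)) a x) where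

  open IsOrbit isOrbit
  open ℤ-Algebra T φ
  open ℤ-Solver T φ using (solve; _:+_; _:*_; :-_; _:-_; _:=_; con)
  open ≈-Reasoning
  open Products T φ
  open PrimeBinomial T φ e d-prime

  Δ : ℕ → ℕ → Carrier
  Δ j k = a (j ℕ.+ k) - a j

  a≈a+Δ : ∀ j k → a (j ℕ.+ k) ≈ a j + Δ j k
  a≈a+Δ j k = solve 2 (λ x y → x := y :+ (x :- y)) refl _ _

  B : ℕ → ℕ → Carrier
  B j k = Δ j k ^ suc e + δ * (Δ j k * proj₁ (prime-binomial (a j) (Δ j k)) + a j ^ suc e)

  Δ-power : ∀ j k → Δ (suc j) k ≈ (a j + Δ j k) ^ d - a j ^ d
  Δ-power j k = begin
    a (suc (j ℕ.+ k)) - a (suc j)               ≈⟨ +-cong (a-suc (j ℕ.+ k)) (-‿cong (a-suc j)) ⟩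
    a (j ℕ.+ k) ^ d + x - (a j ^ d + x)         ≈⟨ +-congʳ (+-congʳ (^-congˡ d (a≈a+Δ j k))) ⟩
    (a j + Δ j k) ^ d + x - (a j ^ d + x)       ≈⟨ solve 3 (λ u v x → u :+ x :- (v :+ x) := u :- v) refl _ (a j ^ d) x ⟩
    (a j + Δ j k) ^ d - a j ^ d                 ∎

  Δ-suc : ∀ j k → Δ (suc j) k ≈ Δ j k * B j k
  Δ-suc j k = begin
    Δ (suc j) k                              ≈⟨ Δ-power j k ⟩
    (a j + Δ j k) ^ d - a j ^ d              ≈⟨ +-congʳ (proj₂ (prime-binomial (a j) (Δ j k))) ⟩
    a j ^ d + Δ j k * B j k - a j ^ d        ≈⟨ solve 2 (λ u v → u :+ v :- u := v) refl (a j ^ d) (Δ j k * B j k) ⟩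
    Δ j k * B j k                            ∎

  Δ-zero : ∀ k → Δ 0 k ≈ a k
  Δ-zero k = trans (+-congˡ (-‿cong a-zero)) (x-0≈x (a k))

  Δ-one : ∀ k → Δ 1 k ≈ a k * a k ^ suc e
  Δ-one k = begin
    Δ 1 k                           ≈⟨ Δ-power 0 k ⟩
    (a 0 + Δ 0 k) ^ d - a 0 ^ d     ≈⟨ +-cong (^-congˡ d (trans (+-cong a-zero (Δ-zero k)) (+-identityˡ _)))
                                          (-‿cong (trans (^-congˡ d a-zero) (zeroˡ _))) ⟩
    a k ^ d - 0#                    ≈⟨ x-0≈x _ ⟩
    a k * a k ^ suc e               ∎

  abstract
    -- Δ 1 k = (a k)^d with d ≥ 2, and each later Δ is a multiple of the preceding one. The second
    -- factor a k is what makes the cofactor in `a-multiple` equal to 1 modulo a k.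
    Δ-square : ∀ j k → Σ Carrier λ r → Δ (suc j) k ≈ a k * (a k * r)
    Δ-square zero    k = a k ^ e , Δ-one k
    Δ-square (suc j) k = let r , eq = Δ-square j k in r * B (suc j) k
      , trans (Δ-suc (suc j) k) (trans (*-congʳ eq)
          (solve 3 (λ a r b → a :* (a :* r) :* b := a :* (a :* (r :* b))) refl (a k) r _))

  Δ-multiple : ∀ j k → Σ Carrier λ r → Δ j k ≈ a k * r
  Δ-multiple zero    k = 1# , trans (Δ-zero k) (sym (*-identityʳ _))
  Δ-multiple (suc j) k = let r , eq = Δ-square j k in a k * r , eq

  abstract
    a-multiple : ∀ k q → Σ Carrier λ r → a (suc q ℕ.* suc k) ≈ a (suc k) * (1# + a (suc k) * r)
    a-multiple k zero    = 0# , (begin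
      a (suc k ℕ.+ 0)                     ≈⟨ reflexive (≡.cong a (ℕ.+-identityʳ (suc k))) ⟩
      a (suc k)                           ≈⟨ *-identityʳ _ ⟨
      a (suc k) * 1#                      ≈⟨ *-congˡ (sym (trans (+-congˡ (zeroʳ _)) (+-identityʳ 1#))) ⟩
      a (suc k) * (1# + a (suc k) * 0#)   ∎)
    a-multiple k (suc q) =
      let r , er = a-multiple k q
          -- The first argument is `j` - 1, because `Δ-square` speaks of a successor.
          s , es = Δ-square (k ℕ.+ q ℕ.* suc k) (suc k)
          j = suc q ℕ.* suc k
      in r + s , (begin
        a (suc k ℕ.+ j)                   ≈⟨ reflexive (≡.cong a (ℕ.+-comm (suc k) j)) ⟩
        a (j ℕ.+ suc k)                   ≈⟨ a≈a+Δ j (suc k) ⟩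
        a j + Δ j (suc k)                 ≈⟨ +-cong er es ⟩
        a (suc k) * (1# + a (suc k) * r) + a (suc k) * (a (suc k) * s)
          ≈⟨ solve 4 (λ a o r s → a :* (o :+ a :* r) :+ a :* (a :* s) := a :* (o :+ a :* (r :+ s))) refl (a (suc k)) 1# r s ⟩
        a (suc k) * (1# + a (suc k) * (r + s))   ∎)

  a-periodic : ∀ I n₀ → Mem I (a n₀) → ∀ q r → Mem I (a (r ℕ.+ q ℕ.* n₀) - a r)
  a-periodic I n₀ h zero    r = resp I (sym (trans (+-congʳ (reflexive (≡.cong a (ℕ.+-identityʳ r)))) (-‿inverseʳ _))) (mem0 I)
  a-periodic I n₀ h (suc q) r =
    let j = r ℕ.+ q ℕ.* n₀
        s , es = Δ-multiple j n₀
    in resp I (begin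
      Δ j n₀ + (a j - a r)        ≈⟨ solve 3 (λ x y z → (x :- y) :+ (y :- z) := x :- z) refl _ (a j) (a r) ⟩
      a (j ℕ.+ n₀) - a r          ≈⟨ +-congʳ (reflexive (≡.cong a (≡.trans (ℕ.+-assoc r (q ℕ.* n₀) n₀) (≡.cong (r ℕ.+_) (ℕ.+-comm (q ℕ.* n₀) n₀))))) ⟩
      a (r ℕ.+ suc q ℕ.* n₀) - a r  ∎)
      (mem+ I (resp I (sym es) (mem*ʳ I s h)) (a-periodic I n₀ h q r))

  module _ (δ≈0 : δ ≈ 0#) where
    open CharP δ≈0

    Δ-charP : ∀ j k → Δ j k ≈ a k ^ (d ℕ.^ j)
    Δ-charP zero    k = trans (Δ-zero k) (sym (*-identityʳ _))
    Δ-charP (suc j) k = begin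
      Δ (suc j) k                        ≈⟨ Δ-power j k ⟩
      (a j + Δ j k) ^ d - a j ^ d        ≈⟨ +-congʳ (frobenius-+ (a j) (Δ j k)) ⟩
      a j ^ d + Δ j k ^ d - a j ^ d      ≈⟨ solve 2 (λ u v → u :+ v :- u := v) refl (a j ^ d) (Δ j k ^ d) ⟩
      Δ j k ^ d                          ≈⟨ ^-congˡ d (Δ-charP j k) ⟩
      (a k ^ (d ℕ.^ j)) ^ d              ≈⟨ ^-assocʳ (a k) (d ℕ.^ j) d ⟩
      a k ^ (d ℕ.^ j ℕ.* d)              ≈⟨ ^-congʳ (a k) (ℕ.*-comm (d ℕ.^ j) d) ⟩
      a k ^ (d ℕ.^ suc j)                ∎

  -- Stands in for the choice of a maximal ideal, one a k at a time. As excluded middle for a (j +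
  -- 1) is not at hand, K is called twice: applied to J it refutes that a (j + 1) is a unit modulo
  -- J, and so J can be enlarged by a (j + 1) and stays proper.
  refine : ∀ j I → ¬ Mem I 1# →
    (∀ J → (∀ {y} → Mem I y → Mem J y) → ¬ Mem J 1# → (∀ k → k ℕ.≤ j → Mem J (a k) ⊎ Comax J (a k)) → ⊥) → ⊥
  refine zero    I proper K = K I (λ m → m) proper λ { zero z≤n → inj₁ (resp I (sym a-zero) (mem0 I)) }
  refine (suc j) I proper K = refine j I proper λ J I⊆J properJ dec →
    let extend : (J′ : Ideal) → (∀ {y} → Mem J y → Mem J′ y) → Mem J′ (a (suc j)) ⊎ Comax J′ (a (suc j)) →
                 ∀ k → k ℕ.≤ suc j → Mem J′ (a k) ⊎ Comax J′ (a k)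
        extend J′ J⊆J′ new k k≤ = split J J′ J⊆J′ dec new k k≤
        -- This is also the properness of `J ⊕ a (suc j)`, since `Comax` is membership of 1 in that
        -- ideal.
        ¬comax : ¬ Comax J (a (suc j))
        ¬comax c = K J I⊆J properJ (extend J (λ m → m) (inj₂ c))
    in K (J ⊕ a (suc j)) (λ m → ⊕-old J (a (suc j)) (I⊆J m)) ¬comax
         (extend (J ⊕ a (suc j)) (⊕-old J (a (suc j))) (inj₁ (⊕-new J (a (suc j)))))
    where
    split : ∀ J J′ → (∀ {y} → Mem J y → Mem J′ y) → (∀ k → k ℕ.≤ j → Mem J (a k) ⊎ Comax J (a k)) →
      Mem J′ (a (suc j)) ⊎ Comax J′ (a (suc j)) → ∀ k → k ℕ.≤ suc j → Mem J′ (a k) ⊎ Comax J′ (a k)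
    split J J′ J⊆J′ dec new k k≤ with k ℕ.≟ suc j
    ... | yes ≡.refl = new
    ... | no k≢ with dec k (ℕ.≤-pred (ℕ.≤∧≢⇒< k≤ k≢))
    ...   | inj₁ m = inj₁ (J⊆J′ m)
    ...   | inj₂ c = inj₂ (⊕-mono J J′ (a k) J⊆J′ c)

  least : ∀ J j → (∀ k → k ℕ.≤ j → Mem J (a k) ⊎ Comax J (a k)) → Mem J (a j) → 0 ℕ.< j →
    Σ ℕ λ n₀ → Mem J (a (suc n₀)) × (∀ r → 0 ℕ.< r → r ℕ.< suc n₀ → Comax J (a r))
  least J (suc j) dec mem 0<j = search j 0 ≡.refl (λ { (suc r) _ (s≤s ()) })
    where
    search : ∀ f i → i ℕ.+ f ≡ j → (∀ r → 0 ℕ.< r → r ℕ.< suc i → Comax J (a r)) →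
      Σ ℕ λ n₀ → Mem J (a (suc n₀)) × (∀ r → 0 ℕ.< r → r ℕ.< suc n₀ → Comax J (a r))
    search zero    i eq below = i , ≡.subst (λ z → Mem J (a (suc z))) (≡.trans (≡.sym eq) (ℕ.+-identityʳ i)) mem , below
    search (suc f) i eq below with dec (suc i) (s≤s (≡.subst (i ℕ.≤_) eq (ℕ.m≤m+n i (suc f))))
    ... | inj₁ m = i , m , below
    ... | inj₂ c = search f (suc i) (≡.trans (≡.sym (ℕ.+-suc i f)) eq) below′
      where
      below′ : ∀ r → 0 ℕ.< r → r ℕ.< suc (suc i) → Comax J (a r)
      below′ r 0<r (s≤s r≤) with r ℕ.≟ suc i
      ... | yes ≡.refl = c
      ... | no r≢      = below r 0<r (ℕ.≤∧≢⇒< r≤ r≢)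

  -- To be used over a ring of characteristic d, where each B l k has become the power (a k)^E. The
  -- exponent ε belongs to the factors of F_{d,1,n}, if these are divided out.
  module Coprimality
    (cancel : ∀ k y → a (suc k) * y ≈ 0# → y ≈ 0#)
    (n : ℕ) (ks : List ℕ) (ks>0 : All (0 ℕ.<_) ks) (σ⁺ σ⁻ : ℕ → Bool)
    (balanced : ∀ n₀ → 0 ℕ.< n₀ → ¬ (n₀ ≡ n) → countDivisible σ⁺ n₀ ks ≡ countDivisible σ⁻ n₀ ks)
    (E ε : ℕ) (g : Carrier)
    (relation : g * ∏ σ⁻ (λ k → a k ^ E) ks * ∏ σ⁺ (λ k → a k ^ ε) ks ≈
                ∏ σ⁺ (λ k → a k ^ E) ks * ∏ σ⁻ (λ k → a k ^ ε) ks) where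

    cancel-^ : ∀ k i y → a (suc k) ^ i * y ≈ 0# → y ≈ 0#
    cancel-^ k zero    y h = trans (sym (*-identityˡ y)) h
    cancel-^ k (suc i) y h = cancel-^ k i y (cancel k _ (trans (sym (*-assoc _ _ _)) h))

    module _ (J : Ideal) (proper : ¬ Mem J 1#) (n₀-1 : ℕ)
      (a∈J : Mem J (a (suc n₀-1))) (below : ∀ r → 0 ℕ.< r → r ℕ.< suc n₀-1 → Comax J (a r)) where
      private n₀ = suc n₀-1

      -- a k and a (k mod n₀) agree modulo J, and the remainder is a positive index below n₀.
      indivisible : ∀ k → ¬ (n₀ ∣ k) → Comax J (a k)
      indivisible k n₀∤k = ≡.subst (λ z → Comax J (a z)) (≡.sym (m≡m%n+[m/n]*n k n₀))
        (comax-shift J (a-periodic J n₀ a∈J (k / n₀) (k % n₀))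
          (below (k % n₀) (ℕ.n≢0⇒n>0 (λ eq → n₀∤k (ℕ∣.m%n≡0⇒n∣m k n₀ eq))) (m%n<n k n₀)))

      divisible : ∀ k → 0 ℕ.< k → n₀ ∣ k → Σ Carrier λ w → a k ≈ a n₀ * w × Comax J w
      divisible k 0<k (divides zero ≡.refl) = contradiction 0<k λ ()
      divisible k 0<k (divides (suc q) ≡.refl) = let r , er = a-multiple n₀-1 q in
        1# + a n₀ * r , er , (1# , resp J
          (trans (solve 2 (λ o z → :- z := o :- (o :+ z)) refl 1# (a n₀ * r)) (+-congˡ (-‿cong (sym (*-identityˡ _)))))
          (mem- J (mem*ʳ J r a∈J)))

      factors : ∀ i → All (λ k → (n₀ ∣ k → Σ Carrier λ w → a k ^ i ≈ a n₀ ^ i * w × Comax J w)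
                                × (¬ (n₀ ∣ k) → Comax J (a k ^ i))) ks
      factors i = All.map (λ {k} 0<k →
          (λ n₀∣k → let w , ew , cw = divisible k 0<k n₀∣k in
             w ^ i , trans (^-congˡ i ew) (^-distrib-* (a n₀) w i) , comax-^ J w i cw)
        , (λ n₀∤k → comax-^ J (a k) i (indivisible k n₀∤k))) ks>0

      -- By `balanced`, a n₀ occurs equally often on both sides of `relation` and cancels. What is
      -- left says that W₃ W₄, a unit modulo J, is a multiple of g, so g ∈ J would make J improper.
      n₀≢n⇒⊥ : ¬ (n₀ ≡ n) → Mem J g → ⊥
      n₀≢n⇒⊥ n₀≢n g∈J =
        let W₁ , e₁ , c₁ = ∏-factor J n₀ (a n₀ ^ E) σ⁻ _ ks (factors E)
            W₂ , e₂ , c₂ = ∏-factor J n₀ (a n₀ ^ ε) σ⁺ _ ks (factors ε)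
            W₃ , e₃ , c₃ = ∏-factor J n₀ (a n₀ ^ E) σ⁺ _ ks (factors E)
            W₄ , e₄ , c₄ = ∏-factor J n₀ (a n₀ ^ ε) σ⁻ _ ks (factors ε)
            c  = countDivisible σ⁺ n₀ ks
            c≡ = balanced n₀ (s≤s z≤n) n₀≢n
            h  = (a n₀ ^ E) ^ c
            h′ = (a n₀ ^ ε) ^ c
            eq : h * (h′ * (W₃ * W₄ - g * (W₁ * W₂))) ≈ 0#
            eq = begin
              h * (h′ * (W₃ * W₄ - g * (W₁ * W₂)))
                ≈⟨ solve 7 (λ h h′ w₁ w₂ w₃ w₄ g → h :* (h′ :* (w₃ :* w₄ :- g :* (w₁ :* w₂)))
                     := (h :* w₃) :* (h′ :* w₄) :- g :* (h :* w₁) :* (h′ :* w₂)) refl h h′ W₁ W₂ W₃ W₄ g ⟩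
              (h * W₃) * (h′ * W₄) - g * (h * W₁) * (h′ * W₂)
                ≈⟨ +-cong (*-cong (sym e₃) (trans (*-congʳ (reflexive (≡.cong ((a n₀ ^ ε) ^_) c≡))) (sym e₄)))
                    (-‿cong (*-cong (*-congˡ (trans (*-congʳ (reflexive (≡.cong ((a n₀ ^ E) ^_) c≡))) (sym e₁))) (sym e₂))) ⟩
              ∏ σ⁺ (λ k → a k ^ E) ks * ∏ σ⁻ (λ k → a k ^ ε) ks - g * ∏ σ⁻ (λ k → a k ^ E) ks * ∏ σ⁺ (λ k → a k ^ ε) ks
                ≈⟨ +-congˡ (-‿cong relation) ⟩
              ∏ σ⁺ (λ k → a k ^ E) ks * ∏ σ⁻ (λ k → a k ^ ε) ks - ∏ σ⁺ (λ k → a k ^ E) ks * ∏ σ⁻ (λ k → a k ^ ε) ks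
                ≈⟨ -‿inverseʳ _ ⟩
              0# ∎
            z : W₃ * W₄ - g * (W₁ * W₂) ≈ 0#
            z = cancel-^ n₀-1 (ε ℕ.* c) _ (trans (*-congʳ (sym (^-assocʳ (a n₀) ε c)))
                  (cancel-^ n₀-1 (E ℕ.* c) _ (trans (*-congʳ (sym (^-assocʳ (a n₀) E c))) eq)))
            W∈J : Mem J (W₃ * W₄)
            W∈J = resp J (trans (sym (+-identityˡ _)) (trans (+-congʳ (sym z))
                    (solve 2 (λ x y → x :- y :+ y := x) refl (W₃ * W₄) (g * (W₁ * W₂))))) (mem*ʳ J (W₁ * W₂) g∈J)
            u , hu = comax-* J W₃ W₄ c₃ c₄
        in proper (resp J (solve 2 (λ o y → o :- y :+ y := o) refl 1# (u * (W₃ * W₄))) (mem+ J hu (mem* J u W∈J)))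

    coprime : ∀ j → 0 ℕ.< j → ¬ (n ∣ j) → ¬ ¬ Mem (zeroIdeal ⊕ g ⊕ a j) 1#
    coprime j 0<j n∤j proper = refine j (zeroIdeal ⊕ g ⊕ a j) proper λ J I⊆J properJ dec →
      let aj∈J = I⊆J (⊕-new (zeroIdeal ⊕ g) (a j))
          n₀-1 , mem , below = least J j dec aj∈J 0<j
          -- If n₀ did not divide j, then a j would be a unit modulo J although it lies in J. Since
          -- n does not divide j, this separates n₀ from n.
          notAll : ¬ ¬ (suc n₀-1 ∣ j)
          notAll n₀∤j = let u , h = indivisible J properJ n₀-1 mem below j n₀∤j in
            properJ (resp J (solve 2 (λ o y → o :- y :+ y := o) refl 1# (u * a j)) (mem+ J h (mem* J u aj∈J)))
      in notAll λ n₀∣j → n₀≢n⇒⊥ J properJ n₀-1 mem below (λ { ≡.refl → n∤j n₀∣j })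
           (I⊆J (⊕-old (zeroIdeal ⊕ g) (a j) (⊕-new zeroIdeal g)))

-- The Möbius function

positive negative : ℤ → Bool
positive (ℤ.+ 1)    = true
positive _          = false
negative ℤ.-[1+ 0 ] = true
negative _          = false

mob-1 : ∀ f q → mob f 1 q ≡ ℤ.+ 1
mob-1 zero    q = ≡.refl
mob-1 (suc f) q = ≡.refl

module _ {j q : ℕ} (1<j : 1 ℕ.< j) where

  mob-skip : ∀ f → ¬ (2 ℕ.+ q ∣ j) → mob (suc f) j q ≡ mob f j (suc q)
  mob-skip f ∤j rewrite dec-false (j ℕ.≤? 1) (ℕ.<⇒≱ 1<j) | dec-false ((2 ℕ.+ q) ∣? j) ∤j = ≡.refl

  mob-hit : ∀ f → 2 ℕ.+ q ∣ j → ¬ ((2 ℕ.+ q) ℕ.* (2 ℕ.+ q) ∣ j) → mob (suc f) j q ≡ ℤ.- mob f (j / (2 ℕ.+ q)) (suc q)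
  mob-hit f ∣j ∤j rewrite dec-false (j ℕ.≤? 1) (ℕ.<⇒≱ 1<j) | dec-true ((2 ℕ.+ q) ∣? j) ∣j
    | dec-false ((2 ℕ.+ q) ℕ.* (2 ℕ.+ q) ∣? j) ∤j = ≡.refl

  mob-square : ∀ f → (2 ℕ.+ q) ℕ.* (2 ℕ.+ q) ∣ j → mob (suc f) j q ≡ ℤ.+ 0
  mob-square f ∣j rewrite dec-false (j ℕ.≤? 1) (ℕ.<⇒≱ 1<j) | dec-true ((2 ℕ.+ q) ∣? j) (ℕ∣.∣-trans (ℕ∣.m∣m*n (2 ℕ.+ q)) ∣j)
    | dec-true ((2 ℕ.+ q) ℕ.* (2 ℕ.+ q) ∣? j) ∣j = ≡.refl

rough⇒≥ : ∀ {m j} → 1 ℕ.< j → m Rough j → m ℕ.≤ j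
rough⇒≥ 1<j = rough⇒≤ {{ℕ.n>1⇒nonTrivial 1<j}}

0<⇒1⊎1< : ∀ {j} → 0 ℕ.< j → j ≡ 1 ⊎ 1 ℕ.< j
0<⇒1⊎1< {suc zero}    _ = inj₁ ≡.refl
0<⇒1⊎1< {suc (suc j)} _ = inj₂ (s≤s (s≤s z≤n))

-- Each step trades one unit of fuel for one of q, so j ≤ f + q persists. When the fuel is gone, j ≤
-- q rules out a (2 + q)-rough j > 1, and only j = 1 remains, where `mob` is 1 for every fuel.
mob-fuel : ∀ f f′ j q → 0 ℕ.< j → (2 ℕ.+ q) Rough j → j ℕ.≤ f ℕ.+ q → j ℕ.≤ f′ ℕ.+ q → mob f j q ≡ mob f′ j q
mob-fuel f f′ j q 0<j rough h h′ with 0<⇒1⊎1< 0<j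
... | inj₁ ≡.refl = ≡.trans (mob-1 f q) (≡.sym (mob-1 f′ q))
mob-fuel zero    f′ j q 0<j rough h h′ | inj₂ 1<j = contradiction (rough⇒≥ 1<j rough) (ℕ.<⇒≱ (s≤s (ℕ.m≤n⇒m≤1+n h)))
mob-fuel (suc f) zero j q 0<j rough h h′ | inj₂ 1<j = contradiction (rough⇒≥ 1<j rough) (ℕ.<⇒≱ (s≤s (ℕ.m≤n⇒m≤1+n h′)))
mob-fuel (suc f) (suc f′) j q 0<j rough h h′ | inj₂ 1<j
  with (2 ℕ.+ q) ∣? j | (2 ℕ.+ q) ℕ.* (2 ℕ.+ q) ∣? j
... | no ∤j  | _     = ≡.trans (mob-skip 1<j f ∤j) (≡.trans
    (mob-fuel f f′ j (suc q) 0<j (∤⇒rough-suc ∤j rough) (≡.subst (j ℕ.≤_) (≡.sym (ℕ.+-suc f q)) h) (≡.subst (j ℕ.≤_) (≡.sym (ℕ.+-suc f′ q)) h′))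
    (≡.sym (mob-skip 1<j f′ ∤j)))
... | yes ∣j | yes sq = ≡.trans (mob-square 1<j f sq) (≡.sym (mob-square 1<j f′ sq))
... | yes ∣j | no ¬sq = ≡.trans (mob-hit 1<j f ∣j ¬sq) (≡.trans (≡.cong ℤ.-_
    (mob-fuel f f′ j′ (suc q) (DivMod.m≥n⇒m/n>0 (rough⇒≥ 1<j rough)) (∤⇒rough-suc ∤j′ (rough∧∣⇒rough rough (ℕ∣.m/n∣m ∣j)))
      (≡.subst (j′ ℕ.≤_) (≡.sym (ℕ.+-suc f q)) (ℕ.≤-trans (DivMod.m/n≤m j (2 ℕ.+ q)) h))
      (≡.subst (j′ ℕ.≤_) (≡.sym (ℕ.+-suc f′ q)) (ℕ.≤-trans (DivMod.m/n≤m j (2 ℕ.+ q)) h′))))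
    (≡.sym (mob-hit 1<j f′ ∣j ¬sq)))
  where
  j′ = j / (2 ℕ.+ q)
  ∤j′ : ¬ (2 ℕ.+ q ∣ j′)
  ∤j′ h = ¬sq (≡.subst ((2 ℕ.+ q) ℕ.* (2 ℕ.+ q) ∣_) (DivMod.m*[n/m]≡n ∣j) (ℕ∣.*-monoʳ-∣ (2 ℕ.+ q) h))

mob-rough : ∀ s f j q → 1 ℕ.< j → (2 ℕ.+ (s ℕ.+ q)) Rough j → mob (s ℕ.+ f) j q ≡ mob f j (s ℕ.+ q)
mob-rough zero    f j q 1<j rough = ≡.refl
mob-rough (suc s) f j q 1<j rough = ≡.trans
  (mob-skip 1<j (s ℕ.+ f) (λ h → rough (ℕ∣.hasNonTrivialDivisor (s≤s (s≤s (s≤s (ℕ.m≤n+m q s)))) h)))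
  (≡.trans (mob-rough s f j (suc q) 1<j (≡.subst (λ z → (2 ℕ.+ z) Rough j) (≡.sym (ℕ.+-suc s q)) rough))
    (≡.cong (mob f j) (ℕ.+-suc s q)))

μ-rough : ∀ ρ j → 1 ℕ.< j → (2 ℕ.+ ρ) Rough j → Σ ℕ λ f → j ≡ suc f ℕ.+ ρ × μ j ≡ mob (suc f) j ρ
μ-rough ρ j 1<j rough with ℕ.m≤n⇒∃[o]m+o≡n (rough⇒≥ 1<j rough)
... | o , ≡.refl = suc o , ≡.cong (λ z → suc (suc z)) (ℕ.+-comm ρ o) , ≡.trans
  (≡.cong (λ z → mob z j 0) (≡.sym (≡.trans (ℕ.+-suc ρ (suc o)) (≡.cong suc (ℕ.+-suc ρ o)))))
  (≡.trans (mob-rough ρ (suc (suc o)) j 0 1<j (≡.subst (λ z → (2 ℕ.+ z) Rough j) (≡.sym (ℕ.+-identityʳ ρ)) rough))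
    (≡.cong (mob (suc (suc o)) j) (ℕ.+-identityʳ ρ)))

μ-square : ∀ ρ j → 0 ℕ.< j → (2 ℕ.+ ρ) Rough j → (2 ℕ.+ ρ) ℕ.* (2 ℕ.+ ρ) ∣ j → μ j ≡ ℤ.+ 0
μ-square ρ j 0<j rough sq with μ-rough ρ j 1<j rough
  where 1<j : 1 ℕ.< j
        1<j = ℕ.<-≤-trans (s≤s (s≤s z≤n)) (ℕ∣.∣⇒≤ {{ℕ.>-nonZero 0<j}} sq)
... | f , _ , eq = ≡.trans eq (mob-square (ℕ.<-≤-trans (s≤s (s≤s z≤n)) (ℕ∣.∣⇒≤ {{ℕ.>-nonZero 0<j}} sq)) f sq)

-- Roughness makes 2 + ρ the first divisor that trial division meets in the product. After this hit
-- it continues with j at the next candidate, as the computation of μ j also does, except for the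
-- amount of fuel.
μ-flip : ∀ ρ j → 0 ℕ.< j → (2 ℕ.+ ρ) Rough (j ℕ.* (2 ℕ.+ ρ)) → ¬ (2 ℕ.+ ρ ∣ j) → μ (j ℕ.* (2 ℕ.+ ρ)) ≡ ℤ.- μ j
μ-flip ρ j 0<j rough ∤j with μ-rough ρ (j ℕ.* (2 ℕ.+ ρ)) 1<jr rough
  where 1<jr : 1 ℕ.< j ℕ.* (2 ℕ.+ ρ)
        1<jr = ℕ.*-mono-≤ 0<j (s≤s (s≤s z≤n))
... | f , jr≡ , eq = ≡.trans eq (≡.trans (mob-hit (ℕ.*-mono-≤ 0<j (s≤s (s≤s z≤n))) f (ℕ∣.n∣m*n j) ¬sq)
    (≡.cong ℤ.-_ (≡.trans (≡.cong (λ z → mob f z (suc ρ)) (DivMod.m*n/n≡m j (2 ℕ.+ ρ))) (tail (0<⇒1⊎1< 0<j)))))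
  where
  r = 2 ℕ.+ ρ
  roughj : r Rough j
  roughj = rough∧∣⇒rough rough (ℕ∣.m∣m*n r)
  ¬sq : ¬ (r ℕ.* r ∣ j ℕ.* r)
  ¬sq h = ∤j (ℕ∣.*-cancelʳ-∣ r h)
  tail : j ≡ 1 ⊎ 1 ℕ.< j → mob f j (suc ρ) ≡ μ j
  tail (inj₁ ≡.refl) = mob-1 f (suc ρ)
  tail (inj₂ 1<j) with μ-rough ρ j 1<j roughj
  ... | f′ , j≡ , eq′ = ≡.trans
    (mob-fuel f f′ j (suc ρ) 0<j (∤⇒rough-suc ∤j roughj)
      (ℕ.≤-trans (ℕ.m≤m*n j r) (ℕ.≤-reflexive (≡.trans jr≡ (≡.sym (ℕ.+-suc f ρ)))))
      (ℕ.≤-reflexive (≡.trans j≡ (≡.sym (ℕ.+-suc f′ ρ)))))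
    (≡.sym (≡.trans eq′ (mob-skip 1<j f′ ∤j)))

leastDivisor : ∀ M → 1 ℕ.< M → Σ ℕ λ ρ → 2 ℕ.+ ρ ∣ M × (2 ℕ.+ ρ) Rough M
leastDivisor M 1<M with ℕ.m≤n⇒∃[o]m+o≡n 1<M
... | o , eq = search o 0 (≡.trans (≡.cong (λ z → suc (suc z)) (ℕ.+-identityʳ o)) eq) 2-rough
  where
  search : ∀ f ρ → 2 ℕ.+ (f ℕ.+ ρ) ≡ M → (2 ℕ.+ ρ) Rough M → Σ ℕ λ ρ → 2 ℕ.+ ρ ∣ M × (2 ℕ.+ ρ) Rough M
  search zero    ρ eq rough = ρ , ℕ∣.∣-reflexive eq , rough
  search (suc f) ρ eq rough with (2 ℕ.+ ρ) ∣? M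
  ... | yes ∣M = ρ , ∣M , rough
  ... | no ∤M  = search f (suc ρ) (≡.trans (≡.cong (λ z → suc (suc z)) (ℕ.+-suc f ρ)) eq) (∤⇒rough-suc ∤M rough)

-- Each image is deleted from `ys` before the induction goes on; injectivity of R keeps the later
-- images among what is left.
length-injection : ∀ {A : Set} (R : A → A → Set) (xs ys : List A) → Unique xs →
  (∀ {x} → x ∈ xs → Σ A λ y → y ∈ ys × R x y) → (∀ {x x′ y} → R x y → R x′ y → x ≡ x′) →
  length xs ℕ.≤ length ys
length-injection R []       ys uniq f inj = z≤n
length-injection R (x ∷ xs) ys (x∉xs ∷ uniq) f inj with f (here ≡.refl)
... | y , y∈ys , Rxy with ∈-∃++ y∈ys
...   | ys₁ , ys₂ , ≡.refl = ℕ.≤-trans (s≤s (length-injection R xs (ys₁ ++ ys₂) uniq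
          (λ x′∈ → let y′ , y′∈ , R′ = f (there x′∈) in
            y′ , drop (∈-++⁻ ys₁ y′∈) (λ eq → All.lookup x∉xs x′∈ (inj Rxy (≡.subst (R _) eq R′))) , R′) inj))
        (ℕ.≤-reflexive (≡.sym (≡.trans (List.length-++ ys₁) (≡.trans (ℕ.+-suc (length ys₁) _) (≡.cong suc (≡.sym (List.length-++ ys₁)))))))
  where
  drop : ∀ {y′} → y′ ∈ ys₁ ⊎ y′ ∈ y ∷ ys₂ → y′ ≢ y → y′ ∈ ys₁ ++ ys₂
  drop (inj₁ h)           ne = ∈-++⁺ˡ h
  drop (inj₂ (here eq))   ne = contradiction eq ne
  drop (inj₂ (there h))   ne = ∈-++⁺ʳ ys₁ h

safeDiv-≡ : ∀ n j k → 0 ℕ.< k → n ≡ j ℕ.* k → safeDiv n k ≡ j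
safeDiv-≡ n j (suc k) _ ≡.refl = DivMod.m*n/n≡m j (suc k)

-- Cancellation of the signs μ(n/k) over the multiples k of n₀

module _ (n : ℕ) (0<n : 0 ℕ.< n) where

  σ⁺ σ⁻ : ℕ → Bool
  σ⁺ k = positive (μ (safeDiv n k))
  σ⁻ k = negative (μ (safeDiv n k))

  divisors-unique : Unique (divisors n)
  divisors-unique = Unique.filter⁺ (_∣? n) (Unique.upTo⁺ (suc n))

  ∈-divisors⁻ : ∀ {k} → k ∈ divisors n → 0 ℕ.< k × k ∣ n
  ∈-divisors⁻ k∈ with proj₂ (∈-filter⁻ (_∣? n) {xs = upTo (suc n)} k∈)
  ... | divides q eq = ℕ.n≢0⇒n>0 (λ { ≡.refl → ℕ.<⇒≢ 0<n (≡.sym (≡.trans eq (ℕ.*-zeroʳ q))) }) , divides q eq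

  ∈-divisors⁺ : ∀ {k} → k ∣ n → k ∈ divisors n
  ∈-divisors⁺ k∣n = ∈-filter⁺ (_∣? n) (∈-upTo⁺ (s≤s (ℕ∣.∣⇒≤ {{ℕ.>-nonZero 0<n}} k∣n))) k∣n

  select : ∀ (σ : ℕ → Bool) n₀ {k} → k ∈ filterᵇ (λ k → σ k ∧ does (n₀ ∣? k)) (divisors n) → k ∈ divisors n × T (σ k) × n₀ ∣ k
  select σ n₀ {k} k∈ with ∈-filter⁻ (λ k → T? (σ k ∧ does (n₀ ∣? k))) {xs = divisors n} k∈
  ... | k∈′ , t with σ k | n₀ ∣? k
  ...   | true | yes n₀∣k = k∈′ , _ , n₀∣k

  unselect : ∀ (σ : ℕ → Bool) n₀ {k} → k ∈ divisors n → T (σ k) → n₀ ∣ k → k ∈ filterᵇ (λ k → σ k ∧ does (n₀ ∣? k)) (divisors n)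
  unselect σ n₀ {k} k∈ t n₀∣k = ∈-filter⁺ (λ k → T? (σ k ∧ does (n₀ ∣? k))) k∈ both
    where
    both : T (σ k ∧ does (n₀ ∣? k))
    both with σ k
    ... | true rewrite dec-true (n₀ ∣? k) n₀∣k = _

  -- Moving the least prime r of n/n₀ in or out of n/k changes the sign of μ (n/k); on squarefree n/k this is a pairing.
  module _ (s t : ℤ → Bool) (s0 : ¬ T (s (ℤ.+ 0))) (s⇒t : ∀ z → T (s z) → T (t (ℤ.- z))) (n₀ M ρ : ℕ)
    (n≡ : n ≡ M ℕ.* n₀) (r∣M : 2 ℕ.+ ρ ∣ M) (rough : (2 ℕ.+ ρ) Rough M) where
    private
      r = 2 ℕ.+ ρ
      r-prime : Prime r
      r-prime = rough∧∣⇒prime rough r∣M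
      0<n₀ : 0 ℕ.< n₀
      0<n₀ = ℕ.n≢0⇒n>0 (λ { ≡.refl → ℕ.<⇒≢ 0<n (≡.sym (≡.trans n≡ (ℕ.*-zeroʳ M))) })

    -- `up` moves r from n/k into k, and `down` moves it back. The condition on j says that r
    -- divides n/k exactly once in the first case and not at all in the second, so that no k′ is
    -- reached in both ways.
    data Partner (k k′ : ℕ) : Set where
      up   : ∀ j → n ≡ j ℕ.* r ℕ.* k → ¬ (r ∣ j) → k′ ≡ k ℕ.* r → Partner k k′
      down : ∀ j → n ≡ j ℕ.* (k′ ℕ.* r) → ¬ (r ∣ j) → k ≡ k′ ℕ.* r → Partner k k′

    clash : ∀ {k j k′ j′} → n ≡ j ℕ.* r ℕ.* k → ¬ (r ∣ j) → k′ ≡ k ℕ.* r → n ≡ j′ ℕ.* (k′ ℕ.* r) → ⊥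
    clash {k} {j} {k′} {j′} e ∤j ≡.refl e′ = ∤j (divides j′ (ℕ.*-cancelʳ-≡ j (j′ ℕ.* r) k′ {{ℕ.≢-nonZero k′≢0}}
      (≡.trans (≡.trans (≡.cong (j ℕ.*_) (ℕ.*-comm k r)) (≡.sym (ℕ.*-assoc j r k)))
        (≡.trans (≡.sym e) (≡.trans e′ (≡.trans (≡.cong (j′ ℕ.*_) (ℕ.*-comm k′ r)) (≡.sym (ℕ.*-assoc j′ r k′))))))))
      where
      k′≢0 : k ℕ.* r ≢ 0
      k′≢0 eq = ℕ.<⇒≢ 0<n (≡.sym (≡.trans e′ (≡.trans (≡.cong (λ z → j′ ℕ.* (z ℕ.* r)) eq) (ℕ.*-zeroʳ j′))))

    partner-injective : ∀ {k₁ k₂ k′} → Partner k₁ k′ → Partner k₂ k′ → k₁ ≡ k₂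
    partner-injective {k₁} {k₂} (up j e ∤ h) (up j′ e′ ∤′ h′) = ℕ.*-cancelʳ-≡ k₁ k₂ r (≡.trans (≡.sym h) h′)
    partner-injective (up j e ∤ h) (down j′ e′ ∤′ h′) = ⊥-elim (clash {j′ = j′} e ∤ h e′)
    partner-injective (down j e ∤ h) (up j′ e′ ∤′ h′) = ⊥-elim (clash {j′ = j} e′ ∤′ h′ e)
    partner-injective (down j e ∤ h) (down j′ e′ ∤′ h′) = ≡.trans h (≡.sym h′)

    partner : ∀ k → 0 ℕ.< k → k ∣ n → T (s (μ (safeDiv n k))) → n₀ ∣ k →
      Σ ℕ λ k′ → (k′ ∣ n × T (t (μ (safeDiv n k′))) × n₀ ∣ k′) × Partner k k′
    partner k 0<k (divides j n≡jk) sgn (divides i k≡in₀) = go (r ∣? j)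
      where
      M≡ : M ≡ j ℕ.* i
      M≡ = ℕ.*-cancelʳ-≡ M (j ℕ.* i) n₀ {{ℕ.>-nonZero 0<n₀}}
        (≡.trans (≡.sym n≡) (≡.trans n≡jk (≡.trans (≡.cong (j ℕ.*_) k≡in₀) (≡.sym (ℕ.*-assoc j i n₀)))))
      0<j : 0 ℕ.< j
      0<j = ℕ.n≢0⇒n>0 (λ { ≡.refl → ℕ.<⇒≢ 0<n (≡.sym n≡jk) })
      roughj : r Rough j
      roughj = rough∧∣⇒rough rough (divides i (≡.trans M≡ (ℕ.*-comm j i)))
      sgnj : T (s (μ j))
      sgnj = ≡.subst (λ z → T (s (μ z))) (safeDiv-≡ n j k 0<k n≡jk) sgn
      go : _ → Σ ℕ λ k′ → (k′ ∣ n × T (t (μ (safeDiv n k′))) × n₀ ∣ k′) × Partner k k′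
      go (yes (divides j′ j≡)) = k ℕ.* r , (divides j′ n≡′ , sgn′ , ℕ∣.∣m⇒∣m*n r (divides i k≡in₀)) , up j′ (≡.trans n≡jk (≡.cong (ℕ._* k) j≡)) r∤j′ ≡.refl
        where
        -- Otherwise r² ∣ j and μ j = 0, a value that `s` does not select.
        r∤j′ : ¬ (r ∣ j′)
        r∤j′ h = s0 (≡.subst (λ z → T (s z)) (μ-square ρ j 0<j roughj (≡.subst (r ℕ.* r ∣_) (≡.sym j≡) (ℕ∣.*-monoˡ-∣ r h))) sgnj)
        n≡′ : n ≡ j′ ℕ.* (k ℕ.* r)
        n≡′ = ≡.trans n≡jk (≡.trans (≡.cong (ℕ._* k) j≡) (≡.trans (ℕ.*-assoc j′ r k) (≡.cong (j′ ℕ.*_) (ℕ.*-comm r k))))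
        0<j′ : 0 ℕ.< j′
        0<j′ = ℕ.n≢0⇒n>0 (λ { ≡.refl → ℕ.<⇒≢ 0<j (≡.sym j≡) })
        μj′ : ℤ.- μ j ≡ μ j′
        μj′ = ≡.trans (≡.cong (λ z → ℤ.- μ z) j≡) (≡.trans (≡.cong ℤ.-_ (μ-flip ρ j′ 0<j′ (≡.subst (r Rough_) j≡ roughj) r∤j′)) (ℤ.neg-involutive (μ j′)))
        sgn′ : T (t (μ (safeDiv n (k ℕ.* r))))
        sgn′ = ≡.subst (λ z → T (t z)) (≡.trans μj′ (≡.cong μ (≡.sym (safeDiv-≡ n j′ (k ℕ.* r) (ℕ.*-mono-≤ 0<k (s≤s z≤n)) n≡′)))) (s⇒t (μ j) sgnj)
      -- Here n/n₀ = j i with j = n/k and i = k/n₀. As r does not divide j, it divides i, and k/r is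
      -- still a multiple of n₀.
      go (no r∤j) with euclidsLemma j i r-prime (≡.subst (r ∣_) M≡ r∣M)
      ... | inj₁ r∣j = contradiction r∣j r∤j
      ... | inj₂ (divides i′ i≡) = k′ , (divides (j ℕ.* r) n≡′ , sgn′ , divides i′ ≡.refl) , down j (≡.trans n≡jk (≡.cong (j ℕ.*_) k≡)) r∤j k≡
        where
        k′ = i′ ℕ.* n₀
        k≡ : k ≡ k′ ℕ.* r
        k≡ = ≡.trans k≡in₀ (≡.trans (≡.cong (ℕ._* n₀) i≡) (≡.trans (ℕ.*-assoc i′ r n₀)
               (≡.trans (≡.cong (i′ ℕ.*_) (ℕ.*-comm r n₀)) (≡.sym (ℕ.*-assoc i′ n₀ r)))))
        n≡′ : n ≡ j ℕ.* r ℕ.* k′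
        n≡′ = ≡.trans n≡jk (≡.trans (≡.cong (j ℕ.*_) (≡.trans k≡ (ℕ.*-comm k′ r))) (≡.sym (ℕ.*-assoc j r k′)))
        0<k′ : 0 ℕ.< k′
        0<k′ = ℕ.n≢0⇒n>0 (λ eq → ℕ.<⇒≢ 0<k (≡.sym (≡.trans k≡ (≡.cong (ℕ._* r) eq))))
        sgn′ : T (t (μ (safeDiv n k′)))
        sgn′ = ≡.subst (λ z → T (t z)) (≡.trans
          (≡.sym (μ-flip ρ j 0<j (rough∧∣⇒rough rough (divides i′ (≡.trans M≡ (≡.trans (≡.cong (j ℕ.*_) i≡)
             (≡.trans (≡.sym (ℕ.*-assoc j i′ r)) (≡.trans (≡.cong (ℕ._* r) (ℕ.*-comm j i′)) (ℕ.*-assoc i′ j r))))))) r∤j))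
          (≡.cong μ (≡.sym (safeDiv-≡ n (j ℕ.* r) k′ 0<k′ n≡′)))) (s⇒t (μ j) sgnj)

    count-≤ : countDivisible (λ k → s (μ (safeDiv n k))) n₀ (divisors n) ℕ.≤ countDivisible (λ k → t (μ (safeDiv n k))) n₀ (divisors n)
    count-≤ = length-injection Partner _ _ (Unique.filter⁺ (λ k → T? _) divisors-unique)
      (λ {k} k∈ → let k∈′ , sgn , n₀∣k = select (λ k → s (μ (safeDiv n k))) n₀ k∈
                      0<k , k∣n = ∈-divisors⁻ k∈′
                      k′ , (k′∣n , sgn′ , n₀∣k′) , R = partner k 0<k k∣n sgn n₀∣k
                  in k′ , unselect (λ k → t (μ (safeDiv n k))) n₀ (∈-divisors⁺ k′∣n) sgn′ n₀∣k′ , R)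
      partner-injective

  count-∤ : ∀ σ n₀ → ¬ (n₀ ∣ n) → countDivisible σ n₀ (divisors n) ≡ 0
  count-∤ σ n₀ n₀∤n = ℕ.n≤0⇒n≡0 (length-injection _≡_ _ [] (Unique.filter⁺ (λ k → T? _) divisors-unique)
    (λ k∈ → let k∈′ , _ , n₀∣k = select σ n₀ k∈ in contradiction (ℕ∣.∣-trans n₀∣k (proj₂ (∈-divisors⁻ k∈′))) n₀∤n)
    (λ { ≡.refl ≡.refl → ≡.refl }))

  balanced : ∀ n₀ → 0 ℕ.< n₀ → n₀ ≢ n → countDivisible σ⁺ n₀ (divisors n) ≡ countDivisible σ⁻ n₀ (divisors n)
  balanced n₀ 0<n₀ n₀≢n with n₀ ∣? n
  ... | no n₀∤n = ≡.trans (count-∤ σ⁺ n₀ n₀∤n) (≡.sym (count-∤ σ⁻ n₀ n₀∤n))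
  ... | yes (divides M n≡) with leastDivisor M 1<M
    where
    1<M : 1 ℕ.< M
    1<M with 0<⇒1⊎1< (ℕ.n≢0⇒n>0 {M} (λ { ≡.refl → ℕ.<⇒≢ 0<n (≡.sym n≡) }))
    ... | inj₁ ≡.refl = contradiction (≡.sym (≡.trans n≡ (ℕ.+-identityʳ n₀))) n₀≢n
    ... | inj₂ h = h
  ...   | ρ , r∣M , rough = ℕ.≤-antisym
    (count-≤ positive negative (λ ()) (λ { (ℤ.+ 1) _ → _ ; (ℤ.+ 0) () ; (ℤ.+ suc (suc _)) () ; ℤ.-[1+ _ ] () }) n₀ M ρ n≡ r∣M rough)
    (count-≤ negative positive (λ ()) (λ { ℤ.-[1+ 0 ] _ → _ ; ℤ.-[1+ suc _ ] () ; (ℤ.+ _) () }) n₀ M ρ n≡ r∣M rough)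

-- The relation at c₀

¬¬-All : ∀ {A : Set} {P : A → Set} xs → All (λ x → ¬ ¬ P x) xs → ¬ ¬ All P xs
¬¬-All []       []       k = k []
¬¬-All (x ∷ xs) (h ∷ hs) k = h λ px → ¬¬-All xs hs λ pxs → k (px ∷ pxs)

properDivisors : ℕ → List ℕ
properDivisors n = filter (_∣? n) (upTo n)

divisors≡ : ∀ n → divisors n ≡ properDivisors n ++ n ∷ []
divisors≡ n = ≡.trans (≡.cong (filter (_∣? n)) (≡.sym (List.upTo-∷ʳ n)))
  (≡.trans (List.filter-++ (_∣? n) (upTo n) (n ∷ [])) (≡.cong (properDivisors n ++_) (List.filter-accept (_∣? n) ℕ∣.∣-refl)))

IsRegularMod : (T : CommutativeRing 0ℓ 0ℓ) → ℤ→ T → ℕ → (ℕ → CommutativeRing.Carrier T) → Set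
IsRegularMod T φ d a = ∀ k y → Mem I (a (suc k) * y) → Mem I y
  where
  open ℤ-Algebra T φ
  I : Ideal
  I = zeroIdeal ⊕ ι (ℤ.+ d)

module Assembly (T : CommutativeRing 0ℓ 0ℓ) (φ : ℤ→ T) (e : ℕ) (d-prime : Prime (suc (suc e)))
  (a : ℕ → CommutativeRing.Carrier T) (x : CommutativeRing.Carrier T) (isOrbit : IsOrbit T φ (suc (suc e)) a x)
  (Δ-regular : ∀ j k y → CommutativeRing._≈_ T (CommutativeRing._*_ T (OrbitAlgebra.Δ T φ e d-prime a x isOrbit j (suc k)) y) (CommutativeRing.0# T) →
     CommutativeRing._≈_ T y (CommutativeRing.0# T))
  (a-regular-mod : IsRegularMod T φ (suc (suc e)) a) where

  open IsOrbit isOrbit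
  open ℤ-Algebra T φ
  open PrimeBinomial T φ e d-prime
  open OrbitAlgebra T φ e d-prime a x isOrbit
  open ℤ-Solver T φ using (solve; _:+_; _:*_; :-_; _:-_; _:=_; con)
  open Products T φ

  a-regular : ∀ k y → a (suc k) * y ≈ 0# → y ≈ 0#
  a-regular k y h = Δ-regular 0 k y (trans (*-congʳ (Δ-zero (suc k))) h)

  a^-regular : ∀ k i y → a (suc k) ^ i * y ≈ 0# → y ≈ 0#
  a^-regular k zero    y h = trans (sym (*-identityˡ y)) h
  a^-regular k (suc i) y h = a^-regular k i y (a-regular k _ (trans (sym (*-assoc _ _ _)) h))

  ∏-++ : ∀ σ f xs k → ∏ σ f (xs ++ k ∷ []) ≈ ∏ σ f xs * (if σ k then f k else 1#)
  ∏-++ σ f []       k = *-comm _ _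
  ∏-++ σ f (j ∷ xs) k = trans (*-congˡ (∏-++ σ f xs k)) (sym (*-assoc _ _ _))

  ∏-comax : ∀ I σ f xs → All (λ k → Comax I (f k)) xs → Comax I (∏ σ f xs)
  ∏-comax I σ f []       []       = comax-1 I
  ∏-comax I σ f (k ∷ xs) (h ∷ hs) with σ k
  ... | true  = comax-* I (f k) (∏ σ f xs) h (∏-comax I σ f xs hs)
  ... | false = comax-* I 1# (∏ σ f xs) (comax-1 I) (∏-comax I σ f xs hs)

  module Modd = Quotient (zeroIdeal ⊕ δ)
  private
    module F where
      open CommutativeRing Modd.quotient public
      open Algebra.Properties.CommutativeSemiring.Exp (CommutativeRing.commutativeSemiring Modd.quotient) public
    isOrbitF : IsOrbit Modd.quotient Modd.φ/ d a x
    isOrbitF = record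
      { a-zero = Modd.incl a-zero
      ; a-suc = λ k → F.trans (Modd.incl (a-suc k)) (F.+-congʳ (F.reflexive (≡.sym (Modd.^/≡^ (a k) d)))) }
    ∏F : (ℕ → Bool) → (ℕ → Carrier) → List ℕ → Carrier
    ∏F = Products.∏ Modd.quotient Modd.φ/
    δ≈0 : δ F.≈ 0#
    δ≈0 = Modd.mem⇒≈0 (⊕-new zeroIdeal δ)

  B-mod : ∀ l k → B l k F.≈ Δ l k ^ suc e
  B-mod l k = F.trans (F.+-congˡ (F.trans (F.*-congʳ δ≈0) (F.zeroˡ _))) (F.+-identityʳ _)

  Δ^-mod : ∀ l k → Δ l k ^ suc e F.≈ a k F.^ (d ℕ.^ l ℕ.* suc e)
  Δ^-mod l k = F.trans (F.reflexive (≡.sym (Modd.^/≡^ (Δ l k) (suc e))))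
    (F.trans (F.^-congˡ (suc e) (OrbitAlgebra.Δ-charP Modd.quotient Modd.φ/ e d-prime a x isOrbitF δ≈0 l k)) (F.^-assocʳ (a k) (d ℕ.^ l) (suc e)))

  -- ε = 0 is the case n ∤ m − 1, and ε = d − 1 the case n ∣ m − 1, where F_{d,1,n} is divided out.
  Relation : (l n ε : ℕ) → 0 ℕ.< n → Carrier → Set
  Relation l n ε 0<n g = g * ∏ (σ⁻ n 0<n) (B l) (divisors n) * ∏ (σ⁺ n 0<n) (λ k → a k ^ ε) (divisors n) ≈
    ∏ (σ⁺ n 0<n) (B l) (divisors n) * ∏ (σ⁻ n 0<n) (λ k → a k ^ ε) (divisors n)

  module _ (l′ n′ ε : ℕ) (g : Carrier) (relation : Relation (suc l′) (suc n′) ε (s≤s z≤n) g) where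
    private
      l = suc l′
      n = suc n′
      σp = σ⁺ n (s≤s z≤n)
      σm = σ⁻ n (s≤s z≤n)
      E = d ℕ.^ l ℕ.* suc e
      ks = divisors n
      xs = properDivisors n

      ks>0 : All (0 ℕ.<_) ks
      ks>0 = All.tabulate (λ k∈ → proj₁ (∈-divisors⁻ n (s≤s z≤n) k∈))

      B≈F : ∀ σ → ∏ σ (B l) ks F.≈ ∏F σ (λ k → a k F.^ E) ks
      B≈F σ = Products.∏-cong Modd.quotient Modd.φ/ σ ks (All.tabulate (λ {k} _ → F.trans (B-mod l k) (Δ^-mod l k)))

      a≈F : ∀ σ → ∏ σ (λ k → a k ^ ε) ks F.≈ ∏F σ (λ k → a k F.^ ε) ks
      a≈F σ = Products.∏-cong Modd.quotient Modd.φ/ σ ks (All.tabulate (λ {k} _ → F.reflexive (≡.sym (Modd.^/≡^ (a k) ε))))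

      relationF : g F.* ∏F σm (λ k → a k F.^ E) ks F.* ∏F σp (λ k → a k F.^ ε) ks F.≈
                  ∏F σp (λ k → a k F.^ E) ks F.* ∏F σm (λ k → a k F.^ ε) ks
      relationF = F.trans (F.*-cong (F.*-congˡ (F.sym (B≈F σm))) (F.sym (a≈F σp)))
        (F.trans (Modd.incl relation) (F.*-cong (B≈F σp) (a≈F σm)))

      Ig : Ideal
      Ig = zeroIdeal ⊕ δ ⊕ g

    -- `Coprimality` over the quotient by d. A combination of g and a j that is 1 there is one in
    -- the ring itself with d as a further generator.
    coprime-a : ∀ j → 0 ℕ.< j → ¬ (n ∣ j) → ¬ ¬ Comax Ig (a j)
    coprime-a j 0<j n∤j k = OrbitAlgebra.Coprimality.coprime Modd.quotient Modd.φ/ e d-prime a x isOrbitF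
      (λ k y h → Modd.mem⇒≈0 (a-regular-mod k y (Modd.≈0⇒mem h)))
      n ks ks>0 σp σm (balanced n (s≤s z≤n)) E ε g relationF
      j 0<j n∤j λ (w , u , h) → k (w , u , Modd.≈0⇒mem h)

    comax-B : ∀ k → Comax Ig (a k) → Comax Ig (B l k)
    comax-B k h = comax-shift Ig
      (⊕-old (zeroIdeal ⊕ δ) g (Modd.diff (F.trans (F.trans (B-mod l k) (Δ^-mod l k)) (F.reflexive (Modd.^/≡^ (a k) E)))))
      (comax-^ Ig (a k) E h)

    -- The factor of index n, with s and w₀ equal to Δ l n and a l, both divided by a n when ε = d − 1.
    record Local : Set where
      field
        Θ s s₁ y w₀ : Carrier
        Θ≈    : Θ ≈ s ^ suc e + δ * (s * y + w₀ ^ suc e)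
        s≈    : s ≈ a n * s₁
        B≈    : B l n ≈ a n ^ ε * Θ
        Δ≈    : Δ l n ^ suc e ≈ a n ^ ε * s ^ suc e
        comax : Comax (Ig ⊕ a n) w₀

    module _ (coprimes : All (λ k → Comax Ig (a k)) xs) (loc : Local) where
      open Local loc
      private
        -- The factors with k ≠ n on the two sides of `Relation`: W goes with Θ, and N₁ with g.
        W N₁ : Carrier
        W  = ∏ σp (B l) xs * ∏ σm (λ k → a k ^ ε) xs
        N₁ = ∏ σm (B l) xs * ∏ σp (λ k → a k ^ ε) xs

        abstract
          W-comax : Comax Ig W
          W-comax = comax-* Ig (∏ σp (B l) xs) (∏ σm (λ k → a k ^ ε) xs)
            (∏-comax Ig σp (B l) xs (All.map (comax-B _) coprimes))
            (∏-comax Ig σm (λ k → a k ^ ε) xs (All.map (comax-^ Ig _ ε) coprimes))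

        n/n≡1 : safeDiv n n ≡ 1
        n/n≡1 = DivMod.n/n≡1 n

        plus : ∀ f → ∏ σp f ks ≈ ∏ σp f xs * f n
        plus f = trans (reflexive (≡.cong (∏ σp f) (divisors≡ n))) (trans (∏-++ σp f xs n)
          (*-congˡ (reflexive (≡.cong (λ z → if positive (μ z) then f n else 1#) n/n≡1))))

        minus : ∀ f → ∏ σm f ks ≈ ∏ σm f xs
        minus f = trans (reflexive (≡.cong (∏ σm f) (divisors≡ n))) (trans (∏-++ σm f xs n)
          (trans (*-congˡ (reflexive (≡.cong (λ z → if negative (μ z) then f n else 1#) n/n≡1))) (*-identityʳ _)))

        abstract
          -- Since μ(n/n) = 1, the divisor n enters only the `σp` products: (a n)^ε on the side of
          -- g, and B l n = (a n)^ε Θ on the other. The power of a n is regular and cancels.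
          gN≈ΘW : Θ * W ≈ g * N₁
          gN≈ΘW = sym (diff≈0 (a^-regular n′ ε (g * N₁ - Θ * W) (begin
            a n ^ ε * (g * N₁ - Θ * W)
              ≈⟨ solve 7 (λ h g n₁ n₂ c w₁ w₂ → h :* (g :* (n₁ :* n₂) :- c :* (w₁ :* w₂))
                    := g :* n₁ :* (n₂ :* h) :- w₁ :* (h :* c) :* w₂) refl (a n ^ ε) g
                    (∏ σm (B l) xs) (∏ σp (λ k → a k ^ ε) xs) Θ (∏ σp (B l) xs) (∏ σm (λ k → a k ^ ε) xs) ⟩
            g * ∏ σm (B l) xs * (∏ σp (λ k → a k ^ ε) xs * a n ^ ε) - ∏ σp (B l) xs * (a n ^ ε * Θ) * ∏ σm (λ k → a k ^ ε) xs
              ≈⟨ +-cong (*-cong (*-congˡ (sym (minus (B l)))) (sym (plus (λ k → a k ^ ε))))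
                   (-‿cong (*-cong (trans (*-congˡ (sym B≈)) (sym (plus (B l)))) (sym (minus (λ k → a k ^ ε))))) ⟩
            g * ∏ σm (B l) ks * ∏ σp (λ k → a k ^ ε) ks - ∏ σp (B l) ks * ∏ σm (λ k → a k ^ ε) ks
              ≈⟨ trans (+-congʳ relation) (-‿inverseʳ _) ⟩
            0# ∎)))
            where
            open ≈-Reasoning
            diff≈0 : ∀ {u v} → u - v ≈ 0# → u ≈ v
            diff≈0 {u} {v} h = trans (solve 2 (λ u v → u := (u :- v) :+ v) refl u v) (trans (+-congʳ h) (+-identityˡ v))

      private
        y₀ : Carrier
        y₀ = proj₁ (proj₂ (proj₂ W-comax))

        -- W is invertible modulo d, so Θ vanishes modulo g up to a factor 1 − y₀ d.
        Θ-killed : ∀ I → Mem I g → Mem I (Θ * (1# - y₀ * δ))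
        Θ-killed I g∈I = let u , v , y , h = W-comax in resp I
          (begin
            u * (g * N₁) + Θ * (v * g)      ≈⟨ +-congʳ (*-congˡ (sym gN≈ΘW)) ⟩
            u * (Θ * W) + Θ * (v * g)       ≈⟨ +-identityʳ _ ⟨
            u * (Θ * W) + Θ * (v * g) + 0#  ≈⟨ +-congˡ (sym (trans (*-congˡ h) (zeroʳ Θ))) ⟩
            u * (Θ * W) + Θ * (v * g) + Θ * (1# - u * W - v * g - y * δ)
              ≈⟨ solve 7 (λ o u c w v g yd → u :* (c :* w) :+ c :* (v :* g) :+ c :* (o :- u :* w :- v :* g :- yd) := c :* (o :- yd)) refl 1# u Θ W v g (y * δ) ⟩
            Θ * (1# - y * δ) ∎)
          (mem+ I (mem* I u (mem*ʳ I N₁ g∈I)) (mem* I Θ (mem* I v g∈I)))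
          where open ≈-Reasoning

      -- Modulo g and a n, s vanishes and Θ is d w. Here w is a unit up to a factor 1 - z d, and Θ
      -- is killed by 1 - y₀ d, so d is killed by (1 - y₀ d) (1 - z d).
      δ-multiple : Σ Carrier λ y₁ → Mem (zeroIdeal ⊕ g ⊕ a n) (δ * (1# + δ * y₁))
      -- The witness comes from expanding (1 - y₀ d) (1 - z d) as 1 + d y₁.
      δ-multiple = y₀ * z * δ - (y₀ + z) , Q.≈0⇒mem (begin
          δ * (1# + δ * (y₀ * z * δ - (y₀ + z)))
            ≈⟨ Q.incl (solve 4 (λ δ o y z → δ :* (o :+ δ :* (y :* z :* δ :- (y :+ z))) := δ :* (o :- y :* δ :- z :* δ :* (con (ℤ.+ 1) :- y :* δ))) refl δ 1# y₀ z) ⟩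
          δ * (1# - y₀ * δ - z * δ * (ι (ℤ.+ 1) - y₀ * δ))
            ≈⟨ G.*-congˡ (G.trans (G.+-congˡ (G.-‿cong (G.*-congˡ (G.+-congʳ (Q.incl 1-homo)))))
                 (G.+-congʳ (G.sym (G.*-identityˡ (1# - y₀ * δ))))) ⟩
          δ * (1# * (1# - y₀ * δ) - z * δ * (1# - y₀ * δ))
            ≈⟨ Q.incl (solve 4 (λ δ o zd t → δ :* (o :* t :- zd :* t) := δ :* t :* (o :- zd)) refl δ 1# (z * δ) (1# - y₀ * δ)) ⟩
          δ * (1# - y₀ * δ) * (1# - z * δ)     ≈⟨ G.*-congˡ uw ⟩
          δ * (1# - y₀ * δ) * (u * w)          ≈⟨ Q.incl (solve 4 (λ δ t u w → δ :* t :* (u :* w) := u :* (δ :* w :* t)) refl δ (1# - y₀ * δ) u w) ⟩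
          u * (δ * w * (1# - y₀ * δ))          ≈⟨ G.*-congˡ (G.*-congʳ (G.sym Θ≈δw)) ⟩
          u * (Θ * (1# - y₀ * δ))              ≈⟨ G.*-congˡ (Q.mem⇒≈0 (Θ-killed Ia (⊕-old (zeroIdeal ⊕ g) (a n) (⊕-new zeroIdeal g)))) ⟩
          u * 0#                               ≈⟨ G.zeroʳ u ⟩
          0#                                   ∎)
        where
        Ia = zeroIdeal ⊕ g ⊕ a n
        module Q = Quotient Ia
        module G = CommutativeRing Q.quotient
        open Relation.Binary.Reasoning.Setoid G.setoid
        w = w₀ ^ suc e
        abstract
          w-comax : Comax (Ig ⊕ a n) w
          w-comax = comax-^ (Ig ⊕ a n) w₀ (suc e) comax
        u z : Carrier
        u = proj₁ w-comax
        z = proj₁ (proj₂ (proj₂ (proj₂ w-comax)))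
        a≈0 : a n G.≈ 0#
        a≈0 = Q.mem⇒≈0 (⊕-new (zeroIdeal ⊕ g) (a n))
        g≈0 : g G.≈ 0#
        g≈0 = Q.mem⇒≈0 (⊕-old (zeroIdeal ⊕ g) (a n) (⊕-new zeroIdeal g))
        s≈0 : s G.≈ 0#
        s≈0 = G.trans (Q.incl s≈) (G.trans (G.*-congʳ a≈0) (G.zeroˡ s₁))
        Θ≈δw : Θ G.≈ δ * w
        Θ≈δw = G.trans (Q.incl Θ≈) (G.trans (G.+-cong (G.trans (G.*-congʳ s≈0) (G.zeroˡ _))
          (G.*-congˡ (G.trans (G.+-congʳ (G.trans (G.*-congʳ s≈0) (G.zeroˡ y))) (G.+-identityˡ w)))) (G.+-identityˡ _))
        uw : 1# - z * δ G.≈ u * w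
        uw = let _ , t , v , _ , h = w-comax in begin
          1# - z * δ   ≈⟨ Q.incl (solve 5 (λ o zd uw ta vg → o :- zd := (o :- uw :- ta :- vg :- zd) :+ (uw :+ ta :+ vg)) refl 1# (z * δ) (u * w) (t * a n) (v * g)) ⟩
          (1# - u * w - t * a n - v * g - z * δ) + (u * w + t * a n + v * g)
            ≈⟨ G.+-cong (Q.incl h) (G.+-cong (G.+-congˡ (G.trans (G.*-congˡ a≈0) (G.zeroʳ t))) (G.trans (G.*-congˡ g≈0) (G.zeroʳ v))) ⟩
          0# + (u * w + 0# + 0#)   ≈⟨ G.trans (G.+-identityˡ _) (G.trans (G.+-identityʳ _) (G.+-identityʳ _)) ⟩
          u * w ∎

      -- Modulo g and d the annihilator 1 - y₀ d of Θ is 1, so Θ = s^(d-1) is zero; and (a n)^E is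
      -- (Δ l n)^(d-1), a multiple of s^(d-1).
      power-multiple : Mem (zeroIdeal ⊕ g ⊕ δ) (a n ^ E)
      power-multiple = Q.≈0⇒mem (begin
          a n ^ E                    ≈⟨ Q.mod (mod-d⇒ (Modd.diff (F.trans (Δ^-mod l n) (F.reflexive (Modd.^/≡^ (a n) E))))) ⟨
          Δ l n ^ suc e              ≈⟨ Q.incl Δ≈ ⟩
          a n ^ ε * s ^ suc e        ≈⟨ G.*-congˡ s^≈Θ ⟩
          a n ^ ε * Θ                ≈⟨ G.*-congˡ Θ≈0 ⟩
          a n ^ ε * 0#               ≈⟨ G.zeroʳ _ ⟩
          0#                         ∎)
        where
        Iδ = zeroIdeal ⊕ g ⊕ δ
        module Q = Quotient Iδ
        module G = CommutativeRing Q.quotient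
        open Relation.Binary.Reasoning.Setoid G.setoid
        mod-d⇒ : ∀ {t} → Mem (zeroIdeal ⊕ δ) t → Mem Iδ t
        mod-d⇒ = ⊕-mono zeroIdeal (zeroIdeal ⊕ g) δ (⊕-old zeroIdeal g)
        δ≈0′ : δ G.≈ 0#
        δ≈0′ = Q.mem⇒≈0 (⊕-new (zeroIdeal ⊕ g) δ)
        s^≈Θ : s ^ suc e G.≈ Θ
        s^≈Θ = G.sym (G.trans (Q.incl Θ≈) (G.trans (G.+-congˡ (G.trans (G.*-congʳ δ≈0′) (G.zeroˡ _))) (G.+-identityʳ _)))
        Θ≈0 : Θ G.≈ 0#
        Θ≈0 = begin
          Θ                     ≈⟨ G.*-identityʳ Θ ⟨
          Θ * 1#                ≈⟨ G.*-congˡ (G.sym (G.trans (G.+-congˡ (G.-‿cong (G.trans (G.*-congˡ δ≈0′) (G.zeroʳ y₀)))) (Q.incl (x-0≈x 1#)))) ⟩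
          Θ * (1# - y₀ * δ)     ≈⟨ Q.mem⇒≈0 (Θ-killed Iδ (⊕-old (zeroIdeal ⊕ g) δ (⊕-new zeroIdeal g))) ⟩
          0#                    ∎

    Conclusion : Set
    Conclusion = (Σ Carrier λ y₁ → Mem (zeroIdeal ⊕ g ⊕ a n) (δ * (1# + δ * y₁)))
               × Mem (zeroIdeal ⊕ g ⊕ δ) (a n ^ E)

    conclude : ¬ ¬ Local → ¬ ¬ Conclusion
    conclude loc K = ¬¬-All xs (All.tabulate proper) λ coprimes → loc λ loc →
      K (δ-multiple coprimes loc , power-multiple coprimes loc)
      where
      proper : ∀ {k} → k ∈ xs → ¬ ¬ Comax Ig (a k)
      proper {k} k∈ = coprime-a k 0<k λ n∣k → ℕ.<⇒≱ k<n (ℕ∣.∣⇒≤ {{ℕ.>-nonZero 0<k}} n∣k)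
        where
        0<k : 0 ℕ.< k
        0<k = proj₁ (∈-divisors⁻ n (s≤s z≤n) (≡.subst (k ∈_) (≡.sym (divisors≡ n)) (∈-++⁺ˡ k∈)))
        k<n : k ℕ.< n
        k<n = ∈-upTo⁻ (proj₁ (∈-filter⁻ (_∣? n) {xs = upTo n} k∈))

    -- Nothing is divided out: w₀ is a l itself, a unit modulo d and g because n does not divide l.
    local-indivisible : ε ≡ 0 → ¬ (n ∣ l) → ¬ ¬ Local
    local-indivisible ≡.refl n∤l K = coprime-a l (s≤s z≤n) n∤l λ c →
      let s₁ , es = Δ-multiple l n in K (record
        { Θ = B l n ; s = Δ l n ; s₁ = s₁ ; y = proj₁ (prime-binomial (a l) (Δ l n)) ; w₀ = a l
        ; Θ≈ = refl ; s≈ = es ; B≈ = sym (*-identityˡ _) ; Δ≈ = sym (*-identityˡ _)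
        ; comax = ⊕-mono Ig (Ig ⊕ a n) (a l) (⊕-old Ig (a n)) c })

    -- Both a l and Δ l n are multiples of a n, so (a n)^d comes out of the d-th powers in Δ (l + 1)
    -- n. Comparison with Δ l n · B l n, where Δ l n is regular, gives B l n = (a n)^(d-1) Θ. The
    -- quotient w₀ = 1 + a n ρ of a l by a n is a unit modulo a n.
    local-divisible : ε ≡ suc e → n ∣ l → Local
    local-divisible ≡.refl (divides (suc q) l≡) = record
        { Θ = Θ ; s = s ; s₁ = r ; y = proj₁ pb ; w₀ = w₀
        ; Θ≈ = refl ; s≈ = refl
        ; B≈ = sym (trans (solve 2 (λ u v → u := v :+ (u :- v)) refl (a n ^ suc e * Θ) (B l n))
                 (trans (+-congˡ (Δ-regular l n′ _ zero-diff)) (+-identityʳ _)))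
        ; Δ≈ = trans (^-congˡ (suc e) t≈) (^-distrib-* (a n) s (suc e))
        ; comax = 1# , resp (Ig ⊕ a n)
            (trans (solve 2 (λ o z → :- z := o :- (o :+ z)) refl 1# (a n * ρ)) (+-congˡ (-‿cong (sym (*-identityˡ _)))))
            (mem- (Ig ⊕ a n) (mem*ʳ (Ig ⊕ a n) ρ (⊕-new Ig (a n)))) }
      where
      open ≈-Reasoning
      r = proj₁ (Δ-square l′ n)
      s = a n * r
      t≈ : Δ l n ≈ a n * s
      t≈ = proj₂ (Δ-square l′ n)
      ρ = proj₁ (a-multiple n′ q)
      w₀ = 1# + a n * ρ
      v≈ : a l ≈ a n * w₀
      v≈ = trans (reflexive (≡.cong a l≡)) (proj₂ (a-multiple n′ q))
      pb = prime-binomial w₀ s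
      Θ = s ^ suc e + δ * (s * proj₁ pb + w₀ ^ suc e)
      Δ≈′ : Δ (suc l) n ≈ Δ l n * (a n ^ suc e * Θ)
      Δ≈′ = begin
        Δ (suc l) n                                 ≈⟨ Δ-power l n ⟩
        (a l + Δ l n) ^ d - a l ^ d                 ≈⟨ +-cong (^-congˡ d (trans (+-cong v≈ t≈) (sym (distribˡ (a n) w₀ s)))) (-‿cong (^-congˡ d v≈)) ⟩
        (a n * (w₀ + s)) ^ d - (a n * w₀) ^ d       ≈⟨ +-cong (^-distrib-* (a n) _ d) (-‿cong (^-distrib-* (a n) w₀ d)) ⟩
        a n ^ d * (w₀ + s) ^ d - a n ^ d * w₀ ^ d   ≈⟨ +-congʳ (*-congˡ (proj₂ pb)) ⟩
        a n * a n ^ suc e * (w₀ ^ d + s * Θ) - a n * a n ^ suc e * w₀ ^ d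
          ≈⟨ solve 5 (λ a h w s c → a :* h :* (w :+ s :* c) :- a :* h :* w := a :* s :* (h :* c)) refl (a n) (a n ^ suc e) (w₀ ^ d) s Θ ⟩
        a n * s * (a n ^ suc e * Θ)                 ≈⟨ *-congʳ (sym t≈) ⟩
        Δ l n * (a n ^ suc e * Θ)                   ∎
      zero-diff : Δ l n * (a n ^ suc e * Θ - B l n) ≈ 0#
      zero-diff = begin
        Δ l n * (a n ^ suc e * Θ - B l n)              ≈⟨ solve 3 (λ t u v → t :* (u :- v) := t :* u :- t :* v) refl (Δ l n) (a n ^ suc e * Θ) (B l n) ⟩
        Δ l n * (a n ^ suc e * Θ) - Δ l n * B l n      ≈⟨ +-cong (sym Δ≈′) (-‿cong (sym (Δ-suc l n))) ⟩
        Δ (suc l) n - Δ (suc l) n                      ≈⟨ -‿inverseʳ _ ⟩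
        0#                                             ∎

-- Reducedness modulo (a n, d)

n<d^n : ∀ e n → n ℕ.< suc (suc e) ℕ.^ n
n<d^n e zero    = s≤s z≤n
n<d^n e (suc n) = ℕ.≤-trans (ℕ.+-mono-≤ (ℕ.≤-trans (s≤s z≤n) (n<d^n e n)) (n<d^n e n))
  (ℕ.+-monoʳ-≤ (suc (suc e) ℕ.^ n) (ℕ.m≤m+n _ (e ℕ.* suc (suc e) ℕ.^ n)))

inverse-mod : ∀ {d} → Prime d → ∀ c → ¬ (d ∣ ℤ.∣ c ∣) → Σ ℤ λ b → ℤ.+ d ℤ∣.∣ c ℤ.* b ℤ.- ℤ.+ 1
inverse-mod {d} pr c d∤c = sign (proj₁ natural) (proj₂ natural)
  where
  coprime : Coprime d ℤ.∣ c ∣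
  coprime (i∣d , i∣c) with prime⇒irreducible pr i∣d
  ... | inj₁ i≡1    = i≡1
  ... | inj₂ ≡.refl = contradiction i∣c d∤c
  open ℤSolver.+-*-Solver
  natural : Σ ℤ λ b → ℤ.+ d ℤ∣.∣ ℤ.+ ℤ.∣ c ∣ ℤ.* b ℤ.- ℤ.+ 1
  natural with coprime-Bézout coprime
  ... | Bézout.+- x y eq = ℤ.- ℤ.+ y , ℤ∣.divides (ℤ.- ℤ.+ x) (≡.trans
    (solve 2 (λ c y → c :* (:- y) :- con (ℤ.+ 1) := :- (con (ℤ.+ 1) :+ y :* c)) ≡.refl (ℤ.+ ℤ.∣ c ∣) (ℤ.+ y))
    (≡.trans (≡.cong ℤ.-_ (≡.trans (≡.cong (λ z → ℤ.+ 1 ℤ.+ z) (≡.sym (ℤ.pos-* y ℤ.∣ c ∣))) (≡.trans (≡.cong ℤ.+_ eq) (ℤ.pos-* x d))))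
      (ℤ.neg-distribˡ-* (ℤ.+ x) (ℤ.+ d))))
  ... | Bézout.-+ x y eq = ℤ.+ y , ℤ∣.divides (ℤ.+ x) (≡.trans
    (≡.cong (λ z → z ℤ.- ℤ.+ 1) (≡.trans (ℤ.*-comm (ℤ.+ ℤ.∣ c ∣) (ℤ.+ y)) (≡.trans (≡.sym (ℤ.pos-* y ℤ.∣ c ∣))
      (≡.trans (≡.cong ℤ.+_ (≡.sym eq)) (≡.cong (λ z → ℤ.+ 1 ℤ.+ z) (ℤ.pos-* x d))))))
    (solve 1 (λ z → con (ℤ.+ 1) :+ z :- con (ℤ.+ 1) := z) ≡.refl (ℤ.+ x ℤ.* ℤ.+ d)))
  sign : ∀ b → ℤ.+ d ℤ∣.∣ ℤ.+ ℤ.∣ c ∣ ℤ.* b ℤ.- ℤ.+ 1 → Σ ℤ λ b → ℤ.+ d ℤ∣.∣ c ℤ.* b ℤ.- ℤ.+ 1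
  sign b h with ℤ.+∣i∣≡i⊎+∣i∣≡-i c
  ... | inj₁ eq = b , ≡.subst (λ z → ℤ.+ d ℤ∣.∣ z ℤ.* b ℤ.- ℤ.+ 1) eq h
  ... | inj₂ eq = ℤ.- b , ≡.subst (ℤ.+ d ℤ∣.∣_)
    (≡.trans (≡.cong (λ z → z ℤ.* b ℤ.- ℤ.+ 1) eq) (solve 2 (λ c b → (:- c) :* b :- con (ℤ.+ 1) := c :* (:- b) :- con (ℤ.+ 1)) ≡.refl c b)) h

-- T is F_d[x]/(a): it is finite-dimensional, and its Frobenius is surjective because b^d + x = a makes x a d-th power.
module FiniteCharP (T : CommutativeRing 0ℓ 0ℓ) (φ : ℤ→ T) (e : ℕ) (d-prime : Prime (suc (suc e))) where
  open ℤ-Algebra T φ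
  open Integrality T φ
  open PrimeBinomial T φ e d-prime using (d; δ; module CharP)
  open ℤ-Solver T φ using (solve; _:+_; _:*_; :-_; _:-_; _:=_)
  open ≈-Reasoning

  module Reduced (δ≈0 : δ ≈ 0#) (b x : Carrier) (b^d+x≈0 : b ^ d + x ≈ 0#) (D : ℕ) (x-integral : IntegralOf D x)
    (generated : ∀ f → Σ ZPoly λ p → f ≈ ev p x) where
    open CharP δ≈0

    x≈power : x ≈ (- b) ^ d
    x≈power = begin
      x                              ≈⟨ solve 2 (λ x y → x := :- y :+ (y :+ x)) refl x (b ^ d) ⟩
      - (b ^ d) + (b ^ d + x)        ≈⟨ +-congˡ b^d+x≈0 ⟩
      - (b ^ d) + 0#                 ≈⟨ +-identityʳ _ ⟩
      - (b ^ d)                      ≈⟨ frobenius-neg b ⟨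
      (- b) ^ d                      ∎

    ev-power : ∀ p → Σ Carrier λ c → ev p x ≈ c ^ d
    ev-power []      = 0# , sym (zeroˡ _)
    ev-power (c ∷ p) = let c′ , eq = ev-power p in ι c + - b * c′ , (begin
      ι c + x * ev p x                   ≈⟨ +-cong (sym (fermat c)) (*-cong x≈power eq) ⟩
      ι c ^ d + (- b) ^ d * c′ ^ d       ≈⟨ +-congˡ (sym (^-distrib-* (- b) c′ d)) ⟩
      ι c ^ d + (- b * c′) ^ d           ≈⟨ frobenius-+ (ι c) (- b * c′) ⟨
      (ι c + - b * c′) ^ d               ∎)

    frobenius-surjective : ∀ f → Σ Carrier λ c → f ≈ c ^ d
    frobenius-surjective f =
      let p , fp = generated f
          c , pc = ev-power p
      in c , trans fp pc

    frobenius-iterate : ∀ k f → Σ Carrier λ c → f ≈ c ^ (d ℕ.^ k)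
    frobenius-iterate zero    f = f , sym (*-identityʳ f)
    frobenius-iterate (suc k) f =
      let c , eq = frobenius-iterate k f
          c′ , eq′ = frobenius-surjective c
      in c′ , trans eq (trans (^-congˡ (d ℕ.^ k) eq′) (^-assocʳ c′ d (d ℕ.^ k)))

    vs : List Carrier
    vs = powers x D

    ev-spanned : ∀ p → Span vs (ev p x)
    ev-spanned []      = Span-0 vs
    ev-spanned (c ∷ p) = Span-resp vs (+-congʳ (*-identityʳ (ι c)))
      (Span-+ vs (Span-scale vs c (power∈powers x-integral z≤n))
        (Span-bind vs vs x (powers-stable x-integral) (ev-spanned p)))

    spanned : ∀ f → Span vs f
    spanned f = let p , fp = generated f in Span-resp vs (sym fp) (ev-spanned p)

    E : ℕ
    E = elimDegree vs 1

    abstract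
      all-integral : ∀ c → IntegralOf E c
      all-integral c = finite⇒integral vs (spanned 1#) (λ {v} _ → spanned (c * v))

    ι-multiple : ∀ q → ℤ.+ d ℤ∣.∣ q → ι q ≈ 0#
    ι-multiple q (ℤ∣.divides s eq) = begin
      ι q             ≈⟨ reflexive (≡.cong ι eq) ⟩
      ι (s ℤ.* ℤ.+ d) ≈⟨ *-homo s (ℤ.+ d) ⟩
      ι s * δ         ≈⟨ *-congˡ {ι s} δ≈0 ⟩
      ι s * 0#        ≈⟨ zeroʳ (ι s) ⟩
      0#              ∎

    -- The lowest coefficient of h that is nonzero modulo d can be inverted.
    absorb : ∀ c h k i → ℤ[x].coeff h k ≡ ℤ.+ 1 → c ^ i * ev h c ≈ 0# →
      Σ ℕ λ j → j ℕ.≤ i ℕ.+ k × Σ Carrier λ u → c ^ j ≈ c ^ j * (c * u)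
    absorb c (q ∷ h) k i one z with d ∣? ℤ.∣ q ∣
    ... | no d∤q = let b , h∣ = inverse-mod d-prime q d∤q in
      i , ℕ.m≤m+n i k , - (ev h c * ι b) , (begin
        c ^ i                                             ≈⟨ *-identityʳ _ ⟨
        c ^ i * 1#                                        ≈⟨ *-congˡ (sym (unit b h∣)) ⟩
        c ^ i * (ι q * ι b)
          ≈⟨ solve 5 (λ x q b c r → x :* (q :* b) := x :* (q :+ c :* r) :* b :+ x :* (c :* :- (r :* b))) refl (c ^ i) (ι q) (ι b) c (ev h c) ⟩
        c ^ i * (ι q + c * ev h c) * ι b + c ^ i * (c * - (ev h c * ι b))   ≈⟨ +-congʳ (trans (*-congʳ z) (zeroˡ _)) ⟩
        0# + c ^ i * (c * - (ev h c * ι b))               ≈⟨ +-identityˡ _ ⟩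
        c ^ i * (c * - (ev h c * ι b))                    ∎)
      where
      minus-plus : ∀ z → z ℤ.- ℤ.+ 1 ℤ.+ ℤ.+ 1 ≡ z
      minus-plus z = ≡.trans (ℤ.+-assoc z (ℤ.- ℤ.+ 1) (ℤ.+ 1)) (ℤ.+-identityʳ z)
      unit : ∀ b → ℤ.+ d ℤ∣.∣ q ℤ.* b ℤ.- ℤ.+ 1 → ι q * ι b ≈ 1#
      unit b h∣ = begin
        ι q * ι b                                 ≈⟨ *-homo q b ⟨
        ι (q ℤ.* b)                               ≈⟨ reflexive (≡.cong ι (≡.sym (minus-plus (q ℤ.* b)))) ⟩
        ι (q ℤ.* b ℤ.- ℤ.+ 1 ℤ.+ ℤ.+ 1)           ≈⟨ +-homo (q ℤ.* b ℤ.- ℤ.+ 1) (ℤ.+ 1) ⟩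
        ι (q ℤ.* b ℤ.- ℤ.+ 1) + ι (ℤ.+ 1)         ≈⟨ +-cong (ι-multiple _ h∣) 1-homo ⟩
        0# + 1#                                   ≈⟨ +-identityˡ 1# ⟩
        1#                                        ∎
    absorb c (q ∷ h) zero    i ≡.refl z | yes d∣1 = contradiction (ℕ∣.∣1⇒≡1 d∣1) λ ()
    absorb c (q ∷ h) (suc k) i one    z | yes d∣q =
      let j , j≤ , r = absorb c h k (suc i) one (trans
            (solve 3 (λ c x r → c :* x :* r := x :* (c :* r)) refl c (c ^ i) (ev h c))
            (trans (*-congˡ (sym (trans (+-congʳ (ι-multiple q (ℤ∣.∣ᵤ⇒∣ d∣q))) (+-identityˡ _)))) z))
      in j , ℕ.≤-trans j≤ (ℕ.≤-reflexive (≡.sym (ℕ.+-suc i k))) , r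

    absorb-iterate : ∀ {y z} → y ≈ y * z → ∀ t → y ≈ y * z ^ t
    absorb-iterate {y} {z} h zero    = sym (*-identityʳ y)
    absorb-iterate {y} {z} h (suc t) = trans (absorb-iterate h t) (trans (*-congʳ h) (*-assoc y z (z ^ t)))

    -- Write f = c^N with N = d^E. From c^j = c^j (c u) for some j ≤ E < N follows f = f (c u)^t for
    -- every t, and t = N k turns c^t into f^k.
    regular : ∀ f k → Σ Carrier λ u → f ≈ u * f ^ k
    regular f k =
      -- The number of roots to take is fixed before c is known; this needs the bound E to hold for
      -- all elements at once.
      let c , fc = frobenius-iterate E f
          p , l , eq = all-integral c
          j , j≤E , u , cj = absorb c (monicDiff E p) E 0 (proj₁ (monicDiff-monic E p))
            (trans (*-identityˡ _) (trans (ev-monicDiff E p c l) (trans (+-congʳ eq) (-‿inverseʳ _))))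
          N = d ℕ.^ E
          r = N ℕ.∸ j
          cN : c ^ N ≈ c ^ N * (c * u)
          cN = begin
            c ^ N                       ≈⟨ ^-congʳ c (≡.sym (ℕ.m+[n∸m]≡n (ℕ.≤-trans j≤E (ℕ.<⇒≤ (n<d^n e E))))) ⟩
            c ^ (j ℕ.+ r)               ≈⟨ ^-homo-* c j r ⟩
            c ^ j * c ^ r               ≈⟨ *-congʳ cj ⟩
            c ^ j * (c * u) * c ^ r     ≈⟨ solve 3 (λ x y z → x :* y :* z := x :* z :* y) refl (c ^ j) (c * u) (c ^ r) ⟩
            c ^ j * c ^ r * (c * u)     ≈⟨ *-congʳ (sym (^-homo-* c j r)) ⟩
            c ^ (j ℕ.+ r) * (c * u)     ≈⟨ *-congʳ (^-congʳ c (ℕ.m+[n∸m]≡n (ℕ.≤-trans j≤E (ℕ.<⇒≤ (n<d^n e E))))) ⟩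
            c ^ N * (c * u)             ∎
      in f * u ^ (N ℕ.* k) , (begin
        f                                      ≈⟨ fc ⟩
        c ^ N                                  ≈⟨ absorb-iterate cN (N ℕ.* k) ⟩
        c ^ N * (c * u) ^ (N ℕ.* k)            ≈⟨ *-cong (sym fc) (^-distrib-* c u (N ℕ.* k)) ⟩
        f * (c ^ (N ℕ.* k) * u ^ (N ℕ.* k))    ≈⟨ *-congˡ (*-congʳ (trans (sym (^-assocʳ c N k)) (^-congˡ k (sym fc)))) ⟩
        f * (f ^ k * u ^ (N ℕ.* k))            ≈⟨ solve 3 (λ x y z → x :* (y :* z) := x :* z :* y) refl f (f ^ k) (u ^ (N ℕ.* k)) ⟩
        f * u ^ (N ℕ.* k) * f ^ k              ∎)

-- Descent

module Saturation (T : CommutativeRing 0ℓ 0ℓ) (φ : ℤ→ T) where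
  open ℤ-Algebra T φ
  open Integrality T φ
  open ℤ-Solver T φ using (solve; _:+_; _:*_; :-_; _:-_; _:=_; con)
  open ≈-Reasoning

  module Descent
    (R : Carrier → Set)
    (R-resp : ∀ {x y} → x ≈ y → R x → R y)
    (R-+ : ∀ {x y} → R x → R y → R (x + y))
    (R-* : ∀ {x y} → R x → R y → R (x * y))
    (R-neg : ∀ {x} → R x → R (- x))
    (R-ι : ∀ c → R (ι c))
    (π δ : Carrier) (R-π : R π) (R-δ : R δ)
    (δ-injective : ∀ y → δ * y ≈ 0# → y ≈ 0#)
    (δ-multiple : Σ Carrier λ y → R y × Σ Carrier λ r → R r × δ * (1# + δ * y) ≈ π * r)
    (π-power : Σ ℕ λ E → Σ Carrier λ r → R r × π ^ E ≈ δ * r)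
    (reduced : ∀ b → R b → ∀ k → Σ Carrier λ u → Σ Carrier λ w → Σ Carrier λ y →
       R u × R w × R y × b ≈ u * b ^ k + w * π + y * δ) where

    R-1 : R 1#
    R-1 = R-resp 1-homo (R-ι (ℤ.+ 1))

    R-^ : ∀ {x} → R x → ∀ k → R (x ^ k)
    R-^ h zero    = R-1
    R-^ h (suc k) = R-* h (R-^ h k)

    module _ {α : Carrier} {k : ℕ} (integral : IntegralOf k α) (Rδα : R (δ * α)) where

      -- A term q^k α^i with i < k is q · q^(k-1-i) (q α)^i, so one factor q is to spare. With the
      -- integral equation of α this puts (q α)^k in q R.
      homogenise : ∀ q → R q → R (q * α) → ∀ p k → length p ℕ.≤ k → Σ Carrier λ r → R r × q ^ k * ev p α ≈ q * r
      homogenise q Rq Rqα [] k l = ι (ℤ.+ 0) , R-ι (ℤ.+ 0) , trans (zeroʳ _) (sym (trans (*-congˡ 0-homo) (zeroʳ q)))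
      homogenise q Rq Rqα (c ∷ p) (suc k) (s≤s l) =
        let r , Rr , eq = homogenise q Rq Rqα p k l
        in q ^ k * ι c + q * α * r , R-+ (R-* (R-^ Rq k) (R-ι c)) (R-* Rqα Rr) , (begin
          q * q ^ k * (ι c + α * ev p α)
            ≈⟨ solve 5 (λ q x c a v → q :* x :* (c :+ a :* v) := q :* (x :* c) :+ (q :* a) :* (x :* v)) refl q (q ^ k) (ι c) α (ev p α) ⟩
          q * (q ^ k * ι c) + (q * α) * (q ^ k * ev p α)    ≈⟨ +-congˡ (*-congˡ eq) ⟩
          q * (q ^ k * ι c) + (q * α) * (q * r)
            ≈⟨ solve 5 (λ q x c a r → q :* (x :* c) :+ (q :* a) :* (q :* r) := q :* (x :* c :+ q :* a :* r)) refl q (q ^ k) (ι c) α r ⟩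
          q * (q ^ k * ι c + q * α * r)                     ∎)

      -- Modulo (π, d), b = π^(j+1) α is a multiple of b^k, and b^k ∈ π R by integrality.
      -- Multiplication by s = 1 + d y₁ makes the d-part a multiple of π too, since d s ∈ π R. So s
      -- b ∈ π R, and what remains is to remove one π and the factors s.
      step : ∀ j → R (π ^ suc j * α) → R (π ^ j * α)
      step j Rb =
        let p , l , α^k = integral
            q = π ^ suc j
            b = q * α
            β = π ^ j * α
            r , Rr , eq = homogenise q (R-^ R-π (suc j)) Rb p k l
            u , w , y , Ru , Rw , Ry , b≈ = reduced b Rb k
            y₁ , Ry₁ , r₁ , Rr₁ , δs≈ = δ-multiple
            s = 1# + δ * y₁
            Rs = R-+ R-1 (R-* R-δ Ry₁)
            X = u * (π ^ j * r) + w
            Z = s * X + y * r₁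
            RZ = R-+ (R-* Rs (R-+ (R-* Ru (R-* (R-^ R-π j) Rr)) Rw)) (R-* Ry Rr₁)
            b^k : b ^ k ≈ π * (π ^ j * r)
            b^k = begin
              (q * α) ^ k          ≈⟨ ^-distrib-* q α k ⟩
              q ^ k * α ^ k        ≈⟨ *-congˡ α^k ⟩
              q ^ k * ev p α       ≈⟨ eq ⟩
              π * π ^ j * r        ≈⟨ *-assoc π (π ^ j) r ⟩
              π * (π ^ j * r)      ∎
            sb : s * b ≈ π * Z
            sb = begin
              s * b                                                    ≈⟨ *-congˡ b≈ ⟩
              s * (u * b ^ k + w * π + y * δ)                          ≈⟨ *-congˡ (+-congʳ (+-congʳ (*-congˡ b^k))) ⟩
              s * (u * (π * (π ^ j * r)) + w * π + y * δ)
                ≈⟨ solve 7 (λ s u p x w y d → s :* (u :* (p :* x) :+ w :* p :+ y :* d) := p :* (s :* (u :* x :+ w)) :+ y :* (d :* s)) refl s u π (π ^ j * r) w y δ ⟩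
              π * (s * X) + y * (δ * s)                                ≈⟨ +-congˡ (*-congˡ δs≈) ⟩
              π * (s * X) + y * (π * r₁)
                ≈⟨ solve 4 (λ p v y r → p :* v :+ y :* (p :* r) := p :* (v :+ y :* r)) refl π (s * X) y r₁ ⟩
              π * Z                                                    ∎
            -- Instead of cancelling π in s b = π Z, this multiplies by d s = π r₁ and cancels d, at
            -- the cost of a second factor s.
            killed : s * (s * β - Z) ≈ 0#
            killed = δ-injective _ (begin
              δ * (s * (s * β - Z))           ≈⟨ *-assoc δ s _ ⟨
              δ * s * (s * β - Z)             ≈⟨ *-congʳ δs≈ ⟩
              π * r₁ * (s * β - Z)
                ≈⟨ solve 6 (λ p r s x a z → p :* r :* (s :* (x :* a) :- z) := r :* (s :* (p :* x :* a) :- p :* z)) refl π r₁ s (π ^ j) α Z ⟩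
              r₁ * (s * b - π * Z)            ≈⟨ *-congˡ (trans (+-congʳ sb) (-‿inverseʳ _)) ⟩
              r₁ * 0#                         ≈⟨ zeroʳ r₁ ⟩
              0#                              ∎)
        -- As s² = 1 + d y₁ (1 + s), β is s² β = s Z minus y₁ (1 + s) π^j (d α), and d α ∈ R.
        in R-resp
          (begin
            s * Z + - (y₁ * (ι (ℤ.+ 1) + s) * (π ^ j * (δ * α)))
              ≈⟨ +-congʳ (trans (sym (+-identityˡ _)) (trans (+-congʳ (sym killed))
                   (solve 3 (λ s b z → s :* (s :* b :- z) :+ s :* z := s :* s :* b) refl s β Z))) ⟩
            s * s * β + - (y₁ * (ι (ℤ.+ 1) + s) * (π ^ j * (δ * α)))
              ≈⟨ +-congʳ (*-congʳ (*-cong s≈ s≈)) ⟩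
            (ι (ℤ.+ 1) + δ * y₁) * (ι (ℤ.+ 1) + δ * y₁) * β + - (y₁ * (ι (ℤ.+ 1) + s) * (π ^ j * (δ * α)))
              ≈⟨ +-congˡ (-‿cong (*-congʳ (*-congˡ (+-congˡ s≈)))) ⟩
            (ι (ℤ.+ 1) + δ * y₁) * (ι (ℤ.+ 1) + δ * y₁) * β + - (y₁ * (ι (ℤ.+ 1) + (ι (ℤ.+ 1) + δ * y₁)) * (π ^ j * (δ * α)))
              ≈⟨ solve 4 (λ y d x a → (con (ℤ.+ 1) :+ d :* y) :* (con (ℤ.+ 1) :+ d :* y) :* (x :* a)
                    :+ :- (y :* (con (ℤ.+ 1) :+ (con (ℤ.+ 1) :+ d :* y)) :* (x :* (d :* a))) := x :* a) refl y₁ δ (π ^ j) α ⟩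
            β ∎)
          (R-+ (R-* Rs RZ) (R-neg (R-* (R-* Ry₁ (R-+ (R-ι (ℤ.+ 1)) Rs)) (R-* (R-^ R-π j) Rδα))))
        where
        s≈ : ∀ {v} → 1# + v ≈ ι (ℤ.+ 1) + v
        s≈ = +-congʳ (sym 1-homo)

      descend : ∀ j → R (π ^ j * α) → R α
      descend zero    h = R-resp (*-identityˡ α) h
      descend (suc j) h = descend j (step j h)

      integral⇒R : R α
      integral⇒R = let E , r , Rr , eq = π-power in descend E (R-resp
        (trans (solve 3 (λ r d a → r :* (d :* a) := d :* r :* a) refl r δ α) (*-congʳ (sym eq))) (R-* Rr Rδα))

-- Finite abelian groups

prime∣^ : ∀ {p} → Prime p → ∀ m k → p ∣ m ℕ.^ k → p ∣ m
prime∣^ pp m zero    h = contradiction (ℕ∣.∣1⇒≡1 h) (ℕ.nonTrivial⇒≢1 {{prime⇒nonTrivial pp}})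
prime∣^ pp m (suc k) h with euclidsLemma m (m ℕ.^ k) pp h
... | inj₁ p∣m = p∣m
... | inj₂ p∣  = prime∣^ pp m k p∣

sumBelow : ℕ → (ℕ → ℕ) → ℕ
sumBelow zero    f = 0
sumBelow (suc e) f = f e ℕ.+ sumBelow e f

sumBelow-cong : ∀ e {f g} → (∀ t → f t ≡ g t) → sumBelow e f ≡ sumBelow e g
sumBelow-cong zero    h = ≡.refl
sumBelow-cong (suc e) h = ≡.cong₂ ℕ._+_ (h e) (sumBelow-cong e h)

sumBelow-shift : ∀ e f → sumBelow e (λ t → f (suc t)) ℕ.+ f 0 ≡ f e ℕ.+ sumBelow e f
sumBelow-shift zero    f = ≡.sym (ℕ.+-identityʳ (f 0))
sumBelow-shift (suc e) f = ≡.trans (ℕ.+-assoc (f (suc e)) _ _) (≡.cong (f (suc e) ℕ.+_) (sumBelow-shift e f))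

module FiniteAbelianGroup {N : ℕ} (_∙_ : Fin N → Fin N → Fin N) (ε : Fin N) (_⁻¹ : Fin N → Fin N)
  (isAbelianGroup : IsAbelianGroup _≡_ _∙_ ε _⁻¹) where

  private
    group : AbelianGroup 0ℓ 0ℓ
    group = record { isAbelianGroup = isAbelianGroup }
    module G = AbelianGroup group
    module GSum = Algebra.Properties.CommutativeMonoid.Sum G.commutativeMonoid
    module ℕSum = Algebra.Properties.CommutativeMonoid.Sum ℕ.+-0-commutativeMonoid
    open Algebra.Properties.Group G.group using (∙-cancelʳ)
    open ≡.≡-Reasoning

  open Algebra.Properties.Monoid.Mult G.monoid using (×-assocˡ) renaming (_×_ to _·_) public

  translate : Fin N → Permutation N N
  translate x = permutation (_∙ x) (_∙ (x ⁻¹))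
    (λ y → ≡.trans (G.assoc y (x ⁻¹) x) (≡.trans (≡.cong (y ∙_) (G.inverseˡ x)) (G.identityʳ y)))
    (λ y → ≡.trans (G.assoc y x (x ⁻¹)) (≡.trans (≡.cong (y ∙_) (G.inverseʳ x)) (G.identityʳ y)))

  -- Translation by x permutes the group, so the sum of all elements equals itself plus N · x.
  N·x≡ε : ∀ x → N · x ≡ ε
  N·x≡ε x = ∙-cancelʳ (GSum.sum (λ y → y)) (N · x) ε (begin
    (N · x) ∙ GSum.sum (λ y → y)                    ≡⟨ ≡.cong (_∙ GSum.sum (λ y → y)) (≡.sym (GSum.sum-replicate N)) ⟩
    GSum.sum {N} (λ _ → x) ∙ GSum.sum (λ y → y)     ≡⟨ G.comm _ _ ⟩
    GSum.sum (λ y → y) ∙ GSum.sum {N} (λ _ → x)     ≡⟨ GSum.∑-distrib-+ (λ y → y) (λ _ → x) ⟨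
    GSum.sum (λ y → y ∙ x)                          ≡⟨ GSum.sum-permute (λ y → y) (translate x) ⟨
    GSum.sum (λ y → y)                              ≡⟨ G.identityˡ _ ⟨
    ε ∙ GSum.sum (λ y → y)                          ∎)

  -- The number of tuples (t_x) with 0 ≤ t_x < e and y + Σ t_x x = 0, that is, the size of the fibre
  -- over -y.
  count : ℕ → List (Fin N) → Fin N → ℕ
  count e []       y = if does (y Fin.≟ ε) then 1 else 0
  count e (x ∷ xs) y = sumBelow e (λ t → count e xs (y ∙ (t · x)))

  sum-indicator : ∀ {n} (i : Fin n) → ℕSum.sum (λ j → if does (j Fin.≟ i) then 1 else 0) ≡ 1
  sum-indicator {suc n} Fin.zero    = ≡.cong suc (ℕSum.sum-replicate-zero n)
  sum-indicator {suc n} (Fin.suc i) = sum-indicator i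

  sum-sumBelow : ∀ e c (f : Fin N → ℕ → ℕ) → (∀ t → ℕSum.sum (λ y → f y t) ≡ c) → ℕSum.sum (λ y → sumBelow e (f y)) ≡ e ℕ.* c
  sum-sumBelow zero    c f h = ℕSum.sum-replicate-zero N
  sum-sumBelow (suc e) c f h = ≡.trans (ℕSum.∑-distrib-+ (λ y → f y e) (λ y → sumBelow e (f y)))
    (≡.cong₂ ℕ._+_ (h e) (sum-sumBelow e c f h))

  sum-count : ∀ e xs → ℕSum.sum (count e xs) ≡ e ℕ.^ length xs
  sum-count e []       = sum-indicator ε
  sum-count e (x ∷ xs) = sum-sumBelow e _ (λ y t → count e xs (y ∙ (t · x)))
    (λ t → ≡.trans (≡.sym (ℕSum.sum-permute (count e xs) (translate (t · x)))) (sum-count e xs))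

  -- Adding x to y shifts the coordinate t_x by one, and because e · x = ε this only rotates its
  -- range.
  count-invariant : ∀ e → (∀ x → e · x ≡ ε) → ∀ xs {x} → x ∈ xs → ∀ y → count e xs (y ∙ x) ≡ count e xs y
  count-invariant e kill (x ∷ xs) (here ≡.refl) y = ℕ.+-cancelʳ-≡ (F 0) _ _ (begin
    sumBelow e (λ t → count e xs ((y ∙ x) ∙ (t · x))) ℕ.+ F 0  ≡⟨ ≡.cong (ℕ._+ F 0) (sumBelow-cong e (λ t → ≡.cong (count e xs) (G.assoc y x (t · x)))) ⟩
    sumBelow e (λ t → F (suc t)) ℕ.+ F 0                       ≡⟨ sumBelow-shift e F ⟩
    F e ℕ.+ sumBelow e F                                       ≡⟨ ≡.cong (λ z → count e xs (y ∙ z) ℕ.+ sumBelow e F) (kill x) ⟩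
    F 0 ℕ.+ sumBelow e F                                       ≡⟨ ℕ.+-comm (F 0) _ ⟩
    sumBelow e F ℕ.+ F 0                                       ∎)
    where
    F : ℕ → ℕ
    F t = count e xs (y ∙ (t · x))
  count-invariant e kill (x ∷ xs) {x′} (there x′∈) y = sumBelow-cong e (λ t → ≡.trans
    (≡.cong (count e xs) (≡.trans (G.assoc y x′ (t · x)) (≡.trans (≡.cong (y ∙_) (G.comm x′ (t · x))) (≡.sym (G.assoc y (t · x) x′)))))
    (count-invariant e kill xs x′∈ (y ∙ (t · x))))

  -- All fibres of (t_x)_x ↦ Σ t_x x from (ℤ/e)^N onto the group have equal size.
  order∣exponent^ : ∀ e → (∀ x → e · x ≡ ε) → N ∣ e ℕ.^ length (allFin N)
  order∣exponent^ e kill = divides (count e (allFin N) ε) (begin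
    e ℕ.^ length (allFin N)                     ≡⟨ sum-count e (allFin N) ⟨
    ℕSum.sum (count e (allFin N))               ≡⟨ ℕSum.sum-cong-≗ constant ⟩
    ℕSum.sum {N} (λ _ → count e (allFin N) ε)   ≡⟨ sum-const N (count e (allFin N) ε) ⟩
    N ℕ.* count e (allFin N) ε                  ≡⟨ ℕ.*-comm N _ ⟩
    count e (allFin N) ε ℕ.* N                  ∎)
    where
    constant : ∀ y → count e (allFin N) y ≡ count e (allFin N) ε
    constant y = ≡.trans (≡.cong (count e (allFin N)) (≡.sym (G.identityˡ y)))
      (count-invariant e kill (allFin N) (∈-allFin y) ε)
    sum-const : ∀ n c → ℕSum.sum {n} (λ _ → c) ≡ n ℕ.* c
    sum-const zero    c = ≡.refl
    sum-const (suc n) c = ≡.cong (c ℕ.+_) (sum-const n c)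

  module _ {d : ℕ} (d-prime : Prime d) (torsion-free : ∀ x → d · x ≡ ε → x ≡ ε) where

    -- If q d is an exponent, then d · (q · x) = ε, and torsion-freeness makes q one as well. The
    -- bound f on M lets the recursion terminate.
    primeToExponent : ∀ f M → 0 ℕ.< M → M ℕ.≤ f → (∀ x → M · x ≡ ε) → Σ ℕ λ e → ¬ (d ∣ e) × (∀ x → e · x ≡ ε)
    primeToExponent zero    M 0<M M≤f kill = contradiction M≤f (ℕ.<⇒≱ 0<M)
    primeToExponent (suc f) M 0<M M≤f kill with d ∣? M
    ... | no d∤M = M , d∤M , kill
    ... | yes (divides q ≡.refl) = primeToExponent f q 0<q (ℕ.≤-pred (ℕ.<-≤-trans q<qd M≤f))
      (λ x → torsion-free (q · x) (≡.trans (×-assocˡ x d q) (≡.trans (≡.cong (_· x) (ℕ.*-comm d q)) (kill x))))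
      where
      0<q : 0 ℕ.< q
      0<q = ℕ.n≢0⇒n>0 λ { ≡.refl → ℕ.<⇒≢ 0<M ≡.refl }
      q<qd : q ℕ.< q ℕ.* d
      q<qd = ℕ.m<m*n q d {{ℕ.>-nonZero 0<q}} (ℕ.nonTrivial⇒n>1 d {{prime⇒nonTrivial d-prime}})

    -- The contrapositive of Cauchy's theorem: N divides a power of every exponent, and there is an
    -- exponent prime to d.
    order-prime-to : ¬ (d ∣ N)
    order-prime-to d∣N =
      let e , d∤e , kill = primeToExponent N N 0<N ℕ.≤-refl N·x≡ε
      in d∤e (prime∣^ d-prime e (length (allFin N)) (ℕ∣.∣-trans d∣N (order∣exponent^ e kill)))
      where
      0<N : 0 ℕ.< N
      0<N = ℕ.≤-<-trans z≤n (Fin.toℕ<n ε)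

-- The number field

module Specialise (A T : CommutativeRing 0ℓ 0ℓ) (φA : ℤ→ A) (φT : ℤ→ T) where
  private
    module A = ℤ-Algebra A φA
    module T = ℤ-Algebra T φT

  module Along
    (h : A.Carrier → T.Carrier)
    (h-cong : ∀ {x y} → x A.≈ y → h x T.≈ h y)
    (h-+ : ∀ x y → h (x A.+ y) T.≈ h x T.+ h y)
    (h-* : ∀ x y → h (x A.* y) T.≈ h x T.* h y)
    (h-neg : ∀ x → h (A.- x) T.≈ T.- h x)
    (h-ι : ∀ c → h (A.ι c) T.≈ T.ι c)
    (δ a g : A.Carrier) (hg : h g T.≈ T.0#)
    (hδ-injective : ∀ y → h δ T.* y T.≈ T.0# → y T.≈ T.0#)
    (δ-multiple : Σ A.Carrier λ y → A.Mem (A.zeroIdeal A.⊕ g A.⊕ a) (δ A.* (A.1# A.+ δ A.* y)))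
    (E : ℕ) (a-power : A.Mem (A.zeroIdeal A.⊕ g A.⊕ δ) (a A.^ E))
    (reduced : ∀ z k → Σ A.Carrier λ u → A.Mem (A.zeroIdeal A.⊕ δ A.⊕ a) (z A.- u A.* z A.^ k)) where
    open T
    open ℤ-Solver T φT using (solve; _:+_; _:*_; :-_; _:-_; _:=_)

    -- For h the map from ℤ[x] to K this is R = ℤ[c₀].
    Image : Carrier → Set
    Image t = Σ A.Carrier λ z → t ≈ h z

    h-0 : h A.0# ≈ 0#
    h-0 = trans (h-cong (A.sym A.0-homo)) (trans (h-ι (ℤ.+ 0)) 0-homo)

    h-1 : h A.1# ≈ 1#
    h-1 = trans (h-cong (A.sym A.1-homo)) (trans (h-ι (ℤ.+ 1)) 1-homo)

    h-^ : ∀ x k → h (x A.^ k) ≈ h x ^ k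
    h-^ x zero    = h-1
    h-^ x (suc k) = trans (h-* x (x A.^ k)) (*-congˡ (h-^ x k))

    h-minus : ∀ x u y → h (x A.- u A.* y) ≈ h x - h u * h y
    h-minus x u y = trans (h-+ x _) (+-congˡ (trans (h-neg _) (-‿cong (h-* u y))))

    h-mem : ∀ x y {s} → ((v , u , _) : A.Mem (A.zeroIdeal A.⊕ x A.⊕ y) s) → h s ≈ h u * h x + h v * h y
    h-mem x y {s} (v , u , e) = trans
      (solve 3 (λ s p q → s := (s :- q :- p) :+ (p :+ q)) refl (h s) (h u * h x) (h v * h y))
      (trans (+-congʳ (trans (sym (trans (h-minus _ u x) (+-congʳ (h-minus s v y)))) (trans (h-cong e) h-0))) (+-identityˡ _))

    -- At c₀ the generator g vanishes, so membership in (g, y) becomes divisibility by the value of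
    -- y in ℤ[c₀].
    h-mem-g : ∀ y {s} → ((v , _) : A.Mem (A.zeroIdeal A.⊕ g A.⊕ y) s) → h s ≈ h v * h y
    h-mem-g y m = trans (h-mem g y m) (trans (+-congʳ (trans (*-congˡ hg) (zeroʳ _))) (+-identityˡ _))

    Image-resp : ∀ {x y} → x ≈ y → Image x → Image y
    Image-resp e (z , f) = z , trans (sym e) f

    Image-+ : ∀ {x y} → Image x → Image y → Image (x + y)
    Image-+ (z , e) (w , f) = z A.+ w , trans (+-cong e f) (sym (h-+ z w))

    Image-* : ∀ {x y} → Image x → Image y → Image (x * y)
    Image-* (z , e) (w , f) = z A.* w , trans (*-cong e f) (sym (h-* z w))

    Image-neg : ∀ {x} → Image x → Image (- x)
    Image-neg (z , e) = A.- z , trans (-‿cong e) (sym (h-neg z))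

    open Integrality T φT using (IntegralOf)

    saturated : ∀ {α k} → IntegralOf k α → Image (h δ * α) → Image α
    saturated = Saturation.Descent.integral⇒R T φT Image Image-resp Image-+ Image-* Image-neg
      (λ c → A.ι c , sym (h-ι c)) (h a) (h δ) (a , refl) (δ , refl) hδ-injective
      (let y , m = δ-multiple in h y , (y , refl) , h (proj₁ m) , (proj₁ m , refl)
        , trans (trans (*-congˡ (+-cong (sym h-1) (sym (h-* δ y)))) (trans (*-congˡ (sym (h-+ _ _))) (sym (h-* δ _))))
            (trans (h-mem-g a m) (*-comm _ _)))
      (E , h (proj₁ a-power) , (proj₁ a-power , refl) , trans (sym (h-^ a E)) (trans (h-mem-g δ a-power) (*-comm _ _)))
      λ b (z , b≈) k → let u , m = reduced z k ; w , y , _ = m in h u , h w , h y , (u , refl) , (w , refl) , (y , refl)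
        , trans b≈ (trans (solve 2 (λ z p → z := (z :- p) :+ p) refl (h z) (h u * h z ^ k))
            (trans (+-congʳ (trans (trans (+-congˡ (-‿cong (*-congˡ (sym (h-^ z k))))) (sym (h-minus z u _))) (h-mem δ a m)))
              (trans (solve 3 (λ p q r → p :+ q :+ r := r :+ q :+ p) refl (h y * h δ) (h w * h a) (h u * h z ^ k))
                (+-congʳ (+-congʳ (*-congˡ (^-congˡ k (sym b≈))))))))

module IndexGroup (T : CommutativeRing 0ℓ 0ℓ) (φ : ℤ→ T) where
  open ℤ-Algebra T φ
  open ℤ-Solver T φ using (solve; _:+_; _:*_; :-_; _:-_; _:=_)

  module Torsion
    (Int : Carrier → Set) (Int-0 : Int 0#) (Int-+ : ∀ {x y} → Int x → Int y → Int (x + y)) (Int-neg : ∀ {x} → Int x → Int (- x))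
    (R : Carrier → Set) (R-resp : ∀ {x y} → x ≈ y → R x → R y) (R-0 : R 0#)
    (R-+ : ∀ {x y} → R x → R y → R (x + y)) (R-neg : ∀ {x} → R x → R (- x))
    {N : ℕ} (f : Σ Carrier Int → Fin N) (s : Fin N → Σ Carrier Int)
    (f-cong : ∀ a b → R (proj₁ a - proj₁ b) → f a ≡ f b)
    (f∘s : ∀ i → f (s i) ≡ i) (s∘f : ∀ a → R (proj₁ (s (f a)) - proj₁ a))
    {d : ℕ} (d-prime : Prime d) (saturated : ∀ x → Int x → R (ι (ℤ.+ d) * x) → R x) where

    rep : Fin N → Carrier
    rep i = proj₁ (s i)

    -- The addition of 𝒪_K/ℤ[c₀], transported along the given bijection. The group laws hold for the
    -- representatives up to elements of R, which f does not see.
    _∙_ : Fin N → Fin N → Fin N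
    i ∙ j = f (rep i + rep j , Int-+ (proj₂ (s i)) (proj₂ (s j)))

    ε : Fin N
    ε = f (0# , Int-0)

    _⁻¹ : Fin N → Fin N
    i ⁻¹ = f (- rep i , Int-neg (proj₂ (s i)))

    rep-∙ : ∀ i j → R (rep (i ∙ j) - (rep i + rep j))
    rep-∙ i j = s∘f _

    ≡-rep : ∀ i j → R (rep i - rep j) → i ≡ j
    ≡-rep i j r = ≡.trans (≡.sym (f∘s i)) (≡.trans (f-cong (s i) (s j) r) (f∘s j))

    isAbelianGroup : IsAbelianGroup _≡_ _∙_ ε _⁻¹
    isAbelianGroup = record
      { isGroup = record
        { isMonoid = record
          { isSemigroup = record
            { isMagma = record { isEquivalence = ≡.isEquivalence ; ∙-cong = ≡.cong₂ _∙_ }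
            ; assoc = λ i j k → ≡-rep _ _ (R-resp
                (solve 7 (λ ij-k ij i-jk jk i j k → (ij-k :- (ij :+ k)) :+ (ij :- (i :+ j)) :+ :- ((i-jk :- (i :+ jk)) :+ (jk :- (j :+ k))) := ij-k :- i-jk)
                  refl (rep ((i ∙ j) ∙ k)) (rep (i ∙ j)) (rep (i ∙ (j ∙ k))) (rep (j ∙ k)) (rep i) (rep j) (rep k))
                (R-+ (R-+ (rep-∙ (i ∙ j) k) (rep-∙ i j)) (R-neg (R-+ (rep-∙ i (j ∙ k)) (rep-∙ j k))))) }
          ; identity = idˡ , λ i → ≡.trans (comm i ε) (idˡ i) }
        ; inverse = invˡ , (λ i → ≡.trans (comm i (i ⁻¹)) (invˡ i))
        ; ⁻¹-cong = ≡.cong _⁻¹ }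
      ; comm = comm }
      where
      comm : ∀ i j → i ∙ j ≡ j ∙ i
      comm i j = f-cong _ _ (R-resp (sym (trans (+-congʳ (+-comm (rep i) (rep j))) (-‿inverseʳ _))) R-0)
      repε : R (rep ε)
      repε = R-resp (x-0≈x _) (s∘f (0# , Int-0))
      idˡ : ∀ i → ε ∙ i ≡ i
      idˡ i = ≡-rep _ _ (R-resp (solve 3 (λ x e i → x :- (e :+ i) :+ e := x :- i) refl (rep (ε ∙ i)) (rep ε) (rep i))
        (R-+ (rep-∙ ε i) repε))
      invˡ : ∀ i → (i ⁻¹) ∙ i ≡ ε
      invˡ i = ≡-rep _ _ (R-resp
        (solve 4 (λ x v i e → x :- (v :+ i) :+ (v :- :- i) :+ :- e := x :- e) refl (rep ((i ⁻¹) ∙ i)) (rep (i ⁻¹)) (rep i) (rep ε))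
        (R-+ (R-+ (rep-∙ (i ⁻¹) i) (s∘f _)) (R-neg repε)))

    open FiniteAbelianGroup _∙_ ε _⁻¹ isAbelianGroup

    rep-· : ∀ k i → R (rep (k · i) - ι (ℤ.+ k) * rep i)
    rep-· zero    i = R-resp (+-congˡ (-‿cong (sym (trans (*-congʳ 0-homo) (zeroˡ _))))) (s∘f (0# , Int-0))
    rep-· (suc k) i = R-resp
      (trans (solve 4 (λ x y i c → x :- (i :+ y) :+ (y :- c :* i) := x :- (i :+ c :* i)) refl (rep (suc k · i)) (rep (k · i)) (rep i) (ι (ℤ.+ k)))
        (+-congˡ (-‿cong (trans (+-congʳ (trans (sym (*-identityˡ _)) (*-congʳ (sym 1-homo))))
          (trans (sym (distribʳ _ _ _)) (*-congʳ (sym (+-homo (ℤ.+ 1) (ℤ.+ k)))))))))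
      (R-+ (rep-∙ i (k · i)) (rep-· k i))

    torsion-free : ∀ i → d · i ≡ ε → i ≡ ε
    torsion-free i eq = ≡.trans (≡.sym (f∘s i)) (f-cong (s i) (0# , Int-0) (R-resp (sym (x-0≈x _))
      (saturated (rep i) (proj₂ (s i)) (R-resp
        (solve 3 (λ e o x → (e :- o) :+ :- (e :- x) :+ o := x) refl (rep (d · i)) 0# (ι (ℤ.+ d) * rep i))
        (R-+ (R-+ (≡.subst (λ j → R (rep j - 0#)) (≡.sym eq) (s∘f (0# , Int-0))) (R-neg (rep-· d i))) R-0)))))

    index-prime-to : ¬ (d ∣ N)
    index-prime-to = order-prime-to d-prime torsion-free

-- The embedding of ℤ[x] into ℚ[x]

/1-toℚᵘ : ∀ z → ℚ.toℚᵘ (z ℚ./ 1) ℚᵘ.≃ mkℚᵘ z 0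
/1-toℚᵘ z = ℚ.toℚᵘ-fromℚᵘ (mkℚᵘ z 0)

/1-+ : ∀ a b → (a ℤ.+ b) ℚ./ 1 ≡ a ℚ./ 1 ℚ.+ b ℚ./ 1
/1-+ a b = ℚ.toℚᵘ-injective (ℚᵘ.≃-trans (/1-toℚᵘ (a ℤ.+ b)) (ℚᵘ.≃-trans
  (*≡* (≡.cong (ℤ._* ℤ.+ 1) (≡.sym (≡.cong₂ ℤ._+_ (ℤ.*-identityʳ a) (ℤ.*-identityʳ b)))))
  (ℚᵘ.≃-sym (ℚᵘ.≃-trans (ℚ.toℚᵘ-homo-+ (a ℚ./ 1) (b ℚ./ 1)) (ℚᵘ.+-cong (/1-toℚᵘ a) (/1-toℚᵘ b))))))

/1-* : ∀ a b → (a ℤ.* b) ℚ./ 1 ≡ (a ℚ./ 1) ℚ.* (b ℚ./ 1)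
/1-* a b = ℚ.toℚᵘ-injective (ℚᵘ.≃-trans (/1-toℚᵘ (a ℤ.* b))
  (ℚᵘ.≃-sym (ℚᵘ.≃-trans (ℚ.toℚᵘ-homo-* (a ℚ./ 1) (b ℚ./ 1)) (ℚᵘ.*-cong (/1-toℚᵘ a) (/1-toℚᵘ b)))))

/1-neg : ∀ a → (ℤ.- a) ℚ./ 1 ≡ ℚ.- (a ℚ./ 1)
/1-neg a = ℚ.toℚᵘ-injective (ℚᵘ.≃-trans (/1-toℚᵘ (ℤ.- a))
  (ℚᵘ.≃-sym (ℚᵘ.≃-trans (ℚ.toℚᵘ-homo‿- (a ℚ./ 1)) (ℚᵘ.-‿cong (/1-toℚᵘ a)))))

reciprocal : ∀ e → (ℤ.+ 1 ℚ./ suc e) ℚ.* (ℤ.+ suc e ℚ./ 1) ≡ ℚ.1ℚ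
reciprocal e = ℚ.toℚᵘ-injective (ℚᵘ.≃-trans (ℚ.toℚᵘ-homo-* (ℤ.+ 1 ℚ./ suc e) (ℤ.+ suc e ℚ./ 1))
  (ℚᵘ.≃-trans (ℚᵘ.*-cong (ℚ.toℚᵘ-fromℚᵘ (mkℚᵘ (ℤ.+ 1) e)) (/1-toℚᵘ (ℤ.+ suc e)))
    (*≡* (≡.trans (ℤ.*-identityʳ _) (≡.trans (ℤ.*-identityˡ _) (≡.sym (≡.trans (ℤ.*-identityˡ _) (≡.cong ℤ.+_ (ℕ.*-identityʳ (suc e))))))))))

constℚ : ℤ→ ℚX.polyRing
constℚ = record
  { ⟦_⟧ = λ z → ℚX.constP (z ℚ./ 1)
  ; +-homo = λ a b → ℚX.by-coeff λ { zero → /1-+ a b ; (suc i) → ≡.refl }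
  ; *-homo = λ a b → ℚX.by-coeff λ { zero → ≡.trans (/1-* a b) (≡.sym (ℚ.+-identityʳ _)) ; (suc i) → ≡.refl }
  ; -‿homo = λ a → ℚX.by-coeff λ { zero → /1-neg a ; (suc i) → ≡.refl }
  ; 0-homo = ℚX.by-coeff λ { zero → ≡.refl ; (suc i) → ≡.refl }
  ; 1-homo = ℚX.by-coeff λ i → ≡.refl }

coeff-toQ : ∀ p i → ℚX.coeff (toQ p) i ≡ ℤX.coeff p i ℚ./ 1
coeff-toQ []      i       = ≡.refl
coeff-toQ (a ∷ p) zero    = ≡.refl
coeff-toQ (a ∷ p) (suc i) = coeff-toQ p i

toQ-cong : ∀ {p q} → p ℤX.≋ q → toQ p ℚX.≋ toQ q
toQ-cong {p} {q} e = ℚX.by-coeff λ i → ≡.trans (coeff-toQ p i) (≡.trans (≡.cong (ℚ._/ 1) (ℤX.at e i)) (≡.sym (coeff-toQ q i)))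

toQ-+ : ∀ p q → toQ (p ℤX.+ₚ q) ℚX.≋ toQ p ℚX.+ₚ toQ q
toQ-+ p q = ℚX.by-coeff λ i → ≡.trans (coeff-toQ (p ℤX.+ₚ q) i) (≡.trans (≡.cong (ℚ._/ 1) (ℤX.coeff-+ p q i))
  (≡.trans (/1-+ (ℤX.coeff p i) (ℤX.coeff q i)) (≡.sym (≡.trans (ℚX.coeff-+ (toQ p) (toQ q) i) (≡.cong₂ ℚ._+_ (coeff-toQ p i) (coeff-toQ q i))))))

toQ-neg : ∀ p → toQ (ℤX.-ₚ p) ℚX.≋ ℚX.-ₚ toQ p
toQ-neg p = ℚX.by-coeff λ i → ≡.trans (coeff-toQ (ℤX.-ₚ p) i) (≡.trans (≡.cong (ℚ._/ 1) (ℤX.coeff-neg p i))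
  (≡.trans (/1-neg (ℤX.coeff p i)) (≡.sym (≡.trans (ℚX.coeff-neg (toQ p) i) (≡.cong ℚ.-_ (coeff-toQ p i))))))

toQ-* : ∀ p q → toQ (p ℤX.*ₚ q) ℚX.≋ toQ p ℚX.*ₚ toQ q
toQ-* p q = ℚX.by-coeff (λ i → ≡.trans (coeff-toQ (p ℤX.*ₚ q) i) (go p q i))
  where
  go : ∀ p q i → ℤX.coeff (p ℤX.*ₚ q) i ℚ./ 1 ≡ ℚX.coeff (toQ p ℚX.*ₚ toQ q) i
  go []      q i       = ≡.refl
  go (a ∷ p) q zero    = ≡.trans (≡.cong (ℚ._/ 1) (ℤX.coeff-*-zero a p q)) (≡.trans (/1-* a (ℤX.coeff q 0))
    (≡.sym (≡.trans (ℚX.coeff-*-zero (a ℚ./ 1) (toQ p) (toQ q)) (≡.cong ((a ℚ./ 1) ℚ.*_) (coeff-toQ q 0)))))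
  go (a ∷ p) q (suc i) = ≡.trans (≡.cong (ℚ._/ 1) (ℤX.coeff-*-suc a p q i)) (≡.trans (/1-+ (a ℤ.* ℤX.coeff q (suc i)) (ℤX.coeff (p ℤX.*ₚ q) i))
    (≡.sym (≡.trans (ℚX.coeff-*-suc (a ℚ./ 1) (toQ p) (toQ q) i)
      (≡.cong₂ ℚ._+_ (≡.trans (≡.cong ((a ℚ./ 1) ℚ.*_) (coeff-toQ q (suc i))) (≡.sym (/1-* a (ℤX.coeff q (suc i))))) (≡.sym (go p q i))))))

module Q = ℤ-Algebra ℚX.polyRing constℚ

-- The ring of integers of K and the index of ℤ[c₀]

module Field (p : QPoly) where
  module K/ = Q.Quotient (Q.zeroIdeal Q.⊕ p)
  module K = CommutativeRing K/.quotient
  open Integrality K/.quotient K/.φ/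
  open NumberField p
  open ℤ-Solver ℚX.polyRing constℚ using (solve; _:+_; _:-_; _:=_)

  ∣ₚ⇒mem : ∀ {α} → ℚ[x]._∣ₚ_ p α → Q.Mem (Q.zeroIdeal Q.⊕ p) α
  ∣ₚ⇒mem {α} (r , e) = r , Q.trans (Q.+-congʳ {Q.- (r Q.* p)} (Q.sym (ℚX.by-coeff e)))
    (Q.trans (Q.+-congʳ {Q.- (r Q.* p)} (Q.*-comm p r)) (Q.-‿inverseʳ (r Q.* p)))

  mem⇒∣ₚ : ∀ {α} → Q.Mem (Q.zeroIdeal Q.⊕ p) α → ℚ[x]._∣ₚ_ p α
  mem⇒∣ₚ {α} (r , e) = r , ℚX.at (Q.sym (Q.trans
    (solve 2 (λ a b → a := (a :- b) :+ b) Q.refl α (r Q.* p))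
    (Q.trans (Q.+-congʳ {r Q.* p} e) (Q.trans (Q.+-identityˡ (r Q.* p)) (Q.*-comm r p)))))

  ≈K⇒≈ : ∀ {α β} → α ≈K β → α K.≈ β
  ≈K⇒≈ h = K/.mod (∣ₚ⇒mem h)

  ≈⇒≈K : ∀ {α β} → α K.≈ β → α ≈K β
  ≈⇒≈K (K/.mod h) = mem⇒∣ₚ h

  compose≡ev : ∀ h α → ℚ[x].compose (toQ h) α ≡ ev h α
  compose≡ev []      α = ≡.refl
  compose≡ev (c ∷ h) α = ≡.cong (λ z → ℚ[x].constP (c ℚ./ 1) ℚX.+ₚ α ℚX.*ₚ z) (compose≡ev h α)

  algInt⇒integral : ∀ α → IsAlgInt α → Σ ℕ λ k → IntegralOf k α
  algInt⇒integral α (h , monic , root) = proj₁ monic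
    , monic⇒integral h monic (≡.subst (K._≈ []) (compose≡ev h α) (≈K⇒≈ root))

  integral⇒algInt : ∀ α → (Σ ℕ λ k → IntegralOf k α) → IsAlgInt α
  integral⇒algInt α (k , int) = let h , monic , root = integral⇒monic int in
    h , monic , ≈⇒≈K (≡.subst (K._≈ []) (≡.sym (compose≡ev h α)) root)

  module Index (e : ℕ) (d-prime : Prime (suc (suc e))) where
    private
      d = suc (suc e)
      δ = S.ι (ℤ.+ d)

    module At (a g : ZPoly) (p∣g : ℚ[x]._∣ₚ_ p (toQ g))
      (δ-multiple : Σ ZPoly λ y → S.Mem (S.zeroIdeal S.⊕ g S.⊕ a) (δ S.* (S.1# S.+ δ S.* y)))
      (E : ℕ) (a-power : S.Mem (S.zeroIdeal S.⊕ g S.⊕ δ) (a S.^ E))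
      (reduced : ∀ z k → Σ ZPoly λ u → S.Mem (S.zeroIdeal S.⊕ δ S.⊕ a) (z S.- u S.* z S.^ k)) where

      δ-injective : ∀ y → toQ δ K.* y K.≈ K.0# → y K.≈ K.0#
      δ-injective y h = K.trans (K.sym (K.*-identityˡ y)) (K.trans (K.*-congʳ {y} (K.sym unit))
        (K.trans (K.*-assoc r (toQ δ) y) (K.trans (K.*-congˡ {r} h) (K.zeroʳ r))))
        where
        r : QPoly
        r = ℚX.constP (ℤ.+ 1 ℚ./ d)
        unit : r K.* toQ δ K.≈ K.1#
        unit = K/.incl (ℚX.by-coeff λ { zero → ≡.trans (ℚ.+-identityʳ _) (reciprocal (suc e)) ; (suc i) → ≡.refl })

      module Sp = Specialise.Along ℤX.polyRing K/.quotient constℤ K/.φ/ toQ (λ e → K/.incl (toQ-cong e))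
        (λ x y → K/.incl (toQ-+ x y)) (λ x y → K/.incl (toQ-* x y)) (λ x → K/.incl (toQ-neg x)) (λ c → K.refl {toQ (S.ι c)})
        δ a g (K/.mem⇒≈0 (∣ₚ⇒mem p∣g)) δ-injective δ-multiple E a-power reduced

      index : ∀ N → IndexIs N → ¬ (d ∣ N)
      index N (f , s , f-cong , f∘s , s∘f) = IndexGroup.Torsion.index-prime-to K/.quotient K/.φ/
        IsAlgInt (integral⇒algInt [] (1 , 0-integral))
        (λ {x} {y} h h′ → integral⇒algInt (x K.+ y) (+-integral (proj₂ (algInt⇒integral x h)) (proj₂ (algInt⇒integral y h′))))
        (λ {x} h → integral⇒algInt (K.- x) (neg-integral (proj₂ (algInt⇒integral x h))))
        Sp.Image Sp.Image-resp ([] , K.refl {[]}) Sp.Image-+ Sp.Image-neg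
        f s (λ a b (z , h) → f-cong a b (z , ≈⇒≈K h)) f∘s (λ a → let z , h = s∘f a in z , ≈K⇒≈ h)
        d-prime (λ x int h → Sp.saturated (proj₂ (algInt⇒integral x int)) h)

-- The polynomial G

open Products ℤX.polyRing constℤ using (∏)
open ℤ-Solver ℤX.polyRing constℤ using (solve; _:+_; _:*_; _:-_; _:=_)

Regular : ZPoly → Set
Regular f = ∀ y → f S.* y S.≈ S.0# → y S.≈ S.0#

regular-1 : Regular S.1#
regular-1 y h = S.trans (S.sym (S.*-identityˡ y)) h

regular-* : ∀ f g → Regular f → Regular g → Regular (f S.* g)
regular-* f g hf hg y h = hg y (hf (g S.* y) (S.trans (S.sym (S.*-assoc f g y)) h))

cancel : ∀ f {u v} → Regular f → f S.* u S.≈ f S.* v → u S.≈ v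
cancel f {u} {v} hf h = S.trans (solve 2 (λ u v → u := (u :- v) :+ v) S.refl u v)
  (S.trans (S.+-congʳ {v} (hf (u S.- v) (S.trans
    (solve 3 (λ f u v → f :* (u :- v) := f :* u :- f :* v) S.refl f u v)
    (S.trans (S.+-congʳ {S.- (f S.* v)} h) (S.-‿inverseʳ (f S.* v)))))) (S.+-identityˡ v))

monic-regular : ∀ {k f} → MonicOf k f → Regular f
monic-regular {k} {f} monic y h =
  let u , e = monic-cancel 0 {k} {f} y monic (S.resp ⟨ 0 ⟩ (S.sym h) (S.mem0 ⟨ 0 ⟩))
  in S.trans (S.sym (S.x-0≈x y)) (S.trans (S.+-congˡ {y} (S.-‿cong (S.sym
       (S.trans (S.*-congˡ {u} S.0-homo) (S.zeroʳ u))))) e)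

module _ (ε : ℕ → ℤ) (F G : ℕ → ZPoly) where

  -- The fold of `FnumDen` with signs and factors as parameters, so that the fractions for m and for
  -- 1 are both instances by computation.
  quotientFold : List ℕ → ZPoly × ZPoly
  quotientFold = foldr (λ k acc → let c = contrib (ε k) (F k) (G k) in
    (proj₁ c S.* proj₁ acc) , (proj₂ c S.* proj₂ acc)) (S.1# , S.1#)

  contrib-split : ∀ z f g b → f S.≈ g S.* b → Regular g → Σ ZPoly λ t → Regular t ×
    proj₁ (contrib z f g) S.≈ t S.* (if positive z then b else S.1#) ×
    proj₂ (contrib z f g) S.≈ t S.* (if negative z then b else S.1#)
  contrib-split (ℤ.+ 0)           f g b e r = S.1# , regular-1 , S.sym (S.*-identityˡ S.1#) , S.sym (S.*-identityˡ S.1#)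
  contrib-split (ℤ.+ 1)           f g b e r = g , r , e , S.sym (S.*-identityʳ g)
  contrib-split (ℤ.+ suc (suc _)) f g b e r = S.1# , regular-1 , S.sym (S.*-identityˡ S.1#) , S.sym (S.*-identityˡ S.1#)
  contrib-split ℤ.-[1+ 0 ]        f g b e r = g , r , S.sym (S.*-identityʳ g) , e
  contrib-split ℤ.-[1+ suc _ ]    f g b e r = S.1# , regular-1 , S.sym (S.*-identityˡ S.1#) , S.sym (S.*-identityˡ S.1#)

  -- Numerator and denominator share a factor t, the product of those G k whose sign is not 0. It is
  -- regular, so it can be cancelled later to leave a relation between the quotients B k alone.
  quotientFold-split : ∀ B ks → All (λ k → F k S.≈ G k S.* B k × Regular (G k)) ks → Σ ZPoly λ t → Regular t ×
    proj₁ (quotientFold ks) S.≈ t S.* ∏ (λ k → positive (ε k)) B ks ×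
    proj₂ (quotientFold ks) S.≈ t S.* ∏ (λ k → negative (ε k)) B ks
  quotientFold-split B []       []             = S.1# , regular-1 , S.sym (S.*-identityˡ S.1#) , S.sym (S.*-identityˡ S.1#)
  quotientFold-split B (k ∷ ks) ((e , r) ∷ hs) =
    let t , rt , e₁ , e₂ = contrib-split (ε k) (F k) (G k) (B k) e r
        t′ , rt′ , e₁′ , e₂′ = quotientFold-split B ks hs
    in t S.* t′ , regular-* t t′ rt rt′ , combine t t′ e₁ e₁′ , combine t t′ e₂ e₂′
    where
    combine : ∀ t t′ {x x′ y y′} → x S.≈ t S.* y → x′ S.≈ t′ S.* y′ → x S.* x′ S.≈ (t S.* t′) S.* (y S.* y′)
    combine t t′ {x} {x′} {y} {y′} h h′ = S.trans (S.*-cong h h′)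
      (solve 4 (λ t y t′ y′ → (t :* y) :* (t′ :* y′) := (t :* t′) :* (y :* y′)) S.refl t y t′ y′)

∏-1 : ∀ (σ : ℕ → Bool) ks → ∏ σ (λ _ → S.1#) ks S.≈ S.1#
∏-1 σ []       = S.refl {S.1#}
∏-1 σ (k ∷ ks) with σ k
... | true  = S.trans (S.*-identityˡ _) (∏-1 σ ks)
... | false = S.trans (S.*-identityˡ _) (∏-1 σ ks)

-- The index at a root of G

module AtRoot (e : ℕ) (d-prime : Prime (suc (suc e)))
  (a : ℕ → ZPoly) (isOrbit : IsOrbit ℤX.polyRing constℤ (suc (suc e)) a ℤX.X)
  (degree : ℕ → ℕ) (a-monic : ∀ k → MonicOf (degree k) (a (suc k)))
  (Δ-regular : ∀ j k → Regular (a (j ℕ.+ suc k) S.- a j)) where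

  private
    d = suc (suc e)

    a-regular-mod : IsRegularMod ℤX.polyRing constℤ d a
    a-regular-mod k y = monic-cancel d {degree k} {a (suc k)} y (a-monic k)

  open IsOrbit isOrbit
  open OrbitAlgebra ℤX.polyRing constℤ e d-prime a ℤX.X isOrbit
  open Assembly ℤX.polyRing constℤ e d-prime a ℤX.X isOrbit Δ-regular a-regular-mod

  module _ (n′ : ℕ) where
    private
      n = suc n′
      module Q/ = S.Quotient (⟨ d ⟩ S.⊕ a n)
      module A/ = CommutativeRing Q/.quotient
      module IA = Integrality Q/.quotient Q/.φ/

    ev-x : ∀ f → IA.ev f ℤX.X A/.≈ f
    ev-x []      = A/.refl {[]}
    ev-x (c ∷ f) = A/.trans (A/.+-congˡ {S.ι c} (A/.*-congˡ {ℤX.X} (ev-x f))) (A/.sym (Q/.incl (∷≈ c f)))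

    aₙ≈0 : a n A/.≈ S.0#
    aₙ≈0 = Q/.mem⇒≈0 (S.⊕-new ⟨ d ⟩ (a n))

    reduced : ∀ z k → Σ ZPoly λ u → S.Mem (⟨ d ⟩ S.⊕ a n) (z S.- u S.* z S.^ k)
    reduced z k = let u , h = FiniteCharP.Reduced.regular Q/.quotient Q/.φ/ e d-prime
                        (Q/.mem⇒≈0 (S.⊕-old ⟨ d ⟩ (a n) (S.⊕-new S.zeroIdeal (S.ι (ℤ.+ d)))))
                        (a n′) ℤX.X
                        (A/.trans (A/.+-congʳ {ℤX.X} (A/.reflexive (Q/.^/≡^ (a n′) d)))
                          (A/.trans (A/.sym (Q/.incl (a-suc n′))) aₙ≈0))
                        (degree n′) (IA.monic⇒integral (a n) (degree n′ , a-monic n′) (A/.trans (ev-x (a n)) aₙ≈0))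
                        (λ f → f , A/.sym (ev-x f)) z k
                  in u , Q/.diff (A/.trans h (A/.*-congˡ {u} (A/.reflexive (Q/.^/≡^ z k))))

    module _ (l′ : ℕ) (g : ZPoly) where
      private
        l = suc l′
        ks = divisors n
        sgn : ℕ → ℤ
        sgn k = μ (safeDiv n k)
        σp σm : ℕ → Bool
        σp = σ⁺ n (s≤s z≤n)
        σm = σ⁻ n (s≤s z≤n)

        onDivisors : ∀ {P : ℕ → Set} → (∀ k → P (suc k)) → All P ks
        onDivisors {P} h = All.tabulate (λ k∈ → positive-case (proj₁ (∈-divisors⁻ n (s≤s z≤n) k∈)))
          where
          positive-case : ∀ {k} → 0 ℕ.< k → P k
          positive-case {suc k} _ = h k

        foldₘ fold₁ : ZPoly × ZPoly
        foldₘ = quotientFold sgn (Δ (suc l)) (Δ l) ks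
        fold₁ = quotientFold sgn (Δ 1) (Δ 0) ks

        abstract
          split-m : Σ ZPoly λ t → Regular t × proj₁ foldₘ S.≈ t S.* ∏ σp (B l) ks × proj₂ foldₘ S.≈ t S.* ∏ σm (B l) ks
          split-m = quotientFold-split sgn (Δ (suc l)) (Δ l) (B l) ks
            (onDivisors (λ k → Δ-suc l (suc k) , Δ-regular l k))

          split-1 : Σ ZPoly λ t → Regular t ×
            proj₁ fold₁ S.≈ t S.* ∏ σp (λ k → a k S.^ suc e) ks × proj₂ fold₁ S.≈ t S.* ∏ σm (λ k → a k S.^ suc e) ks
          split-1 = quotientFold-split sgn (Δ 1) (Δ 0) (λ k → a k S.^ suc e) ks
            (onDivisors (λ k → S.trans (Δ-one (suc k)) (S.*-congʳ {a (suc k) S.^ suc e} (S.sym (Δ-zero (suc k)))) , Δ-regular 0 k))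

      relation₀ : g S.* proj₂ foldₘ S.≈ proj₁ foldₘ →
        Relation l n 0 (s≤s z≤n) g
      relation₀ h = let t , rt , e₁ , e₂ = split-m in
        S.trans (S.*-congˡ {g S.* ∏ σm (B l) ks} (∏-1 σp ks)) (S.trans (S.*-identityʳ _)
          (S.trans (cancel t rt (S.trans
              (solve 3 (λ t g u → t :* (g :* u) := g :* (t :* u)) S.refl t g (∏ σm (B l) ks))
              (S.trans (S.*-congˡ {g} (S.sym e₂)) (S.trans h e₁))))
            (S.sym (S.trans (S.*-congˡ {∏ σp (B l) ks} (∏-1 σm ks)) (S.*-identityʳ _)))))

      relation₁ : g S.* proj₂ foldₘ S.* proj₁ fold₁ S.≈ proj₁ foldₘ S.* proj₂ fold₁ →
        Relation l n (suc e) (s≤s z≤n) g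
      relation₁ h =
        let t , rt , e₁ , e₂ = split-m
            t′ , rt′ , e₁′ , e₂′ = split-1
        in cancel (t S.* t′) (regular-* t t′ rt rt′) (S.trans
             (solve 5 (λ t t′ g u v → (t :* t′) :* (g :* u :* v)
                 := g :* (t :* u) :* (t′ :* v)) S.refl
               t t′ g (∏ σm (B l) ks) (∏ σp (λ k → a k S.^ suc e) ks))
             (S.trans (S.*-cong (S.*-congˡ {g} (S.sym e₂)) (S.sym e₁′))
               (S.trans h (S.trans (S.*-cong e₁ e₂′)
                 (solve 4 (λ t u t′ v → (t :* u) :* (t′ :* v)
                     := (t :* t′) :* (u :* v)) S.refl
                   t (∏ σp (B l) ks) t′ (∏ σm (λ k → a k S.^ suc e) ks))))))

      module _ (p : QPoly) (p∣g : ℚ[x]._∣ₚ_ p (toQ g)) (N : ℕ) (isIndex : NumberField.IndexIs p N) where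

        indivisible-case : ¬ (n ∣ l) → g S.* proj₂ foldₘ S.≈ proj₁ foldₘ → ¬ (d ∣ N)
        indivisible-case n∤l h d∣N =
          -- The goal is ⊥ here, so the double negation in `conclude` can be discharged.
          conclude l′ n′ 0 g rel (local-indivisible l′ n′ 0 g rel ≡.refl n∤l) λ (δm , ap) →
            Field.Index.At.index p e d-prime (a n) g p∣g δm (d ℕ.^ l ℕ.* suc e) ap reduced N isIndex d∣N
          where rel = relation₀ h

        divisible-case : n ∣ l → g S.* proj₂ foldₘ S.* proj₁ fold₁ S.≈ proj₁ foldₘ S.* proj₂ fold₁ → ¬ (d ∣ N)
        divisible-case n∣l h d∣N =
          conclude l′ n′ (suc e) g rel (λ k → k (local-divisible l′ n′ (suc e) g rel ≡.refl n∣l)) λ (δm , ap) →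
            Field.Index.At.index p e d-prime (a n) g p∣g δm (d ℕ.^ l ℕ.* suc e) ap reduced N isIndex d∣N
          where rel = relation₁ h

orbit-suc : ∀ d k → orbit d (suc k) S.≈ orbit d k S.^ d S.+ ℤX.X
orbit-suc d k = S.+-congʳ {ℤX.X} (S.reflexive (^ₚ≡^ (orbit d k) d))
  where
  ^ₚ≡^ : ∀ f k → f ℤX.^ₚ k ≡ f S.^ k
  ^ₚ≡^ f zero    = ≡.refl
  ^ₚ≡^ f (suc k) = ≡.cong (f ℤX.*ₚ_) (^ₚ≡^ f k)

module _ (d m n : ℕ) (g : ZPoly) where
  private
    Cases : Bool → Set
    Cases b = if b then g S.* Fden d m n S.* Fnum d 1 n ℤX.≈ₚ Fnum d m n S.* Fden d 1 n
              else g S.* Fden d m n ℤX.≈ₚ Fnum d m n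

  IsG-indivisible : ¬ (n ∣ m ℕ.∸ 1) → IsG d m n g → g S.* Fden d m n S.≈ Fnum d m n
  IsG-indivisible n∤ isG = ℤX.by-coeff (≡.subst Cases (dec-false (n ∣? (m ℕ.∸ 1)) n∤) isG)

  IsG-divisible : n ∣ m ℕ.∸ 1 → IsG d m n g → g S.* Fden d m n S.* Fnum d 1 n S.≈ Fnum d m n S.* Fden d 1 n
  IsG-divisible n∣ isG = ℤX.by-coeff (≡.subst Cases (dec-true (n ∣? (m ℕ.∸ 1)) n∣) isG)

orbit-isOrbit : ∀ d-2 → IsOrbit ℤX.polyRing constℤ (suc (suc d-2)) (orbit (suc (suc d-2))) ℤX.X
orbit-isOrbit d-2 = record { a-zero = S.refl {[]} ; a-suc = orbit-suc (suc (suc d-2)) }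

theorem1p9 : (d m n : ℕ) → Prime d → 2 ≤ m → 1 ≤ n →
    (g : ZPoly) → IsG d m n g →
    (p : QPoly) → ℚ[x].Monic p → ℚ[x].Irreducible p → ℚ[x]._∣ₚ_ p (toQ g) →
    (N : ℕ) → NumberField.IndexIs p N → ¬ (d ∣ N)
theorem1p9 zero          m n d-prime = ⊥-elim (ℕ.NonTrivial.nonTrivial (prime⇒nonTrivial d-prime))
theorem1p9 (suc zero)    m n d-prime = ⊥-elim (ℕ.NonTrivial.nonTrivial (prime⇒nonTrivial d-prime))
theorem1p9 (suc (suc e)) (suc (suc l′)) (suc n′) d-prime (s≤s (s≤s z≤n)) (s≤s z≤n) g isG p _ _ p∣g N isIndex
  with suc n′ ∣? suc l′
... | no n∤l  = AtRoot.indivisible-case e d-prime (orbit (suc (suc e))) (orbit-isOrbit e)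
    (λ k → orbitDegree e (suc k)) (orbit-monic e) (λ j k → monic-regular {orbitDegree e (j ℕ.+ suc k)} {A (suc (suc e)) j (suc k)} (A-monic e j k)) n′ l′ g p p∣g N isIndex n∤l
    (IsG-indivisible (suc (suc e)) (suc (suc l′)) (suc n′) g n∤l isG)
... | yes n∣l = AtRoot.divisible-case e d-prime (orbit (suc (suc e))) (orbit-isOrbit e)
    (λ k → orbitDegree e (suc k)) (orbit-monic e) (λ j k → monic-regular {orbitDegree e (j ℕ.+ suc k)} {A (suc (suc e)) j (suc k)} (A-monic e j k)) n′ l′ g p p∣g N isIndex n∣l
    (IsG-divisible (suc (suc e)) (suc (suc l′)) (suc n′) g n∣l isG)
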